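{- Let $G_1$ and $G_2$ be finite connected graphs (loops and multiple edges allowed), with no vertex of degree $1$, each of rank two. Then $G_1$ and $G_2$ are isomorphic if and only if $\zeta_{G_1}(u)=\zeta_{G_2}(u)$.
   Context: For a finite connected graph $G$ with vertex set $V$, edge set $E$ and no vertex of degree $1$, its rank is $r=|E|-|V|+1$. Let $\mathcal{A}$ be its adjacency matrix ($\mathcal{A}_{ij}$ = number of edges joining $v_i$ and $v_j$ for $i\neq j$; $\mathcal{A}_{ii}$ = twice the number of loops at $v_i$), and $\mathcal{Q}=D-I$ with $D$ the diagonal matrix of degrees (a loop contributes $2$ to the degree). The reciprocal Ihara zeta function is $\zeta_G(u)^{ -1}=(1-u^2)^{r-1}\det(I-\mathcal{A}u+\mathcal{Q}u^2)$. -}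

module Defs where

open import Algebra.Bundles.Raw using (RawRing)
import Algebra.Definitions.RawSemiring as RawSemiringDefs
open import Data.Bool.Base using (if_then_else_)
open import Data.Fin.Base using (Fin; zero; suc; toℕ; punchIn)
open import Data.Fin.Permutation using (Permutation; _⟨$⟩ʳ_)
open import Data.Fin.Properties using (_≟_)
open import Data.Integer.Base as ℤ using (ℤ; +_; -[1+_]; 0ℤ; 1ℤ)
import Data.Integer.Properties as ℤ
open import Data.List.Base using (List; []; _∷_; map; length; filter; allFin)
open import Data.Nat.Base as ℕ using (ℕ; zero; suc)
open import Data.Product.Base using (_×_; _,_; proj₁; proj₂; ∃)
open import Data.Product.Properties using (≡-dec)
open import Data.Sum.Base using (_⊎_)
open import Level using (0ℓ)
open import Relation.Binary.Construct.Closure.ReflexiveTransitive using (Star)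
open import Relation.Binary.PropositionalEquality
  using (_≡_; _≢_; refl; sym; trans; cong; cong₂)
open import Relation.Nullary using (Dec; does)
open import Relation.Nullary.Decidable using (_⊎-dec_)

Matrix : ∀ {a} → Set a → ℕ → Set a
Matrix A n = Fin n → Fin n → A

module _ {c ℓ} (R : RawRing c ℓ) where
  open RawRing R
  open RawSemiringDefs rawSemiring using (sum; _^_)

  -- Laplace expansion along the first row.
  det : ∀ {n} → Matrix Carrier n → Carrier
  det {zero}  M = 1#
  det {suc n} M = sum λ j →
    ((- 1#) ^ toℕ j) * M zero j * det (λ i k → M (suc i) (punchIn j k))

-- Coefficient lists, constant term first.  Trailing zeros are allowed, so
-- equality of polynomials is _≈_ (coefficientwise) and not _≡_.
Poly : Set
Poly = List ℤ

coeff : Poly → ℕ → ℤ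
coeff []      _       = 0ℤ
coeff (a ∷ p) zero    = a
coeff (a ∷ p) (suc k) = coeff p k

infix  4 _≈ₚ_
infixl 6 _+ₚ_
infixl 7 _*ₚ_

_≈ₚ_ : Poly → Poly → Set
p ≈ₚ q = ∀ k → coeff p k ≡ coeff q k

_+ₚ_ : Poly → Poly → Poly
[]      +ₚ q       = q
(a ∷ p) +ₚ []      = a ∷ p
(a ∷ p) +ₚ (b ∷ q) = (a ℤ.+ b) ∷ (p +ₚ q)

_*ₚ_ : Poly → Poly → Poly
[]      *ₚ q = []
(a ∷ p) *ₚ q = map (a ℤ.*_) q +ₚ (0ℤ ∷ (p *ₚ q))

ℤ[u] : RawRing 0ℓ 0ℓ
ℤ[u] = record
  { Carrier = Poly
  ; _≈_     = _≈ₚ_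
  ; _+_     = _+ₚ_
  ; _*_     = _*ₚ_
  ; -_      = map (ℤ.-_)
  ; 0#      = []
  ; 1#      = 1ℤ ∷ []
  }

open RawRing ℤ[u] public using () renaming (0# to 0ₚ; 1# to 1ₚ; _≉_ to _≉ₚ_)
open RawSemiringDefs (RawRing.rawSemiring ℤ[u]) public
  using () renaming (sum to sumₚ; _^_ to _^ₚ_)

1-u² : Poly
1-u² = 1ℤ ∷ 0ℤ ∷ ℤ.- 1ℤ ∷ []

-- The field of rational functions, as fractions of elements of ℤ[u].
record RationalFunction : Set where
  constructor mkFraction
  field
    num   : Poly
    den   : Poly
    den≉0 : den ≉ₚ 0ₚ

open RationalFunction public

infix 4 _≃_

_≃_ : RationalFunction → RationalFunction → Set
f ≃ g = num f *ₚ den g ≈ₚ num g *ₚ den f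

reciprocal : (f : RationalFunction) → num f ≉ₚ 0ₚ → RationalFunction
reciprocal f num≉0 = mkFraction (den f) (num f) num≉0

-- Constant terms; used only to see that denominators are nonzero.

coeff₀-+ : ∀ p q → coeff (p +ₚ q) 0 ≡ coeff p 0 ℤ.+ coeff q 0
coeff₀-+ []      q       = sym (ℤ.+-identityˡ _)
coeff₀-+ (a ∷ p) []      = sym (ℤ.+-identityʳ a)
coeff₀-+ (a ∷ p) (b ∷ q) = refl

coeff₀-scale : ∀ a q → coeff (map (a ℤ.*_) q) 0 ≡ a ℤ.* coeff q 0
coeff₀-scale a []      = sym (ℤ.*-zeroʳ a)
coeff₀-scale a (b ∷ q) = refl

coeff₀-* : ∀ p q → coeff (p *ₚ q) 0 ≡ coeff p 0 ℤ.* coeff q 0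
coeff₀-* []      q = refl
coeff₀-* (a ∷ p) q =
  trans (coeff₀-+ (map (a ℤ.*_) q) (0ℤ ∷ (p *ₚ q)))
        (trans (ℤ.+-identityʳ _) (coeff₀-scale a q))

coeff₀-^ : ∀ p n → coeff p 0 ≡ 1ℤ → coeff (p ^ₚ n) 0 ≡ 1ℤ
coeff₀-^ p zero    eq = refl
coeff₀-^ p (suc n) eq =
  trans (coeff₀-* p (p ^ₚ n)) (cong₂ ℤ._*_ eq (coeff₀-^ p n eq))

coeff₀-sum : ∀ {n} (f : Fin n → Poly) →
             (∀ j → coeff (f j) 0 ≡ 0ℤ) → coeff (sumₚ f) 0 ≡ 0ℤ
coeff₀-sum {zero}  f eq = refl
coeff₀-sum {suc n} f eq =
  trans (coeff₀-+ (f zero) _)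
        (cong₂ ℤ._+_ (eq zero) (coeff₀-sum (λ j → f (suc j)) (λ j → eq (suc j))))

coeff₀≡1⇒≉0 : ∀ p → coeff p 0 ≡ 1ℤ → p ≉ₚ 0ₚ
coeff₀≡1⇒≉0 p eq p≈0 with () ← trans (sym eq) (p≈0 0)

𝕀 : ∀ {n} → Matrix ℤ n
𝕀 i j = if does (i ≟ j) then 1ℤ else 0ℤ

coeff₀-det : ∀ {n} (M : Matrix Poly n) →
             (∀ i j → coeff (M i j) 0 ≡ 𝕀 i j) → coeff (det ℤ[u] M) 0 ≡ 1ℤ
coeff₀-det {zero}  M eq = refl
coeff₀-det {suc n} M eq =
  trans (coeff₀-+ (term zero) _)
        (cong₂ ℤ._+_ diagonal (coeff₀-sum (λ j → term (suc j)) offDiagonal))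
  where
  minor : Fin (suc n) → Matrix Poly n
  minor j i k = M (suc i) (punchIn j k)

  sign : Fin (suc n) → Poly
  sign j = map (ℤ.-_) 1ₚ ^ₚ toℕ j

  term : Fin (suc n) → Poly
  term j = sign j *ₚ M zero j *ₚ det ℤ[u] (minor j)

  diagonal : coeff (term zero) 0 ≡ 1ℤ
  diagonal =
    trans (coeff₀-* (sign zero *ₚ M zero zero) _)
          (cong₂ ℤ._*_
            (trans (coeff₀-* (sign zero) (M zero zero))
                   (cong (1ℤ ℤ.*_) (eq zero zero)))
            (coeff₀-det (minor zero) (λ i k → eq (suc i) (suc k))))

  offDiagonal : ∀ j → coeff (term (suc j)) 0 ≡ 0ℤ
  offDiagonal j =
    trans (coeff₀-* (sign (suc j) *ₚ M zero (suc j)) _)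
          (cong (ℤ._* coeff (det ℤ[u] (minor (suc j))) 0)
            (trans (coeff₀-* (sign (suc j)) (M zero (suc j)))
            (trans (cong (coeff (sign (suc j)) 0 ℤ.*_) (eq zero (suc j)))
                   (ℤ.*-zeroʳ (coeff (sign (suc j)) 0)))))

-- The order of the two endpoints of an edge carries no meaning: edges are
-- only ever inspected through Joins, degree and the unordered _≅_ below.
record Graph : Set where
  field
    #V   : ℕ
    #E   : ℕ
    ends : Fin #E → Fin #V × Fin #V

  Joins : Fin #V → Fin #V → Fin #E → Set
  Joins i j e = ends e ≡ (i , j) ⊎ ends e ≡ (j , i)

  joins? : ∀ i j e → Dec (Joins i j e)
  joins? i j e = ends e ≟² (i , j) ⊎-dec ends e ≟² (j , i)
    where _≟²_ = ≡-dec _≟_ _≟_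

  Adjacent : Fin #V → Fin #V → Set
  Adjacent i j = ∃ λ e → Joins i j e

  Connected : Set
  Connected = (#V ≢ 0) × (∀ i j → Star Adjacent i j)

  -- For i = j this counts each loop at i once.
  edgesBetween : Fin #V → Fin #V → ℕ
  edgesBetween i j = length (filter (joins? i j) (allFin #E))

  degree : Fin #V → ℕ
  degree i = length (filter (λ e → proj₁ (ends e) ≟ i) (allFin #E))
       ℕ.+ length (filter (λ e → proj₂ (ends e) ≟ i) (allFin #E))

  NoDegreeOne : Set
  NoDegreeOne = ∀ i → degree i ≢ 1

  rank : ℤ
  rank = (+ #E ℤ.- + #V) ℤ.+ 1ℤ

  𝒜 : Matrix ℤ #V
  𝒜 i j = if does (i ≟ j) then + (2 ℕ.* edgesBetween i i) else + edgesBetween i j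

  𝒟 : Matrix ℤ #V
  𝒟 i j = if does (i ≟ j) then + degree i else 0ℤ

  𝒬 : Matrix ℤ #V
  𝒬 i j = 𝒟 i j ℤ.- 𝕀 i j

  I-𝒜u+𝒬u² : Matrix Poly #V
  I-𝒜u+𝒬u² i j = 𝕀 i j ∷ ℤ.- 𝒜 i j ∷ 𝒬 i j ∷ []

open Graph public

infix 4 _≅_

record _≅_ (G H : Graph) : Set where
  field
    vertices  : Permutation (#V G) (#V H)
    edges     : Permutation (#E G) (#E H)
    incidence : ∀ e → Joins H (vertices ⟨$⟩ʳ proj₁ (ends G e))
                              (vertices ⟨$⟩ʳ proj₂ (ends G e))
                              (edges ⟨$⟩ʳ e)

-- (1 - u²)ᵏ · p, where k may be negative.
[1-u²]^_·_ : ℤ → Poly → RationalFunction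
[1-u²]^ (+ n)    · p = mkFraction ((1-u² ^ₚ n) *ₚ p) 1ₚ (coeff₀≡1⇒≉0 1ₚ refl)
[1-u²]^ -[1+ n ] · p =
  mkFraction p (1-u² ^ₚ suc n)
    (coeff₀≡1⇒≉0 (1-u² ^ₚ suc n) (coeff₀-^ 1-u² (suc n) refl))

[1-u²]^·-≉0 : ∀ k p → coeff p 0 ≡ 1ℤ → num ([1-u²]^ k · p) ≉ₚ 0ₚ
[1-u²]^·-≉0 (+ n)    p eq = coeff₀≡1⇒≉0 ((1-u² ^ₚ n) *ₚ p)
  (trans (coeff₀-* (1-u² ^ₚ n) p) (cong₂ ℤ._*_ (coeff₀-^ 1-u² n refl) eq))
[1-u²]^·-≉0 -[1+ n ] p eq = coeff₀≡1⇒≉0 p eq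

ζ⁻¹ : Graph → RationalFunction
ζ⁻¹ G = [1-u²]^ (rank G ℤ.- 1ℤ) · det ℤ[u] (I-𝒜u+𝒬u² G)

ζ⁻¹≉0 : ∀ G → num (ζ⁻¹ G) ≉ₚ 0ₚ
ζ⁻¹≉0 G = [1-u²]^·-≉0 (rank G ℤ.- 1ℤ) (det ℤ[u] (I-𝒜u+𝒬u² G))
  (coeff₀-det (I-𝒜u+𝒬u² G) (λ _ _ → refl))

ζ : Graph → RationalFunction
ζ G = reciprocal (ζ⁻¹ G) (ζ⁻¹≉0 G)

{-# OPTIONS --safe #-}

-- Smoothing the vertices of degree 2 turns a connected graph of rank two without leaves into a
-- figure eight, a dumbbell or a theta graph whose edges carry the lengths of the smoothed paths.
-- The reciprocal zeta function is ∏ₑ (1 − xₑ²) · det M for the weighted graph with xₑ = u^(length e),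
-- and eliminating a vertex of degree 2 (a Schur complement) replaces two adjacent edges of weights
-- x and y by one of weight xy without changing it.  Hence it equals
--   (1 − x)(1 − y)((1 − x)(1 − y) − 4xyz²)  for loops x, y joined by a path z (z = 1: figure eight),
--   (1 − xy − xz − yz)² − 4x²y²z²            for a theta graph.
-- Writing either polynomial P as (1 − s)² − 2t(1 − s) + t² − r with the two smallest cycle
-- weights s and t, the lowest term of r is 2u^k for theta graphs and figure eights and −2u^k for
-- dumbbells, so shape and lengths can be read off.  The value at the single point u = 10
-- suffices, since the coefficients involved are distinguished modulo 10.  Conversely, determinants
-- are invariant under simultaneous permutations of rows and columns.  All computations take place
-- in ℚ at integers u ≥ 2, where the 1 − u^(2k) are invertible; an integer polynomial is determined
-- by its values there.
module Submission where

open import Defs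
open import Algebra.Bundles using (AbelianGroup; CommutativeRing)
open import Algebra.Bundles.Raw using (RawRing)
open import Algebra.Definitions using (LeftCancellative)
import Algebra.Definitions.RawSemiring as RawSemiringDefs
import Algebra.Properties.Group as GroupProperties
import Algebra.Solver.Ring as RingSolver
import Algebra.Solver.Ring.AlmostCommutativeRing as ACR
open import Algebra.Structures using (IsCommutativeRing)
open import Data.Bool.Base using (Bool; true; false; if_then_else_; T)
open import Data.Empty using (⊥; ⊥-elim)
open import Data.Fin.Base using (Fin; zero; suc; toℕ; cast; punchIn)
open import Data.Fin.Permutation as Perm using (Permutation; _∘ₚ_; _⟨$⟩ʳ_; _⟨$⟩ˡ_)
import Data.Fin.Properties as Fin
open import Data.Integer.Base as ℤ using (ℤ; 0ℤ; 1ℤ)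
import Data.Integer.Divisibility.Signed as Divisibility
import Data.Integer.Properties as ℤ
open import Data.Integer.Solver using (module +-*-Solver)
open import Data.List.Base
  using (List; []; _∷_; _++_; _∷ʳ_; allFin; concatMap; filter; foldr; length; lookup; map; reverse; tabulate)
open import Data.List.Membership.Propositional using (_∈_; find; lose)
open import Data.List.Membership.Propositional.Properties using (∈-allFin; ∈-map⁺; ∈-∃++)
open import Data.List.Membership.Propositional.Properties.WithK using (unique∧set⇒bag)
import Data.List.Properties as List
open import Data.List.Relation.Binary.BagAndSetEquality using (∼bag⇒↭)
open import Data.List.Relation.Binary.Permutation.Propositional
  using (_↭_; refl; prep; swap; trans; ↭-sym; ↭⇒↭ₛ; module PermutationReasoning)
import Data.List.Relation.Binary.Permutation.Propositional.Properties as ↭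
import Data.List.Relation.Binary.Permutation.Setoid as PermS
import Data.List.Relation.Binary.Permutation.Setoid.Properties as PermSP
open import Data.List.Relation.Binary.Pointwise.Base using (Pointwise; []; _∷_)
open import Data.List.Relation.Unary.All as All using (All; []; _∷_)
import Data.List.Relation.Unary.All.Properties as All
open import Data.List.Relation.Unary.AllPairs using ([]; _∷_)
open import Data.List.Relation.Unary.Any using (any?; here; there)
open import Data.List.Relation.Unary.Unique.Propositional using (Unique)
open import Data.List.Relation.Unary.Unique.Propositional.Properties using (allFin⁺; map⁺)
open import Data.Maybe.Base using (Maybe; just; nothing)
open import Data.Nat.Base as ℕ using (ℕ; zero; suc; _≤_; _≤ᵇ_; z≤n; s≤s)
import Data.Nat.Coprimality as Coprimality
import Data.Nat.Properties as ℕ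
open import Data.Nat.Tactic.RingSolver using (solve-∀)
open import Data.Product.Base as Product using (_×_; _,_; proj₁; proj₂; ∃)
open import Data.Rational.Base as ℚ using (ℚ; mkℚ)
import Data.Rational.Properties as ℚ
open import Data.Rational.Unnormalised.Base using (*≡*)
import Data.Rational.Unnormalised.Properties as ℚᵘ
open import Data.Sum.Base as Sum using (_⊎_; inj₁; inj₂)
open import Function.Base using (_∘_; id)
open import Function.Bundles using (_⇔_; mk⇔)
open import Level using (0ℓ)
open import Relation.Binary.Bundles using (Setoid)
open import Relation.Binary.Construct.Closure.ReflexiveTransitive as Star using (Star; _◅_)
open import Relation.Binary.Definitions using (DecidableEquality)
open import Relation.Binary.PropositionalEquality as ≡
  using (_≡_; _≢_; cong; cong₂; subst; sym; module ≡-Reasoning)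
open import Relation.Nullary using (¬_; Dec; yes; no; does; contradiction)
open import Relation.Nullary.Decidable using (False; toWitnessFalse; dec-true; dec-false)

-- Smoothing leads out of the class of graphs on which the zeta function is defined: I - 𝒜u + 𝒬u²
-- knows edges but no lengths. Weighted arcs give a class of matrices closed under elimination, at
-- the price of the denominators 1 - xₑ², and the definition is recovered when every weight is u.
-- Smoothing can also create loops and parallel arcs, so the matrix entries are written to treat
-- them uniformly. The first three terms in the expansion of P are the square (1 - s - t)², written
-- so that s can be found before t is known: 1 - P shows the exponent of s, (1 - s)² - P that of t,
-- and what is left that of r. Cycles of equal length make these terms collide, and their
-- coefficients then add up to 4 or 6 in place of 2. Ten serves as point and as modulus because it
-- divides none of 2, 4 and 6, so that a collision never hides an exponent. The residues 2 and -2
-- separate dumbbells from the other two shapes, which are told apart by comparing exponents.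

-- Zero and one are the images of those of ℤ so that the ring solver, which has
-- integer coefficients, sees them as literals.
record ℤ-Algebra : Set₁ where
  infixl 6 _+_
  infixl 7 _*_
  infix  8 -_
  field
    Carrier           : Set
    _+_ _*_           : Carrier → Carrier → Carrier
    -_                : Carrier → Carrier
    ι                 : ℤ → Carrier
    isCommutativeRing : IsCommutativeRing _≡_ _+_ _*_ -_ (ι 0ℤ) (ι 1ℤ)
    ι-+               : ∀ i j → ι (i ℤ.+ j) ≡ ι i + ι j
    ι-*               : ∀ i j → ι (i ℤ.* j) ≡ ι i * ι j
    ι-neg             : ∀ i → ι (ℤ.- i) ≡ - ι i

  commutativeRing : CommutativeRing 0ℓ 0ℓ
  commutativeRing = record { isCommutativeRing = isCommutativeRing }

  open CommutativeRing commutativeRing public using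
    ( rawRing; 0#; 1#; _-_; +-identityˡ; +-identityʳ
    ; *-comm; *-assoc; *-identityˡ; *-identityʳ; zeroˡ; zeroʳ; distribˡ; distribʳ )

  open RawSemiringDefs (RawRing.rawSemiring rawRing) public using (_^_; sum)

  ι-morphism : ℤ.+-*-rawRing ACR.-Raw-AlmostCommutative⟶ ACR.fromCommutativeRing commutativeRing
  ι-morphism = record
    { ⟦_⟧ = ι ; +-homo = ι-+ ; *-homo = ι-* ; -‿homo = ι-neg ; 0-homo = ≡.refl ; 1-homo = ≡.refl }

  ι-≟ : ∀ i j → Maybe (ι i ≡ ι j)
  ι-≟ i j with i ℤ.≟ j
  ... | yes i≡j = just (cong ι i≡j)
  ... | no  _   = nothing

  module Solver =
    RingSolver ℤ.+-*-rawRing (ACR.fromCommutativeRing commutativeRing) ι-morphism ι-≟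

-- Determinants

module Determinant (R : ℤ-Algebra) where
  open ℤ-Algebra R
  open Solver using (solve; _:=_; _:+_; _:*_; :-_; _:-_; con)

  -- Contraction of c₁ ∧ … ∧ cₙ with the covector r, read through a functional D
  -- on such products.  Expanding a determinant along successive rows is iterating
  -- it, and the row symmetries of determinants are ι_r ι_s = − ι_s ι_r and ι_r² = 0.
  contract : ∀ {C : Set} → (C → Carrier) → (List C → Carrier) → List C → Carrier
  contract r D []       = 0#
  contract r D (c ∷ cs) = r c * D cs - contract r (λ ds → D (c ∷ ds)) cs

  -- Rows and columns are lists over an arbitrary label type instead of `Fin n`, so that a vertex is
  -- deleted by passing to a tail. Lists of unequal lengths get the value 0, and squareness stays
  -- implicit.
  minor : ∀ {C : Set} → List (C → Carrier) → List C → Carrier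
  minor []       []      = 1#
  minor []       (_ ∷ _) = 0#
  minor (r ∷ rs) cs      = contract r (minor rs) cs

  module _ {C : Set} where
    private
      Row        = C → Carrier
      Functional = List C → Carrier

    contract-cong : ∀ {r s : Row} {D E : Functional} cs → (∀ {c} → c ∈ cs → r c ≡ s c) →
                    (∀ ds → (∀ {c} → c ∈ ds → c ∈ cs) → D ds ≡ E ds) →
                    contract r D cs ≡ contract s E cs
    contract-cong []       r≗s D≗E = ≡.refl
    contract-cong (c ∷ cs) r≗s D≗E = cong₂ _-_
      (cong₂ _*_ (r≗s (here ≡.refl)) (D≗E cs there))
      (contract-cong cs (λ c∈cs → r≗s (there c∈cs))
        (λ ds ds⊆cs → D≗E (c ∷ ds) λ { (here eq) → here eq ; (there c∈ds) → there (ds⊆cs c∈ds) }))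

    contract-congʳ : ∀ (r : Row) {D E : Functional} cs →
                     (∀ ds → D ds ≡ E ds) → contract r D cs ≡ contract r E cs
    contract-congʳ r cs D≗E = contract-cong cs (λ _ → ≡.refl) (λ ds _ → D≗E ds)

    contract-*ʳ : ∀ (r : Row) a (D : Functional) cs →
                  contract r (λ ds → a * D ds) cs ≡ a * contract r D cs
    contract-*ʳ r a D []       = sym (zeroʳ a)
    contract-*ʳ r a D (c ∷ cs) = ≡.trans
      (cong (λ z → r c * (a * D cs) - z) (contract-*ʳ r a (λ ds → D (c ∷ ds)) cs))
      (solve 4 (λ x a y z → x :* (a :* y) :- a :* z := a :* (x :* y :- z)) ≡.refl _ a _ _)

    contract-*ˡ : ∀ (r : Row) a (D : Functional) cs →
                  contract (λ c → a * r c) D cs ≡ a * contract r D cs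
    contract-*ˡ r a D []       = sym (zeroʳ a)
    contract-*ˡ r a D (c ∷ cs) = ≡.trans
      (cong (λ z → a * r c * D cs - z) (contract-*ˡ r a (λ ds → D (c ∷ ds)) cs))
      (solve 4 (λ x a y z → a :* x :* y :- a :* z := a :* (x :* y :- z)) ≡.refl _ a _ _)

    contract--ʳ : ∀ (r : Row) (D E : Functional) cs →
                  contract r (λ ds → D ds - E ds) cs ≡ contract r D cs - contract r E cs
    contract--ʳ r D E []       = solve 0 (con 0ℤ := con 0ℤ :- con 0ℤ) ≡.refl
    contract--ʳ r D E (c ∷ cs) = ≡.trans
      (cong (λ z → r c * (D cs - E cs) - z)
        (contract--ʳ r (λ ds → D (c ∷ ds)) (λ ds → E (c ∷ ds)) cs))
      (solve 5 (λ x y z p q → x :* (y :- z) :- (p :- q) := (x :* y :- p) :- (x :* z :- q))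
        ≡.refl _ _ _ _ _)

    contract--ˡ : ∀ (r s : Row) (D : Functional) cs →
                  contract (λ c → r c - s c) D cs ≡ contract r D cs - contract s D cs
    contract--ˡ r s D []       = solve 0 (con 0ℤ := con 0ℤ :- con 0ℤ) ≡.refl
    contract--ˡ r s D (c ∷ cs) = ≡.trans
      (cong (λ z → (r c - s c) * D cs - z) (contract--ˡ r s (λ ds → D (c ∷ ds)) cs))
      (solve 5 (λ x y d p q → (x :- y) :* d :- (p :- q) := (x :* d :- p) :- (y :* d :- q))
        ≡.refl _ _ _ _ _)

    -- The first factor is absorbed by `r`, by `s`, or by neither; in the last case both
    -- contractions pass over it and their signs cancel.
    contract-contract : ∀ (r s : Row) (D : Functional) c cs →
      contract r (contract s D) (c ∷ cs) ≡
      r c * contract s D cs - s c * contract r D cs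
        + contract r (contract s (λ ds → D (c ∷ ds))) cs
    contract-contract r s D c cs = begin
      r c * contract s D cs - contract r (λ ds → s c * D ds - contract s D′ ds) cs
        ≡⟨ cong₂ _-_ ≡.refl (contract--ʳ r (λ ds → s c * D ds) (contract s D′) cs) ⟩
      r c * contract s D cs - (contract r (λ ds → s c * D ds) cs - contract r (contract s D′) cs)
        ≡⟨ cong₂ _-_ ≡.refl (cong₂ _-_ (contract-*ʳ r (s c) D cs) ≡.refl) ⟩
      r c * contract s D cs - (s c * contract r D cs - contract r (contract s D′) cs)
        ≡⟨ solve 3 (λ x y z → x :- (y :- z) := x :- y :+ z) ≡.refl _ _ _ ⟩
      r c * contract s D cs - s c * contract r D cs + contract r (contract s D′) cs ∎
      where
      open ≡-Reasoning
      D′ : Functional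
      D′ ds = D (c ∷ ds)

    contract-anticomm : ∀ (r s : Row) (D : Functional) cs →
      contract r (contract s D) cs ≡ - contract s (contract r D) cs
    contract-anticomm r s D []       = solve 0 (con 0ℤ := :- con 0ℤ) ≡.refl
    contract-anticomm r s D (c ∷ cs) = begin
      contract r (contract s D) (c ∷ cs)
        ≡⟨ contract-contract r s D c cs ⟩
      r c * contract s D cs - s c * contract r D cs + contract r (contract s D′) cs
        ≡⟨ cong₂ _+_ ≡.refl (contract-anticomm r s D′ cs) ⟩
      r c * contract s D cs - s c * contract r D cs + - contract s (contract r D′) cs
        ≡⟨ solve 3 (λ x y z → x :- y :+ :- z := :- (y :- x :+ z)) ≡.refl _ _ _ ⟩
      - (s c * contract r D cs - r c * contract s D cs + contract s (contract r D′) cs)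
        ≡⟨ cong -_ (contract-contract s r D c cs) ⟨
      - contract s (contract r D) (c ∷ cs) ∎
      where
      open ≡-Reasoning
      D′ : Functional
      D′ ds = D (c ∷ ds)

    -- Anticommutativity says only that this value equals its own negative, and 2 need not be
    -- cancellable in a `ℤ-Algebra`; hence a separate induction.
    contract² : ∀ (r : Row) (D : Functional) cs → contract r (contract r D) cs ≡ 0#
    contract² r D []       = ≡.refl
    contract² r D (c ∷ cs) = ≡.trans (contract-contract r r D c cs)
      (≡.trans (cong₂ _+_ ≡.refl (contract² r (λ ds → D (c ∷ ds)) cs))
               (solve 1 (λ x → x :- x :+ con 0ℤ := con 0ℤ) ≡.refl _))

    data Transposed : List C → List C → Set where
      here  : ∀ {c d cs} → Transposed (c ∷ d ∷ cs) (d ∷ c ∷ cs)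
      there : ∀ {c cs ds} → Transposed cs ds → Transposed (c ∷ cs) (c ∷ ds)

    Antisymmetric : Functional → Set
    Antisymmetric D = ∀ {cs ds} → Transposed cs ds → D cs ≡ - D ds

    contract-antisymmetric : ∀ (r : Row) {D} → Antisymmetric D → Antisymmetric (contract r D)
    contract-antisymmetric r {D} anti (here {c} {d} {cs}) = begin
      r c * D (d ∷ cs) - (r d * D (c ∷ cs) - contract r (λ ds → D (c ∷ d ∷ ds)) cs)
        ≡⟨ cong₂ _-_ ≡.refl (cong₂ _-_ ≡.refl swapped) ⟩
      r c * D (d ∷ cs) - (r d * D (c ∷ cs) - (- 1#) * contract r (λ ds → D (d ∷ c ∷ ds)) cs)
        ≡⟨ solve 3 (λ x y z → x :- (y :- (:- con 1ℤ) :* z) := :- (y :- (x :- z))) ≡.refl _ _ _ ⟩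
      - (r d * D (c ∷ cs) - (r c * D (d ∷ cs) - contract r (λ ds → D (d ∷ c ∷ ds)) cs)) ∎
      where
      open ≡-Reasoning
      swapped : contract r (λ ds → D (c ∷ d ∷ ds)) cs ≡
                (- 1#) * contract r (λ ds → D (d ∷ c ∷ ds)) cs
      swapped = ≡.trans
        (contract-congʳ r cs λ ds → ≡.trans (anti here)
          (solve 1 (λ x → :- x := (:- con 1ℤ) :* x) ≡.refl _))
        (contract-*ʳ r (- 1#) (λ ds → D (d ∷ c ∷ ds)) cs)
    contract-antisymmetric r {D} anti (there {c} t) = ≡.trans
      (cong₂ (λ x y → r c * x - y) (anti t) (contract-antisymmetric r (λ t′ → anti (there t′)) t))
      (solve 3 (λ x y z → x :* (:- y) :- :- z := :- (x :* y :- z)) ≡.refl _ _ _)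

    minor-antisymmetric : ∀ (rs : List Row) → Antisymmetric (minor rs)
    minor-antisymmetric []       here      = solve 0 (con 0ℤ := :- con 0ℤ) ≡.refl
    minor-antisymmetric []       (there _) = solve 0 (con 0ℤ := :- con 0ℤ) ≡.refl
    minor-antisymmetric (r ∷ rs) t         = contract-antisymmetric r (minor-antisymmetric rs) t

    -- One derivation of `vs ↭ ws` reorders both the rows and the columns, so both pick up the same
    -- `ε`. A simultaneous reordering then costs `ε * ε`, which is why the square is all that is
    -- recorded about the sign.
    record Sign (M : C → Row) (vs ws : List C) : Set where
      field
        ε        : Carrier
        ε²       : ε * ε ≡ 1#
        onColumn : ∀ {D} → Antisymmetric D → D vs ≡ ε * D ws
        onRow    : ∀ cs → minor (map M vs) cs ≡ ε * minor (map M ws) cs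

    sign : ∀ M {vs ws} → vs ↭ ws → Sign M vs ws
    sign M refl = record
      { ε = 1# ; ε² = *-identityˡ 1#
      ; onColumn = λ _ → sym (*-identityˡ _) ; onRow = λ _ → sym (*-identityˡ _) }
    sign M (prep v p) = record
      { ε = ε ; ε² = ε²
      ; onColumn = λ anti → onColumn (λ t → anti (there t))
      ; onRow = λ cs → ≡.trans (contract-congʳ (M v) cs onRow) (contract-*ʳ (M v) ε _ cs) }
      where open Sign (sign M p)
    sign M (swap {xs} {ys} v w p) = record
      { ε = - ε
      ; ε² = ≡.trans (solve 1 (λ x → (:- x) :* (:- x) := x :* x) ≡.refl ε) ε²
      ; onColumn = λ anti → ≡.trans (anti here)
          (≡.trans (cong -_ (onColumn (λ t → anti (there (there t))))) (neg-* _))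
      ; onRow = λ cs → ≡.trans (contract-anticomm (M v) (M w) _ cs)
          (≡.trans (cong -_ (≡.trans
            (contract-congʳ (M w) cs λ ds → ≡.trans (contract-congʳ (M v) ds onRow)
                                                    (contract-*ʳ (M v) ε _ ds))
            (contract-*ʳ (M w) ε _ cs))) (neg-* _)) }
      where
      open Sign (sign M p)
      neg-* : ∀ x → - (ε * x) ≡ (- ε) * x
      neg-* x = solve 2 (λ ε x → :- (ε :* x) := (:- ε) :* x) ≡.refl ε x
    sign M (trans p q) = record
      { ε = P.ε * Q.ε
      ; ε² = ≡.trans (solve 2 (λ x y → (x :* y) :* (x :* y) := (x :* x) :* (y :* y)) ≡.refl P.ε Q.ε)
               (≡.trans (cong₂ _*_ P.ε² Q.ε²) (*-identityˡ 1#))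
      ; onColumn = λ anti → ≡.trans (P.onColumn anti)
          (≡.trans (cong (P.ε *_) (Q.onColumn anti)) (sym (*-assoc _ _ _)))
      ; onRow = λ cs → ≡.trans (P.onRow cs)
          (≡.trans (cong (P.ε *_) (Q.onRow cs)) (sym (*-assoc _ _ _))) }
      where
      module P = Sign (sign M p)
      module Q = Sign (sign M q)

    detOn : (C → Row) → List C → Carrier
    detOn M vs = minor (map M vs) vs

    detOn-↭ : ∀ M {vs ws} → vs ↭ ws → detOn M vs ≡ detOn M ws
    detOn-↭ M {vs} {ws} p = begin
      minor (map M vs) vs           ≡⟨ onRow vs ⟩
      ε * minor (map M ws) vs       ≡⟨ cong (ε *_) (onColumn (minor-antisymmetric (map M ws))) ⟩
      ε * (ε * minor (map M ws) ws) ≡⟨ *-assoc ε ε _ ⟨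
      ε * ε * minor (map M ws) ws   ≡⟨ cong (_* minor (map M ws) ws) ε² ⟩
      1# * minor (map M ws) ws      ≡⟨ *-identityˡ _ ⟩
      minor (map M ws) ws           ∎
      where
      open ≡-Reasoning
      open Sign (sign M p)

    minor-cong : ∀ {M N : C → Row} vs cs → (∀ {i j} → i ∈ vs → j ∈ cs → M i j ≡ N i j) →
                 minor (map M vs) cs ≡ minor (map N vs) cs
    minor-cong []       []       M≗N = ≡.refl
    minor-cong []       (_ ∷ _)  M≗N = ≡.refl
    minor-cong (v ∷ vs) cs       M≗N = contract-cong cs (M≗N (here ≡.refl))
      (λ ds ds⊆cs → minor-cong vs ds (λ i∈vs j∈ds → M≗N (there i∈vs) (ds⊆cs j∈ds)))

    detOn-cong : ∀ {M N : C → Row} vs → (∀ {i j} → i ∈ vs → j ∈ vs → M i j ≡ N i j) →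
                 detOn M vs ≡ detOn N vs
    detOn-cong vs = minor-cong vs vs

    minor-* : ∀ a (M : C → Row) vs cs →
              minor (map (λ i j → a * M i j) vs) cs ≡ a ^ length vs * minor (map M vs) cs
    minor-* a M []       cs = sym (*-identityˡ _)
    minor-* a M (v ∷ vs) cs = begin
      contract (λ j → a * M v j) (minor (map (λ i j → a * M i j) vs)) cs
        ≡⟨ contract-*ˡ (M v) a _ cs ⟩
      a * contract (M v) (minor (map (λ i j → a * M i j) vs)) cs
        ≡⟨ cong (a *_) (contract-congʳ (M v) cs (minor-* a M vs)) ⟩
      a * contract (M v) (λ ds → a ^ length vs * minor (map M vs) ds) cs
        ≡⟨ cong (a *_) (contract-*ʳ (M v) (a ^ length vs) _ cs) ⟩
      a * (a ^ length vs * contract (M v) (minor (map M vs)) cs)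
        ≡⟨ *-assoc a _ _ ⟨
      a * a ^ length vs * contract (M v) (minor (map M vs)) cs ∎
      where open ≡-Reasoning

    minor-vanish : ∀ (M : C → Row) v vs cs → (∀ i → M i v ≡ 0#) →
                   minor (map M vs) (v ∷ cs) ≡ 0#
    minor-vanish M v []       cs Mv≡0 = ≡.refl
    minor-vanish M v (w ∷ ws) cs Mv≡0 = begin
      M w v * minor (map M ws) cs - contract (M w) (λ ds → minor (map M ws) (v ∷ ds)) cs
        ≡⟨ cong₂ _-_ (cong₂ _*_ (Mv≡0 w) ≡.refl)
            (≡.trans (contract-congʳ (M w) cs λ ds →
                       ≡.trans (minor-vanish M v ws ds Mv≡0) (sym (zeroˡ 0#)))
                     (contract-*ʳ (M w) 0# (λ _ → 0#) cs)) ⟩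
      0# * minor (map M ws) cs - 0# * contract (M w) (λ _ → 0#) cs
        ≡⟨ solve 2 (λ x y → con 0ℤ :* x :- con 0ℤ :* y := con 0ℤ) ≡.refl _ _ ⟩
      0# ∎
      where open ≡-Reasoning

    -- Row operations: since `s` is contracted as well, a multiple of `s` inside another row
    -- produces a double contraction with `s`, which is 0. Anticommutativity brings `s` next to each
    -- row in turn.
    contract-reduce : ∀ (M : C → Row) (s : Row) (t : C → Carrier) vs cs →
      contract s (minor (map (λ i j → M i j - t i * s j) vs)) cs ≡ contract s (minor (map M vs)) cs
    contract-reduce M s t []       cs = ≡.refl
    contract-reduce M s t (v ∷ vs) cs = begin
      contract s (contract r′ (minor (map M′ vs))) cs
        ≡⟨ contract-anticomm s r′ _ cs ⟩
      - contract r′ (contract s (minor (map M′ vs))) cs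
        ≡⟨ cong -_ (contract-congʳ r′ cs (contract-reduce M s t vs)) ⟩
      - contract r′ (contract s (minor (map M vs))) cs
        ≡⟨ contract-anticomm s r′ _ cs ⟨
      contract s (contract r′ (minor (map M vs))) cs
        ≡⟨ contract-congʳ s cs (λ ds → ≡.trans (contract--ˡ (M v) (λ j → t v * s j) _ ds)
                                               (cong₂ _-_ ≡.refl (contract-*ˡ s (t v) _ ds))) ⟩
      contract s (λ ds → contract (M v) D ds - t v * contract s D ds) cs
        ≡⟨ contract--ʳ s (contract (M v) D) (λ ds → t v * contract s D ds) cs ⟩
      contract s (contract (M v) D) cs - contract s (λ ds → t v * contract s D ds) cs
        ≡⟨ cong₂ _-_ ≡.refl (≡.trans (contract-*ʳ s (t v) (contract s D) cs)
                                       (cong (t v *_) (contract² s D cs))) ⟩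
      contract s (contract (M v) D) cs - t v * 0#
        ≡⟨ solve 2 (λ x y → x :- y :* con 0ℤ := x) ≡.refl _ _ ⟩
      contract s (contract (M v) D) cs ∎
      where
      open ≡-Reasoning
      M′ : C → Row
      M′ i j = M i j - t i * s j
      r′ : Row
      r′ = M′ v
      D : Functional
      D = minor (map M vs)

    -- Once multiples of row `v` have cleared column `v` in the other rows, every term of the
    -- expansion along row `v` that leaves column `v` to them vanishes. The quotients M i v / M v v
    -- enter as the function `t`, characterised by an equation instead of a division.
    schur : ∀ (M : C → Row) v vs (t : C → Carrier) → (∀ i → t i * M v v ≡ M i v) →
            detOn M (v ∷ vs) ≡ M v v * detOn (λ i j → M i j - t i * M v j) vs
    schur M v vs t pivot = begin
      contract (M v) (minor (map M vs)) (v ∷ vs)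
        ≡⟨ contract-reduce M (M v) t vs (v ∷ vs) ⟨
      M v v * minor (map M′ vs) vs - contract (M v) (λ ds → minor (map M′ vs) (v ∷ ds)) vs
        ≡⟨ cong₂ _-_ ≡.refl
            (≡.trans (contract-congʳ (M v) vs λ ds →
                       ≡.trans (minor-vanish M′ v vs ds column-vanishes) (sym (zeroˡ 0#)))
                     (contract-*ʳ (M v) 0# (λ _ → 0#) vs)) ⟩
      M v v * minor (map M′ vs) vs - 0# * contract (M v) (λ _ → 0#) vs
        ≡⟨ solve 2 (λ x y → x :- con 0ℤ :* y := x) ≡.refl _ _ ⟩
      M v v * minor (map M′ vs) vs ∎
      where
      open ≡-Reasoning
      M′ : C → Row
      M′ i j = M i j - t i * M v j
      column-vanishes : ∀ i → M′ i v ≡ 0#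
      column-vanishes i = ≡.trans (cong (λ z → M i v - z) (pivot i))
        (solve 1 (λ x → x :- x := con 0ℤ) ≡.refl (M i v))

  contract-map : ∀ {B C : Set} (σ : B → C) r D cs →
                 contract r D (map σ cs) ≡ contract (r ∘ σ) (D ∘ map σ) cs
  contract-map σ r D []       = ≡.refl
  contract-map σ r D (c ∷ cs) = cong₂ _-_ ≡.refl (contract-map σ r (λ ds → D (σ c ∷ ds)) cs)

  minor-map : ∀ {B C : Set} (σ : B → C) M vs cs →
              minor (map M (map σ vs)) (map σ cs) ≡ minor (map (λ i j → M (σ i) (σ j)) vs) cs
  minor-map σ M []       []       = ≡.refl
  minor-map σ M []       (_ ∷ _)  = ≡.refl
  minor-map σ M (v ∷ vs) cs       = ≡.trans (contract-map σ (M (σ v)) _ cs)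
    (contract-congʳ (M (σ v) ∘ σ) cs (minor-map σ M vs))

  -- Generalising over the column family `c` and the functional `D` makes the sum over `suc j`
  -- another instance of the same statement: column `c zero` moves into `D`, and the extra factor -1
  -- of each term becomes the minus sign in `contract`.
  laplace-contract : ∀ {n} {C : Set} (r : C → Carrier) (D : List C → Carrier) (c : Fin (suc n) → C) →
    sum (λ j → (- 1#) ^ toℕ j * r (c j) * D (tabulate (λ k → c (punchIn j k)))) ≡
    contract r D (tabulate c)
  laplace-contract {zero}  r D c =
    solve 2 (λ x y → con 1ℤ :* x :* y :+ con 0ℤ := x :* y :- con 0ℤ) ≡.refl _ _
  laplace-contract {suc n} r D c = cong₂ _+_
    (cong₂ _*_ (*-identityˡ _) ≡.refl)
    (≡.trans (negate-sum term λ j →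
               solve 4 (λ s x y e → (e :* s) :* x :* y := e :* (s :* x :* y)) ≡.refl
                 ((- 1#) ^ toℕ j) (r (c (suc j))) (D (tabulate (λ k → c (punchIn (suc j) k)))) (- 1#))
      (≡.trans (cong ((- 1#) *_) (laplace-contract r (λ ds → D (c zero ∷ ds)) (c ∘ suc)))
               (solve 1 (λ x → (:- con 1ℤ) :* x := :- x) ≡.refl _)))
    where
    term : Fin (suc n) → Carrier
    term j = (- 1#) ^ toℕ j * r (c (suc j)) * D (c zero ∷ tabulate (λ k → c (suc (punchIn j k))))

    negate-sum : ∀ {m} (g : Fin m → Carrier) {f : Fin m → Carrier} →
                 (∀ j → f j ≡ (- 1#) * g j) → sum f ≡ (- 1#) * sum g
    negate-sum {zero}  g eq = solve 0 (con 0ℤ := (:- con 1ℤ) :* con 0ℤ) ≡.refl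
    negate-sum {suc m} g eq = ≡.trans
      (cong₂ _+_ (eq zero) (negate-sum (g ∘ suc) (eq ∘ suc))) (sym (distribˡ _ _ _))

  sum-cong : ∀ {n} {f g : Fin n → Carrier} → (∀ j → f j ≡ g j) → sum f ≡ sum g
  sum-cong {zero}  eq = ≡.refl
  sum-cong {suc n} eq = cong₂ _+_ (eq zero) (sum-cong (eq ∘ suc))

  det≡minor : ∀ {n} {C : Set} (r : Fin n → C → Carrier) (c : Fin n → C) →
              det rawRing (λ i j → r i (c j)) ≡ minor (tabulate r) (tabulate c)
  det≡minor {zero}  r c = ≡.refl
  det≡minor {suc n} r c = ≡.trans
    (sum-cong λ j → cong ((- 1#) ^ toℕ j * r zero (c j) *_) (det≡minor (r ∘ suc) (λ k → c (punchIn j k))))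
    (laplace-contract (r zero) (minor (tabulate (r ∘ suc))) c)

-- Graphs whose edges are paths

SameEdge : ∀ {V : Set} → V × V → V × V → Set
SameEdge e f = e ≡ f ⊎ e ≡ Product.swap f

edgeSetoid : Set → Setoid 0ℓ 0ℓ
edgeSetoid V = record
  { Carrier = V × V
  ; _≈_ = SameEdge
  ; isEquivalence = record
    { refl  = inj₁ ≡.refl
    ; sym   = λ { (inj₁ ≡.refl) → inj₁ ≡.refl ; (inj₂ ≡.refl) → inj₂ ≡.refl }
    ; trans = λ { (inj₁ ≡.refl) q → q
                ; (inj₂ ≡.refl) (inj₁ ≡.refl) → inj₂ ≡.refl
                ; (inj₂ ≡.refl) (inj₂ ≡.refl) → inj₁ ≡.refl } } }

module _ {V : Set} where
  open PermS (edgeSetoid V) public using () renaming (_↭_ to _↭ᴱ_)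

-- A path of edges from its first to its last component through the vertices listed
-- in between.
Arc : Set → Set
Arc V = V × List V × V

interior : ∀ {V} → Arc V → List V
interior (_ , xs , _) = xs

path : ∀ {V : Set} → V → List V → V → List (V × V)
path s []       t = (s , t) ∷ []
path s (x ∷ xs) t = (s , x) ∷ path x xs t

edgesOf : ∀ {V} → Arc V → List (V × V)
edgesOf (s , xs , t) = path s xs t

path-++ : ∀ {V : Set} (s : V) xs v ys t → path s (xs ++ v ∷ ys) t ≡ path s xs v ++ path v ys t
path-++ s []       v ys t = ≡.refl
path-++ s (x ∷ xs) v ys t = cong ((s , x) ∷_) (path-++ x xs v ys t)

flip : ∀ {V} → Arc V → Arc V
flip (s , xs , t) = (t , reverse xs , s)

infix 4 _~_
-- Lists of arcs up to order and orientation. Turning an arc around also reverses its interior. As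
-- the moves act at the head only, an invariant has to be checked for one flip and one exchange.
data _~_ {V : Set} : List (Arc V) → List (Arc V) → Set where
  ~refl  : ∀ {es} → es ~ es
  ~flip  : ∀ {e es} → e ∷ es ~ flip e ∷ es
  ~swap  : ∀ {e f es} → e ∷ f ∷ es ~ f ∷ e ∷ es
  ~cons  : ∀ {e es fs} → es ~ fs → e ∷ es ~ e ∷ fs
  ~trans : ∀ {es fs gs} → es ~ fs → fs ~ gs → es ~ gs

module _ {V : Set} where
  private
    module E  = PermS (edgeSetoid V)
    module EP = PermSP (edgeSetoid V)

  flip-involutive : ∀ (e : Arc V) → flip (flip e) ≡ e
  flip-involutive (s , xs , t) = cong (λ xs → s , xs , t) (List.reverse-involutive xs)

  ~sym : ∀ {es fs : List (Arc V)} → es ~ fs → fs ~ es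
  ~sym ~refl                 = ~refl
  ~sym (~flip {e} {es})      = subst (λ e′ → flip e ∷ es ~ e′ ∷ es) (flip-involutive e) ~flip
  ~sym ~swap                 = ~swap
  ~sym (~cons es~fs)         = ~cons (~sym es~fs)
  ~sym (~trans es~fs fs~gs)  = ~trans (~sym fs~gs) (~sym es~fs)

  All-~ : ∀ {P : Arc V → Set} → (∀ {e} → P e → P (flip e)) →
          ∀ {es fs} → es ~ fs → All P es → All P fs
  All-~ P-flip ~refl                ps             = ps
  All-~ P-flip ~flip                (p ∷ ps)       = P-flip p ∷ ps
  All-~ P-flip ~swap                (p ∷ q ∷ ps)   = q ∷ p ∷ ps
  All-~ P-flip (~cons es~fs)        (p ∷ ps)       = p ∷ All-~ P-flip es~fs ps
  All-~ P-flip (~trans es~fs fs~gs) ps             = All-~ P-flip fs~gs (All-~ P-flip es~fs ps)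

  -- Degrees, the number of arcs, the product of the 1 - xₑ² and the matrix entries are all folds of
  -- this kind, so their invariance comes down to that of a single term under `flip`.
  foldr-~ : ∀ {X : Set} (_∙_ : X → X → X) (ε : X) (w : Arc V → X) →
            (∀ x y z → x ∙ (y ∙ z) ≡ y ∙ (x ∙ z)) → (∀ e → w (flip e) ≡ w e) →
            ∀ {es fs} → es ~ fs →
            foldr (λ e z → w e ∙ z) ε es ≡ foldr (λ e z → w e ∙ z) ε fs
  foldr-~ {X} _∙_ ε w exchange w-flip = go
    where
    go : ∀ {es fs} → es ~ fs → foldr (λ e z → w e ∙ z) ε es ≡ foldr (λ e z → w e ∙ z) ε fs
    go ~refl                 = ≡.refl
    go (~flip {e} {es})      = cong (_∙ foldr (λ e z → w e ∙ z) ε es) (sym (w-flip e))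
    go ~swap                 = exchange _ _ _
    go (~cons {e} es~fs)     = cong (w e ∙_) (go es~fs)
    go (~trans es~fs fs~gs)  = ≡.trans (go es~fs) (go fs~gs)

  interiors-~ : ∀ {es fs : List (Arc V)} → es ~ fs → concatMap interior es ↭ concatMap interior fs
  interiors-~ ~refl                   = refl
  interiors-~ (~flip {_ , xs , _})    = ↭.++⁺ʳ _ (↭-sym (↭.↭-reverse xs))
  interiors-~ (~swap {e} {f})         = ↭.shifts (interior e) (interior f)
  interiors-~ (~cons {e} es~fs)       = ↭.++⁺ˡ (interior e) (interiors-~ es~fs)
  interiors-~ (~trans es~fs fs~gs)    = trans (interiors-~ es~fs) (interiors-~ fs~gs)

  path-reverse : ∀ (s : V) xs t → path s xs t ↭ᴱ path t (reverse xs) s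
  path-reverse s []       t = E.prep (inj₂ ≡.refl) E.↭-refl
  path-reverse s (x ∷ xs) t = begin
    (s , x) ∷ path x xs t                   ↭⟨ E.prep (inj₂ ≡.refl) (path-reverse x xs t) ⟩
    (x , s) ∷ path t (reverse xs) x         ↭⟨ EP.++-comm ((x , s) ∷ []) _ ⟩
    path t (reverse xs) x ++ (x , s) ∷ []   ≡⟨ path-++ t (reverse xs) x [] s ⟨
    path t (reverse xs ∷ʳ x) s              ≡⟨ cong (λ xs → path t xs s) (List.unfold-reverse x xs) ⟨
    path t (reverse (x ∷ xs)) s             ∎
    where
    open E.PermutationReasoning

  edges-~ : ∀ {es fs : List (Arc V)} → es ~ fs → concatMap edgesOf es ↭ᴱ concatMap edgesOf fs
  edges-~ ~refl                     = E.↭-refl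
  edges-~ (~flip {s , xs , t})      = EP.++⁺ʳ _ (path-reverse s xs t)
  edges-~ (~swap {e} {f})           = EP.shifts (edgesOf e) (edgesOf f)
  edges-~ (~cons {e} es~fs)         = EP.++⁺ˡ (edgesOf e) (edges-~ es~fs)
  edges-~ (~trans es~fs fs~gs)      = E.↭-trans (edges-~ es~fs) (edges-~ fs~gs)

module ArcGraph {V : Set} (_≟_ : DecidableEquality V) where

  [_≐_] : V → V → ℕ
  [ v ≐ w ] = if does (v ≟ w) then 1 else 0

  [≐]-refl : ∀ v → [ v ≐ v ] ≡ 1
  [≐]-refl v rewrite dec-true (v ≟ v) ≡.refl = ≡.refl

  [≐]-≢ : ∀ {v w} → v ≢ w → [ v ≐ w ] ≡ 0
  [≐]-≢ {v} {w} v≢w rewrite dec-false (v ≟ w) v≢w = ≡.refl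

  incidence : V → Arc V → ℕ
  incidence v (s , _ , t) = [ s ≐ v ] ℕ.+ [ t ≐ v ]

  deg : List (Arc V) → V → ℕ
  deg es v = foldr (λ e z → incidence v e ℕ.+ z) 0 es

  deg-~ : ∀ {es fs} → es ~ fs → ∀ v → deg es v ≡ deg fs v
  deg-~ es~fs v = foldr-~ ℕ._+_ 0 (incidence v) exchange
    (λ { (s , _ , t) → ℕ.+-comm [ t ≐ v ] [ s ≐ v ] }) es~fs
    where
    exchange : ∀ x y z → x ℕ.+ (y ℕ.+ z) ≡ y ℕ.+ (x ℕ.+ z)
    exchange = solve-∀

  length-~ : ∀ {es fs : List (Arc V)} → es ~ fs → length es ≡ length fs
  length-~ = foldr-~ ℕ._+_ 0 (λ _ → 1) exchange (λ _ → ≡.refl)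
    where
    exchange : ∀ x y z → x ℕ.+ (y ℕ.+ z) ≡ y ℕ.+ (x ℕ.+ z)
    exchange = solve-∀

  deg≡0⇒avoids : ∀ es {v} → deg es v ≡ 0 → All (λ (s , _ , t) → s ≢ v × t ≢ v) es
  deg≡0⇒avoids []                 _    = []
  deg≡0⇒avoids ((s , xs , t) ∷ es) {v} eq with s ≟ v | t ≟ v
  ... | no s≢v | no t≢v = (s≢v , t≢v) ∷ deg≡0⇒avoids es eq

  pull : ∀ es {v} → deg es v ≢ 0 → ∃ λ xs → ∃ λ t → ∃ λ fs → es ~ (v , xs , t) ∷ fs
  pull []                  deg≢0 = contradiction ≡.refl deg≢0
  pull ((s , xs , t) ∷ es) {v} deg≢0 with s ≟ v | t ≟ v
  ... | yes ≡.refl | _          = xs , t , es , ~refl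
  ... | no _       | yes ≡.refl = reverse xs , s , es , ~flip
  ... | no _       | no _       with pull es deg≢0
  ...   | ys , w , fs , es~ = ys , w , (s , xs , t) ∷ fs , ~trans (~cons es~) ~swap

  -- Connectedness is expressed by two-colourings: one that is constant on every arc is constant on
  -- `vs`. Smoothing then has to extend a colouring to the deleted vertex, and no walk needs
  -- rerouting. The field `count` is rank two in the form |E| = |V| + 1; smoothing lowers both
  -- numbers by one.
  record WellFormed (vs : List V) (es : List (Arc V)) : Set where
    field
      unique    : Unique vs
      inside    : All (λ (s , _ , t) → s ∈ vs × t ∈ vs) es
      connected : ∀ (f : V → Bool) → All (λ (s , _ , t) → f s ≡ f t) es →
                  ∀ {x y} → x ∈ vs → y ∈ vs → f x ≡ f y
      deg≥2     : ∀ {v} → v ∈ vs → 2 ≤ deg es v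
      count     : length es ≡ suc (length vs)

  WellFormed-resp : ∀ {vs ws es fs} → vs ↭ ws → es ~ fs → WellFormed vs es → WellFormed ws fs
  WellFormed-resp {vs} {ws} vs↭ws es~fs wf = record
    { unique    = PermSP.Unique-resp-↭ (≡.setoid V) (↭⇒↭ₛ vs↭ws) unique
    ; inside    = All-~ (λ (p , q) → q , p) es~fs (All.map (λ (p , q) → fwd p , fwd q) inside)
    ; connected = λ f fs-const x∈ y∈ →
                    connected f (All-~ sym (~sym es~fs) fs-const) (bwd x∈) (bwd y∈)
    ; deg≥2     = λ v∈ → subst (2 ≤_) (deg-~ es~fs _) (deg≥2 (bwd v∈))
    ; count     = ≡.trans (sym (length-~ es~fs)) (≡.trans count (cong suc (↭.↭-length vs↭ws)))
    }
    where
    open WellFormed wf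
    fwd : ∀ {x} → x ∈ vs → x ∈ ws
    fwd = ↭.∈-resp-↭ vs↭ws
    bwd : ∀ {x} → x ∈ ws → x ∈ vs
    bwd = ↭.∈-resp-↭ (↭-sym vs↭ws)

  ∈-tail : ∀ {x v} {vs : List V} → x ∈ v ∷ vs → x ≢ v → x ∈ vs
  ∈-tail (here x≡v) x≢v = contradiction x≡v x≢v
  ∈-tail (there x∈) _   = x∈

  Unique-head : ∀ {v x} {vs : List V} → Unique (v ∷ vs) → x ∈ vs → x ≢ v
  Unique-head (v≢ ∷ _) x∈ x≡v = All.lookup v≢ x∈ (sym x≡v)

  -- By connectedness `v` would be the only vertex. Rank two then demands a second arc, which would
  -- have to end at `v` too.
  no-isolated-loop : ∀ {v vs xs es} → WellFormed (v ∷ vs) ((v , xs , v) ∷ es) → deg es v ≡ 0 → ⊥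
  no-isolated-loop {v} {vs} {xs} {es} wf deg≡0 = go vs es unique inside avoids count all-v
    where
    open WellFormed wf
    avoids : All (λ (s , _ , t) → s ≢ v × t ≢ v) es
    avoids = deg≡0⇒avoids es deg≡0

    all-v : ∀ {x} → x ∈ vs → does (v ≟ v) ≡ does (x ≟ v)
    all-v x∈ = connected (λ x → does (x ≟ v))
      (≡.refl ∷ All.map (λ {(s , _ , t)} (s≢v , t≢v) →
        ≡.trans (dec-false (s ≟ v) s≢v) (sym (dec-false (t ≟ v) t≢v))) avoids)
      (here ≡.refl) (there x∈)

    go : ∀ vs es → Unique (v ∷ vs) →
         All (λ (s , _ , t) → s ∈ v ∷ vs × t ∈ v ∷ vs) ((v , xs , v) ∷ es) →
         All (λ (s , _ , t) → s ≢ v × t ≢ v) es →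
         suc (length es) ≡ suc (suc (length vs)) →
         (∀ {x} → x ∈ vs → does (v ≟ v) ≡ does (x ≟ v)) → ⊥
    go []       []      _ _ _ () _
    go []       (e ∷ _) _ (_ ∷ (here s≡v , _) ∷ _) ((s≢v , _) ∷ _) _ _ = s≢v s≡v
    go (x ∷ vs) es      u _ _ _ eq with () ← ≡.trans (sym (dec-true (v ≟ v) ≡.refl))
      (≡.trans (eq (here ≡.refl)) (dec-false (x ≟ v) (Unique-head u (here ≡.refl))))

  -- Every vertex other than `v` keeps its degree, so no leaf can arise. The ends `s` and `t` may
  -- coincide, and the merged arc is then a loop.
  smooth : ∀ {v vs s xs ys t es} → s ≢ v → t ≢ v → deg es v ≡ 0 →
           WellFormed (v ∷ vs) ((s , xs , v) ∷ (v , ys , t) ∷ es) →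
           WellFormed vs ((s , xs ++ v ∷ ys , t) ∷ es)
  smooth {v} {vs} {s} {xs} {ys} {t} {es} s≢v t≢v deg≡0 wf = record
    { unique    = unique-tail unique
    ; inside    = inside-tail inside
    ; connected = connected-tail
    ; deg≥2     = λ {w} w∈ → subst (2 ≤_) (same-deg w (Unique-head unique w∈)) (deg≥2 (there w∈))
    ; count     = ℕ.suc-injective count
    }
    where
    open WellFormed wf
    avoids : All (λ (s , _ , t) → s ≢ v × t ≢ v) es
    avoids = deg≡0⇒avoids es deg≡0

    unique-tail : Unique (v ∷ vs) → Unique vs
    unique-tail (_ ∷ u) = u

    inside-tail : All (λ (s , _ , t) → s ∈ v ∷ vs × t ∈ v ∷ vs) ((s , xs , v) ∷ (v , ys , t) ∷ es) →
                  All (λ (s , _ , t) → s ∈ vs × t ∈ vs) ((s , xs ++ v ∷ ys , t) ∷ es)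
    inside-tail ((s∈ , _) ∷ (_ , t∈) ∷ ins) = (∈-tail s∈ s≢v , ∈-tail t∈ t≢v) ∷
      All.zipWith (λ ((s∈ , t∈) , s≢ , t≢) → ∈-tail s∈ s≢ , ∈-tail t∈ t≢) (ins , avoids)

    connected-tail : ∀ (f : V → Bool) →
      All (λ (s , _ , t) → f s ≡ f t) ((s , xs ++ v ∷ ys , t) ∷ es) →
      ∀ {x y} → x ∈ vs → y ∈ vs → f x ≡ f y
    connected-tail f (fs≡ft ∷ const) x∈ y∈ =
      ≡.trans (sym (off (Unique-head unique x∈)))
        (≡.trans (connected f′ const′ (there x∈) (there y∈)) (off (Unique-head unique y∈)))
      where
      f′ : V → Bool
      -- The deleted vertex takes the colour of `s`, which is also that of `t` because `f` is
      -- constant on the merged arc.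
      f′ x = if does (x ≟ v) then f s else f x
      off : ∀ {x} → x ≢ v → f′ x ≡ f x
      off {x} x≢v rewrite dec-false (x ≟ v) x≢v = ≡.refl
      on : f′ v ≡ f s
      on rewrite dec-true (v ≟ v) ≡.refl = ≡.refl
      const′ : All (λ (s , _ , t) → f′ s ≡ f′ t) ((s , xs , v) ∷ (v , ys , t) ∷ es)
      const′ = ≡.trans (off s≢v) (sym on) ∷ ≡.trans on (≡.trans fs≡ft (sym (off t≢v))) ∷
        All.zipWith (λ (eq , s≢ , t≢) → ≡.trans (off s≢) (≡.trans eq (sym (off t≢)))) (const , avoids)

    same-deg : ∀ w → w ≢ v → deg ((s , xs , v) ∷ (v , ys , t) ∷ es) w ≡
                             deg ((s , xs ++ v ∷ ys , t) ∷ es) w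
    same-deg w w≢v rewrite [≐]-≢ {v} {w} (w≢v ∘ sym) = shape [ s ≐ w ] [ t ≐ w ] (deg es w)
      where
      shape : ∀ a b c → a ℕ.+ 0 ℕ.+ (b ℕ.+ c) ≡ a ℕ.+ b ℕ.+ c
      shape = solve-∀

  total-deg : List (Arc V) → List V → ℕ
  total-deg es vs = foldr (λ v z → deg es v ℕ.+ z) 0 vs

  occurrences : V → List V → ℕ
  occurrences s vs = foldr (λ v z → [ s ≐ v ] ℕ.+ z) 0 vs

  occurrences-absent : ∀ s vs → All (s ≢_) vs → occurrences s vs ≡ 0
  occurrences-absent s []       []         = ≡.refl
  occurrences-absent s (v ∷ vs) (s≢v ∷ s≢) rewrite [≐]-≢ s≢v = occurrences-absent s vs s≢

  occurrences≤1 : ∀ s vs → Unique vs → occurrences s vs ≤ 1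
  occurrences≤1 s []       []       = z≤n
  occurrences≤1 s (v ∷ vs) (v≢ ∷ u) with s ≟ v
  ... | yes ≡.refl = ℕ.≤-reflexive (cong suc (occurrences-absent s vs v≢))
  ... | no _       = occurrences≤1 s vs u

  total-deg-∷ : ∀ s xs t es vs → total-deg ((s , xs , t) ∷ es) vs ≡
                occurrences s vs ℕ.+ occurrences t vs ℕ.+ total-deg es vs
  total-deg-∷ s xs t es []       = ≡.refl
  total-deg-∷ s xs t es (v ∷ vs) rewrite total-deg-∷ s xs t es vs =
    shape [ s ≐ v ] [ t ≐ v ] (deg es v) (occurrences s vs) (occurrences t vs) (total-deg es vs)
    where
    shape : ∀ a b c d e f → a ℕ.+ b ℕ.+ c ℕ.+ (d ℕ.+ e ℕ.+ f) ≡ a ℕ.+ d ℕ.+ (b ℕ.+ e) ℕ.+ (c ℕ.+ f)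
    shape = solve-∀

  -- A list of distinct vertices counts each end of an arc at most once, so an arc adds at most 2.
  -- Against `total-deg-lower` this bounds the number of vertices.
  handshake : ∀ es {vs} → Unique vs → total-deg es vs ≤ length es ℕ.* 2
  handshake []                  {vs} u = ℕ.≤-reflexive (zero-sum vs)
    where
    zero-sum : ∀ vs → total-deg [] vs ≡ 0
    zero-sum []       = ≡.refl
    zero-sum (_ ∷ vs) = zero-sum vs
  handshake ((s , xs , t) ∷ es) {vs} u rewrite total-deg-∷ s xs t es vs =
    ℕ.+-mono-≤ (ℕ.+-mono-≤ (occurrences≤1 s vs u) (occurrences≤1 t vs u)) (handshake es u)

  total-deg-lower : ∀ es vs → (∀ {v} → v ∈ vs → 3 ≤ deg es v) → length vs ℕ.* 3 ≤ total-deg es vs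
  total-deg-lower es []       _  = z≤n
  total-deg-lower es (v ∷ vs) ≥3 =
    ℕ.+-mono-≤ (≥3 (here ≡.refl)) (total-deg-lower es vs (≥3 ∘ there))

-- Zeta functions of weighted graphs

-- g k is 1/(1 − u^(2(k+1))): paths are indexed by their number of interior vertices.
record Point : Set₁ where
  field algebra : ℤ-Algebra
  open ℤ-Algebra algebra public
  field
    u         : Carrier
    g         : ℕ → Carrier
    g-inverse : ∀ k → (1# - u ^ suc k * u ^ suc k) * g k ≡ 1#

-- Replacing a path of k edges by a single edge of weight uᵏ: the zeta function of the
-- weighted graph is ∏ₑ (1 − xₑ²) · det M, where each edge e adds xₑ²/(1 − xₑ²) to the diagonal
-- of M at its ends and −xₑ/(1 − xₑ²) off the diagonal.
module WeightedZeta (𝒫 : Point) where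
  open Point 𝒫
  open Determinant algebra
  open Solver using (solve; _:=_; _:+_; _:*_; :-_; _:-_; con)

  ^-+ : ∀ x m n → x ^ (m ℕ.+ n) ≡ x ^ m * x ^ n
  ^-+ x zero    n = sym (*-identityˡ _)
  ^-+ x (suc m) n = ≡.trans (cong (x *_) (^-+ x m n)) (sym (*-assoc x _ _))

  weight : ℕ → Carrier
  weight k = u ^ suc k

  weight-++ : ∀ {V : Set} (xs : List V) v ys →
              weight (length (xs ++ v ∷ ys)) ≡ weight (length xs) * weight (length ys)
  weight-++ xs v ys = ≡.trans (cong weight (List.length-++ xs)) (^-+ u (suc (length xs)) (suc (length ys)))

  -- p is the diagonal entry of M at a vertex of degree 2 and q = 1/p; the off-diagonal entries of
  -- its row are −x · gx and −y · gy.
  module Elimination {x y gx gy h : Carrier}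
    (gx-inv : (1# - x * x) * gx ≡ 1#) (gy-inv : (1# - y * y) * gy ≡ 1#)
    (h-inv : (1# - (x * y) * (x * y)) * h ≡ 1#) where
    open ≡-Reasoning

    p q : Carrier
    p = 1# + (x * x * gx + y * y * gy)
    q = (1# - x * x) * (1# - y * y) * h

    p-product : (1# - x * x) * (1# - y * y) * p ≡ 1# - (x * y) * (x * y)
    p-product = begin
      (1# - x * x) * (1# - y * y) * p
        ≡⟨ solve 4 (λ x y a b → (con 1ℤ :- x :* x) :* (con 1ℤ :- y :* y)
                                  :* (con 1ℤ :+ (x :* x :* a :+ y :* y :* b))
             := (con 1ℤ :- x :* x) :* (con 1ℤ :- y :* y)
                :+ (con 1ℤ :- y :* y) :* x :* x :* ((con 1ℤ :- x :* x) :* a)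
                :+ (con 1ℤ :- x :* x) :* y :* y :* ((con 1ℤ :- y :* y) :* b)) ≡.refl x y gx gy ⟩
      (1# - x * x) * (1# - y * y) + (1# - y * y) * x * x * ((1# - x * x) * gx)
        + (1# - x * x) * y * y * ((1# - y * y) * gy)
        ≡⟨ cong₂ (λ a b → (1# - x * x) * (1# - y * y) + (1# - y * y) * x * x * a
                             + (1# - x * x) * y * y * b) gx-inv gy-inv ⟩
      (1# - x * x) * (1# - y * y) + (1# - y * y) * x * x * 1# + (1# - x * x) * y * y * 1#
        ≡⟨ solve 2 (λ x y → (con 1ℤ :- x :* x) :* (con 1ℤ :- y :* y)
                :+ (con 1ℤ :- y :* y) :* x :* x :* con 1ℤ
                :+ (con 1ℤ :- x :* x) :* y :* y :* con 1ℤ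
             := con 1ℤ :- (x :* y) :* (x :* y)) ≡.refl x y ⟩
      1# - (x * y) * (x * y) ∎

    q*p : q * p ≡ 1#
    q*p = begin
      q * p ≡⟨ solve 4 (λ x y h p → x :* y :* h :* p := x :* y :* p :* h) ≡.refl _ _ h p ⟩
      (1# - x * x) * (1# - y * y) * p * h ≡⟨ cong (_* h) p-product ⟩
      (1# - (x * y) * (x * y)) * h        ≡⟨ h-inv ⟩
      1# ∎

    xy-entry : (x * gx) * (y * gy) * q ≡ x * y * h
    xy-entry = begin
      (x * gx) * (y * gy) * q
        ≡⟨ solve 7 (λ x y a b s t h → (x :* a) :* (y :* b) :* (s :* t :* h)
             := (s :* a) :* (t :* b) :* (x :* y :* h)) ≡.refl x y gx gy _ _ h ⟩
      ((1# - x * x) * gx) * ((1# - y * y) * gy) * (x * y * h)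
        ≡⟨ cong₂ (λ a b → a * b * (x * y * h)) gx-inv gy-inv ⟩
      1# * 1# * (x * y * h)
        ≡⟨ solve 1 (λ z → con 1ℤ :* con 1ℤ :* z := z) ≡.refl _ ⟩
      x * y * h ∎

    -- What the Schur complement leaves on the diagonal at the far end of an arc is again of the
    -- form z²/(1 - z²), now with z = xy. Together with `xy-entry` it says that the two arcs act on
    -- the remaining vertices like a single arc of weight xy.
    xx-entry : x * x * gx - (x * gx) * (x * gx) * q ≡ (x * y) * (x * y) * h
    xx-entry = begin
      x * x * gx - (x * gx) * (x * gx) * q
        ≡⟨ solve 5 (λ x a s t h → x :* x :* a :- (x :* a) :* (x :* a) :* (s :* t :* h)
             := x :* x :* a :* con 1ℤ :- x :* x :* a :* t :* h :* (s :* a)) ≡.refl x gx _ _ h ⟩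
      x * x * gx * 1# - x * x * gx * (1# - y * y) * h * ((1# - x * x) * gx)
        -- The factor 1 is expanded through `h-inv`, so that both terms acquire the factor `h` and
        -- can be combined.
        ≡⟨ cong₂ (λ a b → x * x * gx * a - x * x * gx * (1# - y * y) * h * b) (sym h-inv) gx-inv ⟩
      x * x * gx * ((1# - (x * y) * (x * y)) * h) - x * x * gx * (1# - y * y) * h * 1#
        ≡⟨ solve 4 (λ x y a h → x :* x :* a :* ((con 1ℤ :- (x :* y) :* (x :* y)) :* h)
                                  :- x :* x :* a :* (con 1ℤ :- y :* y) :* h :* con 1ℤ
             := ((con 1ℤ :- x :* x) :* a) :* ((x :* y) :* (x :* y) :* h)) ≡.refl x y gx h ⟩
      ((1# - x * x) * gx) * ((x * y) * (x * y) * h)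
        ≡⟨ cong (_* ((x * y) * (x * y) * h)) gx-inv ⟩
      1# * ((x * y) * (x * y) * h) ≡⟨ *-identityˡ _ ⟩
      (x * y) * (x * y) * h ∎

  module _ {V : Set} (_≟_ : DecidableEquality V) where

    δ : V → V → Carrier
    δ v w = if does (v ≟ w) then 1# else 0#

    δ-refl : ∀ v → δ v v ≡ 1#
    δ-refl v rewrite dec-true (v ≟ v) ≡.refl = ≡.refl

    δ-≢ : ∀ {v w} → v ≢ w → δ v w ≡ 0#
    δ-≢ {v} {w} v≢w rewrite dec-false (v ≟ w) v≢w = ≡.refl

    -- An arc adds α where row and column name the same end and -β where they name opposite ends.
    -- Being bilinear in the indicators (a, b) of the row and (c, d) of the column, the formula
    -- covers loops too: at the vertex of a loop all four are 1 and the entry is 2α - 2β.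
    entry : (a b c d α β : Carrier) → Carrier
    entry a b c d α β = (a * c + b * d) * α - (a * d + b * c) * β

    contribution : V → V → Arc V → Carrier
    contribution i j (s , xs , t) =
      entry (δ s i) (δ t i) (δ s j) (δ t j)
        (weight (length xs) * weight (length xs) * g (length xs)) (weight (length xs) * g (length xs))

    contributions : List (Arc V) → V → V → Carrier
    contributions es i j = foldr (λ e z → contribution i j e + z) 0# es

    M : List (Arc V) → V → V → Carrier
    M es i j = δ i j + contributions es i j

    factor : Arc V → Carrier
    factor (_ , xs , _) = 1# - weight (length xs) * weight (length xs)

    factors : List (Arc V) → Carrier
    factors es = foldr (λ e z → factor e * z) 1# es

    Z : List V → List (Arc V) → Carrier
    Z vs es = factors es * detOn (M es) vs

    Z-resp : ∀ {vs ws es fs} → vs ↭ ws → es ~ fs → Z vs es ≡ Z ws fs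
    Z-resp {vs} {ws} {es} {fs} vs↭ws es~fs = cong₂ _*_
      (foldr-~ _*_ 1# factor
        (solve 3 (λ x y z → x :* (y :* z) := y :* (x :* z)) ≡.refl)
        (λ (_ , xs , _) → cong (λ k → 1# - weight k * weight k) (List.length-reverse xs)) es~fs)
      (≡.trans (detOn-↭ (M es) vs↭ws) (detOn-cong ws λ {i} {j} _ _ → cong (δ i j +_)
        (foldr-~ _+_ 0# (contribution i j)
          (solve 3 (λ x y z → x :+ (y :+ z) := y :+ (x :+ z)) ≡.refl)
          (contribution-flip i j) es~fs)))
      where
      contribution-flip : ∀ i j e → contribution i j (flip e) ≡ contribution i j e
      contribution-flip i j (s , xs , t) rewrite List.length-reverse xs =
        solve 6 (λ a b c d α β → (b :* d :+ a :* c) :* α :- (b :* c :+ a :* d) :* β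
                   := (a :* c :+ b :* d) :* α :- (a :* d :+ b :* c) :* β) ≡.refl
          (δ s i) (δ t i) (δ s j) (δ t j) _ _

    contributions-avoidˡ : ∀ {v} {es : List (Arc V)} → All (λ (s , _ , t) → s ≢ v × t ≢ v) es →
                           ∀ j → contributions es v j ≡ 0#
    contributions-avoidˡ []                   j = ≡.refl
    contributions-avoidˡ {v} {(s , xs , t) ∷ es} ((s≢v , t≢v) ∷ avoid) j
      rewrite δ-≢ s≢v | δ-≢ t≢v | contributions-avoidˡ avoid j =
        solve 4 (λ c d α β → (con 0ℤ :* c :+ con 0ℤ :* d) :* α :- (con 0ℤ :* d :+ con 0ℤ :* c) :* β
                               :+ con 0ℤ := con 0ℤ) ≡.refl _ _ _ _

    contributions-avoidʳ : ∀ {v} {es : List (Arc V)} → All (λ (s , _ , t) → s ≢ v × t ≢ v) es →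
                           ∀ i → contributions es i v ≡ 0#
    contributions-avoidʳ []                   i = ≡.refl
    contributions-avoidʳ {v} {(s , xs , t) ∷ es} ((s≢v , t≢v) ∷ avoid) i
      rewrite δ-≢ s≢v | δ-≢ t≢v | contributions-avoidʳ avoid i =
        solve 4 (λ a b α β → (a :* con 0ℤ :+ b :* con 0ℤ) :* α :- (a :* con 0ℤ :+ b :* con 0ℤ) :* β
                               :+ con 0ℤ := con 0ℤ) ≡.refl _ _ _ _

    -- The pivot is `p`, and `p-product` merges it with the factors of the two old arcs into the
    -- factor of the new one. The Schur correction is a matrix of rank one, and `entries` checks
    -- that it turns the contributions of the two arcs into that of the merged arc. Bilinearity of
    -- `entry` lets the case s = t go along.
    Z-smooth : ∀ {v vs s xs ys t es} → s ≢ v → t ≢ v → (∀ {w} → w ∈ vs → w ≢ v) →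
               All (λ (s , _ , t) → s ≢ v × t ≢ v) es →
               Z (v ∷ vs) ((s , xs , v) ∷ (v , ys , t) ∷ es) ≡ Z vs ((s , xs ++ v ∷ ys , t) ∷ es)
    Z-smooth {v} {vs} {s} {xs} {ys} {t} {es} s≢v t≢v vs≢v avoid = begin
      (1# - x * x) * ((1# - y * y) * F) * detOn N (v ∷ vs)
        ≡⟨ cong ((1# - x * x) * ((1# - y * y) * F) *_) (schur N v vs τ pivot) ⟩
      (1# - x * x) * ((1# - y * y) * F) * (N v v * detOn (λ i j → N i j - τ i * N v j) vs)
        ≡⟨ cong₂ (λ a b → (1# - x * x) * ((1# - y * y) * F) * (a * b)) Nvv
             (detOn-cong vs λ {i} {j} i∈ j∈ → entries i j (vs≢v i∈) (vs≢v j∈)) ⟩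
      (1# - x * x) * ((1# - y * y) * F) * (p * detOn N′ vs)
        ≡⟨ solve 5 (λ a b f p d → a :* (b :* f) :* (p :* d) := a :* b :* p :* f :* d)
             ≡.refl _ _ F p (detOn N′ vs) ⟩
      (1# - x * x) * (1# - y * y) * p * F * detOn N′ vs
        ≡⟨ cong (λ z → z * F * detOn N′ vs) p-product ⟩
      (1# - (x * y) * (x * y)) * F * detOn N′ vs
        ≡⟨ cong (λ z → (1# - z * z) * F * detOn N′ vs) (weight-++ xs v ys) ⟨
      Z vs ((s , xs ++ v ∷ ys , t) ∷ es) ∎
      where
      open ≡-Reasoning
      x y h F : Carrier
      x = weight (length xs)
      y = weight (length ys)
      h = g (length (xs ++ v ∷ ys))
      F = factors es
      h-inv : (1# - (x * y) * (x * y)) * h ≡ 1#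
      h-inv = ≡.trans (cong (λ z → (1# - z * z) * h) (sym (weight-++ xs v ys)))
                      (g-inverse (length (xs ++ v ∷ ys)))
      gx gy : Carrier
      gx = g (length xs)
      gy = g (length ys)
      open Elimination {x} {y} {gx} {gy} {h} (g-inverse (length xs)) (g-inverse (length ys)) h-inv
      N N′ : V → V → Carrier
      N  = M ((s , xs , v) ∷ (v , ys , t) ∷ es)
      N′ = M ((s , xs ++ v ∷ ys , t) ∷ es)
      τ : V → Carrier
      τ i = N i v * q

      Nvv : N v v ≡ p
      Nvv rewrite δ-refl v | δ-≢ s≢v | δ-≢ t≢v | contributions-avoidˡ avoid v =
        solve 4 (λ x y a b → con 1ℤ :+ ((con 0ℤ :* con 0ℤ :+ con 1ℤ :* con 1ℤ) :* (x :* x :* a)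
                    :- (con 0ℤ :* con 1ℤ :+ con 1ℤ :* con 0ℤ) :* (x :* a)
                  :+ ((con 1ℤ :* con 1ℤ :+ con 0ℤ :* con 0ℤ) :* (y :* y :* b)
                    :- (con 1ℤ :* con 0ℤ :+ con 0ℤ :* con 1ℤ) :* (y :* b) :+ con 0ℤ))
             := con 1ℤ :+ (x :* x :* a :+ y :* y :* b)) ≡.refl x y gx gy

      Niv : ∀ i → i ≢ v → N i v ≡ - (δ s i * (x * gx) + δ t i * (y * gy))
      Niv i i≢v rewrite δ-refl v | δ-≢ s≢v | δ-≢ t≢v | δ-≢ i≢v | δ-≢ (i≢v ∘ sym)
                      | contributions-avoidʳ avoid i =
        solve 6 (λ a b x y α β → con 0ℤ :+ ((a :* con 0ℤ :+ con 0ℤ :* con 1ℤ) :* α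
                    :- (a :* con 1ℤ :+ con 0ℤ :* con 0ℤ) :* x
                  :+ ((con 0ℤ :* con 1ℤ :+ b :* con 0ℤ) :* β
                    :- (con 0ℤ :* con 0ℤ :+ b :* con 1ℤ) :* y :+ con 0ℤ))
             := :- (a :* x :+ b :* y)) ≡.refl (δ s i) (δ t i) (x * gx) (y * gy) _ _

      Nvj : ∀ j → j ≢ v → N v j ≡ - (δ s j * (x * gx) + δ t j * (y * gy))
      Nvj j j≢v rewrite δ-refl v | δ-≢ s≢v | δ-≢ t≢v | δ-≢ (j≢v ∘ sym)
                      | contributions-avoidˡ avoid j =
        solve 6 (λ a b x y α β → con 0ℤ :+ ((con 0ℤ :* a :+ con 1ℤ :* con 0ℤ) :* α
                    :- (con 0ℤ :* con 0ℤ :+ con 1ℤ :* a) :* x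
                  :+ ((con 1ℤ :* con 0ℤ :+ con 0ℤ :* b) :* β
                    :- (con 1ℤ :* b :+ con 0ℤ :* con 0ℤ) :* y :+ con 0ℤ))
             := :- (a :* x :+ b :* y)) ≡.refl (δ s j) (δ t j) (x * gx) (y * gy) _ _

      pivot : ∀ i → τ i * N v v ≡ N i v
      pivot i = begin
        N i v * q * N v v ≡⟨ cong (N i v * q *_) Nvv ⟩
        N i v * q * p     ≡⟨ *-assoc _ q p ⟩
        N i v * (q * p)   ≡⟨ cong (N i v *_) q*p ⟩
        N i v * 1#        ≡⟨ *-identityʳ _ ⟩
        N i v             ∎

      yy-entry : y * y * gy - (y * gy) * (y * gy) * q ≡ (x * y) * (x * y) * h
      yy-entry = begin
        y * y * gy - (y * gy) * (y * gy) * q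
          ≡⟨ cong (λ z → y * y * gy - (y * gy) * (y * gy) * (z * h))
               (*-comm (1# - x * x) (1# - y * y)) ⟩
        y * y * gy - (y * gy) * (y * gy) * ((1# - y * y) * (1# - x * x) * h)
          ≡⟨ Elimination.xx-entry {y} {x} {gy} {gx} {h} (g-inverse (length ys)) (g-inverse (length xs))
               (≡.trans (cong (λ z → (1# - z * z) * h) (*-comm y x)) h-inv) ⟩
        (y * x) * (y * x) * h ≡⟨ cong (λ z → z * z * h) (*-comm y x) ⟩
        (x * y) * (x * y) * h ∎

      entries : ∀ i j → i ≢ v → j ≢ v → N i j - τ i * N v j ≡ N′ i j
      entries i j i≢v j≢v = begin
        N i j - N i v * q * N v j
          ≡⟨ cong₂ (λ y z → N i j - y * q * z) (Niv i i≢v) (Nvj j j≢v) ⟩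
        N i j - (- (a * X + b * Y)) * q * (- (c * X + d * Y))
          ≡⟨ cong (λ z → z - (- (a * X + b * Y)) * q * (- (c * X + d * Y))) Nij ⟩
        δ i j + (a * c * (x * x * gx) + (b * d * (y * y * gy) + S))
          - (- (a * X + b * Y)) * q * (- (c * X + d * Y))
          ≡⟨ solve 11 (λ a b c d X Y q α β S e →
               e :+ (a :* c :* α :+ (b :* d :* β :+ S))
                 :- (:- (a :* X :+ b :* Y)) :* q :* (:- (c :* X :+ d :* Y))
               := e :+ (a :* c :* (α :- X :* X :* q) :+ b :* d :* (β :- Y :* Y :* q)
                        :- (a :* d :+ b :* c) :* (X :* Y :* q) :+ S))
               ≡.refl a b c d X Y q (x * x * gx) (y * y * gy) S (δ i j) ⟩
        δ i j + (a * c * (x * x * gx - X * X * q) + b * d * (y * y * gy - Y * Y * q)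
                 - (a * d + b * c) * (X * Y * q) + S)
          ≡⟨ cong (λ z → δ i j + (z + S)) (cong₂ _-_
               (cong₂ (λ y z → a * c * y + b * d * z) xx-entry yy-entry)
               (cong ((a * d + b * c) *_) xy-entry)) ⟩
        δ i j + (a * c * ((x * y) * (x * y) * h) + b * d * ((x * y) * (x * y) * h)
                 - (a * d + b * c) * (x * y * h) + S)
          ≡⟨ cong (λ z → δ i j + (z - (a * d + b * c) * (x * y * h) + S)) (sym (distribʳ _ _ _)) ⟩
        δ i j + (entry a b c d ((x * y) * (x * y) * h) (x * y * h) + S)
          ≡⟨ cong (λ z → δ i j + (entry a b c d (z * z * h) (z * h) + S)) (weight-++ xs v ys) ⟨
        N′ i j ∎
        where
        a b c d X Y S : Carrier
        a = δ s i
        b = δ t i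
        c = δ s j
        d = δ t j
        X = x * gx
        Y = y * gy
        S = contributions es i j
        Nij : N i j ≡ δ i j + (a * c * (x * x * gx) + (b * d * (y * y * gy) + S))
        Nij rewrite δ-≢ (i≢v ∘ sym) | δ-≢ (j≢v ∘ sym) =
          solve 10 (λ a b c d X Y α β S e →
            e :+ ((a :* c :+ con 0ℤ :* con 0ℤ) :* α :- (a :* con 0ℤ :+ con 0ℤ :* c) :* X
               :+ ((con 0ℤ :* con 0ℤ :+ b :* d) :* β :- (con 0ℤ :* d :+ b :* con 0ℤ) :* Y :+ S))
            := e :+ (a :* c :* α :+ (b :* d :* β :+ S)))
            ≡.refl a b c d X Y (x * x * gx) (y * y * gy) S (δ i j)

  det₁ : ∀ {V : Set} (N : V → V → Carrier) v → detOn N (v ∷ []) ≡ N v v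
  det₁ N v = solve 1 (λ a → a :* con 1ℤ :- con 0ℤ := a) ≡.refl (N v v)

  det₂ : ∀ {V : Set} (N : V → V → Carrier) v w → detOn N (v ∷ w ∷ []) ≡ N v v * N w w - N v w * N w v
  det₂ N v w = solve 4 (λ a b c d →
    a :* (d :* con 1ℤ :- con 0ℤ) :- (b :* (c :* con 1ℤ :- con 0ℤ) :- con 0ℤ) := a :* d :- b :* c)
    ≡.refl (N v v) (N v w) (N w v) (N w w)

  -- In `theta` the monomials xy, xz and yz are the weights of the three cycles; in `dumbbell`, xyz²
  -- is the weight of a closed walk that runs around both loops and crosses the link twice.
  dumbbell theta : (x y z : Carrier) → Carrier
  dumbbell x y z = (1# - x) * (1# - y) * ((1# - x) * (1# - y) - ι (ℤ.+ 4) * (x * y * (z * z)))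
  theta x y z =
    (1# - x * y - x * z - y * z) * (1# - x * y - x * z - y * z) - ι (ℤ.+ 4) * (x * y * z * (x * y * z))

  module Reduction {x gx : Carrier} (gx-inv : (1# - x * x) * gx ≡ 1#) where
    open ≡-Reasoning
    f α β : Carrier
    f = 1# - x * x
    α = x * x * gx
    β = x * gx

    f*α : f * α ≡ x * x
    f*α = begin
      f * α        ≡⟨ solve 3 (λ f x a → f :* (x :* x :* a) := x :* x :* (f :* a)) ≡.refl f x gx ⟩
      x * x * (f * gx) ≡⟨ cong (x * x *_) gx-inv ⟩
      x * x * 1#   ≡⟨ *-identityʳ _ ⟩
      x * x        ∎

    f*β : f * β ≡ x
    f*β = begin
      f * β        ≡⟨ solve 3 (λ f x a → f :* (x :* a) := x :* (f :* a)) ≡.refl f x gx ⟩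
      x * (f * gx) ≡⟨ cong (x *_) gx-inv ⟩
      x * 1#       ≡⟨ *-identityʳ _ ⟩
      x            ∎

    -- The denominator of α² and of β² is (1 - x²)², yet one factor 1 - x² is enough for their
    -- difference. This is why one factor per arc clears the determinants of size two below.
    α²-β² : α * α - β * β ≡ - α
    α²-β² = begin
      α * α - β * β     ≡⟨ solve 2 (λ x a → (x :* x :* a) :* (x :* x :* a) :- (x :* a) :* (x :* a)
                             := (:- (x :* x :* a)) :* ((con 1ℤ :- x :* x) :* a)) ≡.refl x gx ⟩
      (- α) * (f * gx)  ≡⟨ cong ((- α) *_) gx-inv ⟩
      (- α) * 1#        ≡⟨ *-identityʳ _ ⟩
      - α               ∎

    -- This is the value for a graph that is a single cycle: one factor 1 - x for each direction.
    loop : f * (1# + ι (ℤ.+ 2) * (α - β)) ≡ (1# - x) * (1# - x)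
    loop = begin
      f * (1# + ι (ℤ.+ 2) * (α - β))
        ≡⟨ solve 3 (λ f α β → f :* (con 1ℤ :+ con (ℤ.+ 2) :* (α :- β))
             := f :+ con (ℤ.+ 2) :* (f :* α :- f :* β)) ≡.refl f α β ⟩
      f + ι (ℤ.+ 2) * (f * α - f * β)
        ≡⟨ cong₂ (λ a b → f + ι (ℤ.+ 2) * (a - b)) f*α f*β ⟩
      f + ι (ℤ.+ 2) * (x * x - x)
        ≡⟨ solve 1 (λ x → con 1ℤ :- x :* x :+ con (ℤ.+ 2) :* (x :* x :- x)
             := (con 1ℤ :- x) :* (con 1ℤ :- x)) ≡.refl x ⟩
      (1# - x) * (1# - x) ∎

  module _ {V : Set} (_≟_ : DecidableEquality V) where

    Z-figureEight : ∀ v xs ys → Z _≟_ (v ∷ []) ((v , xs , v) ∷ (v , ys , v) ∷ []) ≡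
                    dumbbell (weight (length xs)) (weight (length ys)) 1#
    Z-figureEight v xs ys = begin
      X.f * (Y.f * 1#) * detOn N (v ∷ [])
        ≡⟨ cong (X.f * (Y.f * 1#) *_) (≡.trans (det₁ N v) Nvv) ⟩
      X.f * (Y.f * 1#) * (LX + LY - 1#)
        ≡⟨ solve 4 (λ f f′ L L′ → f :* (f′ :* con 1ℤ) :* (L :+ L′ :- con 1ℤ)
             := f′ :* (f :* L) :+ f :* (f′ :* L′) :- f :* f′) ≡.refl X.f Y.f LX LY ⟩
      Y.f * (X.f * LX) + X.f * (Y.f * LY) - X.f * Y.f
        ≡⟨ cong₂ (λ a b → Y.f * a + X.f * b - X.f * Y.f) X.loop Y.loop ⟩
      Y.f * ((1# - x) * (1# - x)) + X.f * ((1# - y) * (1# - y)) - X.f * Y.f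
        ≡⟨ solve 2 (λ x y →
             (con 1ℤ :- y :* y) :* ((con 1ℤ :- x) :* (con 1ℤ :- x))
               :+ (con 1ℤ :- x :* x) :* ((con 1ℤ :- y) :* (con 1ℤ :- y))
               :- (con 1ℤ :- x :* x) :* (con 1ℤ :- y :* y)
             := (con 1ℤ :- x) :* (con 1ℤ :- y) :* ((con 1ℤ :- x) :* (con 1ℤ :- y)
                  :- con (ℤ.+ 4) :* (x :* y :* (con 1ℤ :* con 1ℤ)))) ≡.refl x y ⟩
      dumbbell x y 1# ∎
      where
      open ≡-Reasoning
      x y LX LY : Carrier
      x = weight (length xs)
      y = weight (length ys)
      module X = Reduction {x} (g-inverse (length xs))
      module Y = Reduction {y} (g-inverse (length ys))
      LX = 1# + ι (ℤ.+ 2) * (X.α - X.β)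
      LY = 1# + ι (ℤ.+ 2) * (Y.α - Y.β)
      N : V → V → Carrier
      N = M _≟_ ((v , xs , v) ∷ (v , ys , v) ∷ [])
      Nvv : N v v ≡ LX + LY - 1#
      Nvv rewrite δ-refl _≟_ v = solve 4 (λ a b c d →
        con 1ℤ :+ ((con 1ℤ :* con 1ℤ :+ con 1ℤ :* con 1ℤ) :* a
                    :- (con 1ℤ :* con 1ℤ :+ con 1ℤ :* con 1ℤ) :* b
               :+ ((con 1ℤ :* con 1ℤ :+ con 1ℤ :* con 1ℤ) :* c
                    :- (con 1ℤ :* con 1ℤ :+ con 1ℤ :* con 1ℤ) :* d :+ con 0ℤ))
        := con 1ℤ :+ con (ℤ.+ 2) :* (a :- b) :+ (con 1ℤ :+ con (ℤ.+ 2) :* (c :- d)) :- con 1ℤ)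
        ≡.refl X.α X.β Y.α Y.β

    Z-dumbbell : ∀ {v w} → v ≢ w → ∀ xs ys zs →
      Z _≟_ (v ∷ w ∷ []) ((v , xs , v) ∷ (w , ys , w) ∷ (v , zs , w) ∷ []) ≡
      dumbbell (weight (length xs)) (weight (length ys)) (weight (length zs))
    Z-dumbbell {v} {w} v≢w xs ys zs = begin
      X.f * (Y.f * (Z′.f * 1#)) * detOn N (v ∷ w ∷ [])
        ≡⟨ cong (X.f * (Y.f * (Z′.f * 1#)) *_) (≡.trans (det₂ N v w)
             (cong₂ _-_ (cong₂ _*_ Nvv Nww) (cong₂ _*_ Nvw Nwv))) ⟩
      X.f * (Y.f * (Z′.f * 1#)) * ((LX + Z′.α) * (LY + Z′.α) - (- Z′.β) * (- Z′.β))
        ≡⟨ solve 7 (λ f f′ h L L′ α β →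
             f :* (f′ :* (h :* con 1ℤ)) :* ((L :+ α) :* (L′ :+ α) :- (:- β) :* (:- β))
             := h :* (f :* L) :* (f′ :* L′) :+ (h :* α) :* (f′ :* (f :* L) :+ f :* (f′ :* L′))
                :+ f :* f′ :* h :* (α :* α :- β :* β)) ≡.refl X.f Y.f Z′.f LX LY Z′.α Z′.β ⟩
      Z′.f * (X.f * LX) * (Y.f * LY) + (Z′.f * Z′.α) * (Y.f * (X.f * LX) + X.f * (Y.f * LY))
        + X.f * Y.f * Z′.f * (Z′.α * Z′.α - Z′.β * Z′.β)
        ≡⟨ cong₂ (λ a b → Z′.f * a * b + (Z′.f * Z′.α) * (Y.f * a + X.f * b)
                            + X.f * Y.f * Z′.f * (Z′.α * Z′.α - Z′.β * Z′.β)) X.loop Y.loop ⟩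
      Z′.f * x₁² * y₁² + (Z′.f * Z′.α) * (Y.f * x₁² + X.f * y₁²)
        + X.f * Y.f * Z′.f * (Z′.α * Z′.α - Z′.β * Z′.β)
        ≡⟨ cong (λ a → Z′.f * x₁² * y₁² + (Z′.f * Z′.α) * (Y.f * x₁² + X.f * y₁²)
                         + X.f * Y.f * Z′.f * a) Z′.α²-β² ⟩
      Z′.f * x₁² * y₁² + (Z′.f * Z′.α) * (Y.f * x₁² + X.f * y₁²) + X.f * Y.f * Z′.f * (- Z′.α)
        ≡⟨ solve 7 (λ f f′ h a b c α →
             h :* a :* b :+ (h :* α) :* c :+ f :* f′ :* h :* (:- α)
             := h :* a :* b :+ (h :* α) :* (c :- f :* f′)) ≡.refl X.f Y.f Z′.f x₁² y₁² _ Z′.α ⟩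
      Z′.f * x₁² * y₁² + (Z′.f * Z′.α) * (Y.f * x₁² + X.f * y₁² - X.f * Y.f)
        ≡⟨ cong (λ a → Z′.f * x₁² * y₁² + a * (Y.f * x₁² + X.f * y₁² - X.f * Y.f)) Z′.f*α ⟩
      Z′.f * x₁² * y₁² + (z * z) * (Y.f * x₁² + X.f * y₁² - X.f * Y.f)
        ≡⟨ solve 3 (λ x y z →
             (con 1ℤ :- z :* z) :* ((con 1ℤ :- x) :* (con 1ℤ :- x)) :* ((con 1ℤ :- y) :* (con 1ℤ :- y))
             :+ (z :* z) :*
               ((con 1ℤ :- y :* y) :* ((con 1ℤ :- x) :* (con 1ℤ :- x))
               :+ (con 1ℤ :- x :* x) :* ((con 1ℤ :- y) :* (con 1ℤ :- y))
               :- (con 1ℤ :- x :* x) :* (con 1ℤ :- y :* y))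
             := (con 1ℤ :- x) :* (con 1ℤ :- y) :* ((con 1ℤ :- x) :* (con 1ℤ :- y)
                  :- con (ℤ.+ 4) :* (x :* y :* (z :* z)))) ≡.refl x y z ⟩
      dumbbell x y z ∎
      where
      open ≡-Reasoning
      x y z LX LY x₁² y₁² : Carrier
      x = weight (length xs)
      y = weight (length ys)
      z = weight (length zs)
      module X = Reduction {x} (g-inverse (length xs))
      module Y = Reduction {y} (g-inverse (length ys))
      module Z′ = Reduction {z} (g-inverse (length zs))
      LX = 1# + ι (ℤ.+ 2) * (X.α - X.β)
      LY = 1# + ι (ℤ.+ 2) * (Y.α - Y.β)
      x₁² = (1# - x) * (1# - x)
      y₁² = (1# - y) * (1# - y)
      N : V → V → Carrier
      N = M _≟_ ((v , xs , v) ∷ (w , ys , w) ∷ (v , zs , w) ∷ [])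
      Nvv : N v v ≡ LX + Z′.α
      Nvv rewrite δ-refl _≟_ v | δ-≢ _≟_ (v≢w ∘ sym) = solve 6 (λ a b c d e f →
        con 1ℤ :+ ((con 1ℤ :* con 1ℤ :+ con 1ℤ :* con 1ℤ) :* a
                    :- (con 1ℤ :* con 1ℤ :+ con 1ℤ :* con 1ℤ) :* b
               :+ ((con 0ℤ :* con 0ℤ :+ con 0ℤ :* con 0ℤ) :* c
                    :- (con 0ℤ :* con 0ℤ :+ con 0ℤ :* con 0ℤ) :* d
               :+ ((con 1ℤ :* con 1ℤ :+ con 0ℤ :* con 0ℤ) :* e
                    :- (con 1ℤ :* con 0ℤ :+ con 0ℤ :* con 1ℤ) :* f :+ con 0ℤ)))
        := con 1ℤ :+ con (ℤ.+ 2) :* (a :- b) :+ e)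
        ≡.refl X.α X.β Y.α Y.β Z′.α Z′.β
      Nww : N w w ≡ LY + Z′.α
      Nww rewrite δ-refl _≟_ w | δ-≢ _≟_ v≢w = solve 6 (λ a b c d e f →
        con 1ℤ :+ ((con 0ℤ :* con 0ℤ :+ con 0ℤ :* con 0ℤ) :* a
                    :- (con 0ℤ :* con 0ℤ :+ con 0ℤ :* con 0ℤ) :* b
               :+ ((con 1ℤ :* con 1ℤ :+ con 1ℤ :* con 1ℤ) :* c
                    :- (con 1ℤ :* con 1ℤ :+ con 1ℤ :* con 1ℤ) :* d
               :+ ((con 0ℤ :* con 0ℤ :+ con 1ℤ :* con 1ℤ) :* e
                    :- (con 0ℤ :* con 1ℤ :+ con 1ℤ :* con 0ℤ) :* f :+ con 0ℤ)))
        := con 1ℤ :+ con (ℤ.+ 2) :* (c :- d) :+ e)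
        ≡.refl X.α X.β Y.α Y.β Z′.α Z′.β
      Nvw : N v w ≡ - Z′.β
      Nvw rewrite δ-refl _≟_ v | δ-refl _≟_ w | δ-≢ _≟_ v≢w | δ-≢ _≟_ (v≢w ∘ sym) =
        solve 6 (λ a b c d e f →
        con 0ℤ :+ ((con 1ℤ :* con 0ℤ :+ con 1ℤ :* con 0ℤ) :* a
                    :- (con 1ℤ :* con 0ℤ :+ con 1ℤ :* con 0ℤ) :* b
               :+ ((con 0ℤ :* con 1ℤ :+ con 0ℤ :* con 1ℤ) :* c
                    :- (con 0ℤ :* con 1ℤ :+ con 0ℤ :* con 1ℤ) :* d
               :+ ((con 1ℤ :* con 0ℤ :+ con 0ℤ :* con 1ℤ) :* e
                    :- (con 1ℤ :* con 1ℤ :+ con 0ℤ :* con 0ℤ) :* f :+ con 0ℤ)))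
        := :- f)
        ≡.refl X.α X.β Y.α Y.β Z′.α Z′.β
      Nwv : N w v ≡ - Z′.β
      Nwv rewrite δ-refl _≟_ v | δ-refl _≟_ w | δ-≢ _≟_ v≢w | δ-≢ _≟_ (v≢w ∘ sym) =
        solve 6 (λ a b c d e f →
        con 0ℤ :+ ((con 0ℤ :* con 1ℤ :+ con 0ℤ :* con 1ℤ) :* a
                    :- (con 0ℤ :* con 1ℤ :+ con 0ℤ :* con 1ℤ) :* b
               :+ ((con 1ℤ :* con 0ℤ :+ con 1ℤ :* con 0ℤ) :* c
                    :- (con 1ℤ :* con 0ℤ :+ con 1ℤ :* con 0ℤ) :* d
               :+ ((con 0ℤ :* con 1ℤ :+ con 1ℤ :* con 0ℤ) :* e
                    :- (con 0ℤ :* con 0ℤ :+ con 1ℤ :* con 1ℤ) :* f :+ con 0ℤ)))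
        := :- f)
        ≡.refl X.α X.β Y.α Y.β Z′.α Z′.β

    Z-theta : ∀ {v w} → v ≢ w → ∀ xs ys zs →
      Z _≟_ (v ∷ w ∷ []) ((v , xs , w) ∷ (v , ys , w) ∷ (v , zs , w) ∷ []) ≡
      theta (weight (length xs)) (weight (length ys)) (weight (length zs))
    Z-theta {v} {w} v≢w xs ys zs = begin
      X.f * (Y.f * (Z′.f * 1#)) * detOn N (v ∷ w ∷ [])
        ≡⟨ cong (X.f * (Y.f * (Z′.f * 1#)) *_) (≡.trans (det₂ N v w)
             (cong₂ _-_ (cong₂ _*_ Nvv Nww) (cong₂ _*_ Nvw Nwv))) ⟩
      X.f * (Y.f * (Z′.f * 1#)) *
        ((1# + (X.α + Y.α + Z′.α)) * (1# + (X.α + Y.α + Z′.α))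
          - (- (X.β + Y.β + Z′.β)) * (- (X.β + Y.β + Z′.β)))
        ≡⟨ cong (X.f * (Y.f * (Z′.f * 1#)) *_) (≡.trans
             (solve 6 (λ a b c d e h →
               (con 1ℤ :+ (a :+ b :+ c)) :* (con 1ℤ :+ (a :+ b :+ c))
                 :- (:- (d :+ e :+ h)) :* (:- (d :+ e :+ h))
               := con 1ℤ :+ con (ℤ.+ 2) :* (a :+ b :+ c)
                  :+ (a :* a :- d :* d) :+ (b :* b :- e :* e) :+ (c :* c :- h :* h)
                  :+ con (ℤ.+ 2) :* (a :* b :- d :* e :+ (a :* c :- d :* h) :+ (b :* c :- e :* h)))
               ≡.refl X.α Y.α Z′.α X.β Y.β Z′.β)
             (cong₂ (λ s t → s + t + ι (ℤ.+ 2) * cross)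
               (cong₂ (λ s t → 1# + ι (ℤ.+ 2) * (X.α + Y.α + Z′.α) + s + t) X.α²-β² Y.α²-β²)
               Z′.α²-β²)) ⟩
      X.f * (Y.f * (Z′.f * 1#)) *
        (1# + ι (ℤ.+ 2) * (X.α + Y.α + Z′.α) + - X.α + - Y.α + - Z′.α + ι (ℤ.+ 2) * cross)
        -- Each factor is moved next to the terms whose denominator it clears.
        ≡⟨ solve 9 (λ r s t a b c d e h →
             r :* (s :* (t :* con 1ℤ)) :*
               (con 1ℤ :+ con (ℤ.+ 2) :* (a :+ b :+ c) :+ :- a :+ :- b :+ :- c :+
                con (ℤ.+ 2) :* (a :* b :- d :* e :+ (a :* c :- d :* h) :+ (b :* c :- e :* h)))
             := r :* s :* t :+ (r :* a) :* s :* t :+ (s :* b) :* r :* t :+ (t :* c) :* r :* s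
                :+ con (ℤ.+ 2) :* (((r :* a) :* (s :* b) :- (r :* d) :* (s :* e)) :* t
                                  :+ ((r :* a) :* (t :* c) :- (r :* d) :* (t :* h)) :* s
                                  :+ ((s :* b) :* (t :* c) :- (s :* e) :* (t :* h)) :* r))
             ≡.refl X.f Y.f Z′.f X.α Y.α Z′.α X.β Y.β Z′.β ⟩
      combine (X.f * X.α) (Y.f * Y.α) (Z′.f * Z′.α) (X.f * X.β) (Y.f * Y.β) (Z′.f * Z′.β)
        ≡⟨ cong₂ (λ a b → combine a b (Z′.f * Z′.α) (X.f * X.β) (Y.f * Y.β) (Z′.f * Z′.β)) X.f*α Y.f*α ⟩
      combine (x * x) (y * y) (Z′.f * Z′.α) (X.f * X.β) (Y.f * Y.β) (Z′.f * Z′.β)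
        ≡⟨ cong₂ (λ a b → combine (x * x) (y * y) a b (Y.f * Y.β) (Z′.f * Z′.β)) Z′.f*α X.f*β ⟩
      combine (x * x) (y * y) (z * z) x (Y.f * Y.β) (Z′.f * Z′.β)
        ≡⟨ cong₂ (combine (x * x) (y * y) (z * z) x) Y.f*β Z′.f*β ⟩
      combine (x * x) (y * y) (z * z) x y z
        ≡⟨ solve 3 (λ x y z →
             let r = con 1ℤ :- x :* x ; s = con 1ℤ :- y :* y ; t = con 1ℤ :- z :* z
                 S = con 1ℤ :- x :* y :- x :* z :- y :* z in
             r :* s :* t :+ (x :* x) :* s :* t :+ (y :* y) :* r :* t :+ (z :* z) :* r :* s
                :+ con (ℤ.+ 2) :* (((x :* x) :* (y :* y) :- x :* y) :* t
                                  :+ ((x :* x) :* (z :* z) :- x :* z) :* s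
                                  :+ ((y :* y) :* (z :* z) :- y :* z) :* r)
             := S :* S :- con (ℤ.+ 4) :* (x :* y :* z :* (x :* y :* z))) ≡.refl x y z ⟩
      theta x y z ∎
      where
      open ≡-Reasoning
      x y z cross : Carrier
      x = weight (length xs)
      y = weight (length ys)
      z = weight (length zs)
      module X = Reduction {x} (g-inverse (length xs))
      module Y = Reduction {y} (g-inverse (length ys))
      module Z′ = Reduction {z} (g-inverse (length zs))
      cross = X.α * Y.α - X.β * Y.β + (X.α * Z′.α - X.β * Z′.β) + (Y.α * Z′.α - Y.β * Z′.β)
      combine : (a b c d e h : Carrier) → Carrier
      combine a b c d e h =
        X.f * Y.f * Z′.f + a * Y.f * Z′.f + b * X.f * Z′.f + c * X.f * Y.f
          + ι (ℤ.+ 2) * ((a * b - d * e) * Z′.f + (a * c - d * h) * Y.f + (b * c - e * h) * X.f)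
      N : V → V → Carrier
      N = M _≟_ ((v , xs , w) ∷ (v , ys , w) ∷ (v , zs , w) ∷ [])
      Nvv : N v v ≡ 1# + (X.α + Y.α + Z′.α)
      Nvv rewrite δ-refl _≟_ v | δ-≢ _≟_ (v≢w ∘ sym) = solve 6 (λ a b c d e f →
        con 1ℤ :+ ((con 1ℤ :* con 1ℤ :+ con 0ℤ :* con 0ℤ) :* a
                    :- (con 1ℤ :* con 0ℤ :+ con 0ℤ :* con 1ℤ) :* b
               :+ ((con 1ℤ :* con 1ℤ :+ con 0ℤ :* con 0ℤ) :* c
                    :- (con 1ℤ :* con 0ℤ :+ con 0ℤ :* con 1ℤ) :* d
               :+ ((con 1ℤ :* con 1ℤ :+ con 0ℤ :* con 0ℤ) :* e
                    :- (con 1ℤ :* con 0ℤ :+ con 0ℤ :* con 1ℤ) :* f :+ con 0ℤ)))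
        := con 1ℤ :+ (a :+ c :+ e))
        ≡.refl X.α X.β Y.α Y.β Z′.α Z′.β
      Nww : N w w ≡ 1# + (X.α + Y.α + Z′.α)
      Nww rewrite δ-refl _≟_ w | δ-≢ _≟_ v≢w = solve 6 (λ a b c d e f →
        con 1ℤ :+ ((con 0ℤ :* con 0ℤ :+ con 1ℤ :* con 1ℤ) :* a
                    :- (con 0ℤ :* con 1ℤ :+ con 1ℤ :* con 0ℤ) :* b
               :+ ((con 0ℤ :* con 0ℤ :+ con 1ℤ :* con 1ℤ) :* c
                    :- (con 0ℤ :* con 1ℤ :+ con 1ℤ :* con 0ℤ) :* d
               :+ ((con 0ℤ :* con 0ℤ :+ con 1ℤ :* con 1ℤ) :* e
                    :- (con 0ℤ :* con 1ℤ :+ con 1ℤ :* con 0ℤ) :* f :+ con 0ℤ)))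
        := con 1ℤ :+ (a :+ c :+ e))
        ≡.refl X.α X.β Y.α Y.β Z′.α Z′.β
      Nvw : N v w ≡ - (X.β + Y.β + Z′.β)
      Nvw rewrite δ-refl _≟_ v | δ-refl _≟_ w | δ-≢ _≟_ v≢w | δ-≢ _≟_ (v≢w ∘ sym) =
        solve 6 (λ a b c d e f →
        con 0ℤ :+ ((con 1ℤ :* con 0ℤ :+ con 0ℤ :* con 1ℤ) :* a
                    :- (con 1ℤ :* con 1ℤ :+ con 0ℤ :* con 0ℤ) :* b
               :+ ((con 1ℤ :* con 0ℤ :+ con 0ℤ :* con 1ℤ) :* c
                    :- (con 1ℤ :* con 1ℤ :+ con 0ℤ :* con 0ℤ) :* d
               :+ ((con 1ℤ :* con 0ℤ :+ con 0ℤ :* con 1ℤ) :* e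
                    :- (con 1ℤ :* con 1ℤ :+ con 0ℤ :* con 0ℤ) :* f :+ con 0ℤ)))
        := :- (b :+ d :+ f))
        ≡.refl X.α X.β Y.α Y.β Z′.α Z′.β
      Nwv : N w v ≡ - (X.β + Y.β + Z′.β)
      Nwv rewrite δ-refl _≟_ v | δ-refl _≟_ w | δ-≢ _≟_ v≢w | δ-≢ _≟_ (v≢w ∘ sym) =
        solve 6 (λ a b c d e f →
        con 0ℤ :+ ((con 0ℤ :* con 1ℤ :+ con 1ℤ :* con 0ℤ) :* a
                    :- (con 0ℤ :* con 0ℤ :+ con 1ℤ :* con 1ℤ) :* b
               :+ ((con 0ℤ :* con 1ℤ :+ con 1ℤ :* con 0ℤ) :* c
                    :- (con 0ℤ :* con 0ℤ :+ con 1ℤ :* con 1ℤ) :* d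
               :+ ((con 0ℤ :* con 1ℤ :+ con 1ℤ :* con 0ℤ) :* e
                    :- (con 0ℤ :* con 0ℤ :+ con 1ℤ :* con 1ℤ) :* f :+ con 0ℤ)))
        := :- (b :+ d :+ f))
        ≡.refl X.α X.β Y.α Y.β Z′.α Z′.β

-- Classification of the smoothed graphs

-- Sorting removes the freedom in naming the arcs. A theta graph is symmetric in all three of them,
-- a dumbbell only in its loops, so the length of its link is not compared with the others.
data Normal {V : Set} : List V → List (Arc V) → Set where
  figureEight : ∀ v xs ys → length xs ≤ length ys →
                Normal (v ∷ []) ((v , xs , v) ∷ (v , ys , v) ∷ [])
  dumbbell    : ∀ v w xs ys zs → v ≢ w → length xs ≤ length ys →
                Normal (v ∷ w ∷ []) ((v , xs , v) ∷ (w , ys , w) ∷ (v , zs , w) ∷ [])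
  theta       : ∀ v w xs ys zs → v ≢ w → length xs ≤ length ys → length ys ≤ length zs →
                Normal (v ∷ w ∷ []) ((v , xs , w) ∷ (v , ys , w) ∷ (v , zs , w) ∷ [])

module Classification (𝒫 : Point) {V : Set} (_≟_ : DecidableEquality V) where
  open ArcGraph _≟_
  open WeightedZeta 𝒫 using (Z; Z-resp; Z-smooth)
  private
    module E  = PermS (edgeSetoid V)
    module EP = PermSP (edgeSetoid V)

  -- Smoothing hides vertices inside arcs but loses nothing: the end vertices with the interiors,
  -- and the edges of the paths, still describe the original graph. Carrying them along with the
  -- zeta value is what allows an isomorphism to be built from two normal forms.
  record SameGraph (vs : List V) (es : List (Arc V)) (ws : List V) (fs : List (Arc V)) : Set where
    field
      vertices : vs ++ concatMap interior es ↭ ws ++ concatMap interior fs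
      edges    : concatMap edgesOf es ↭ᴱ concatMap edgesOf fs
      zeta     : Z _≟_ vs es ≡ Z _≟_ ws fs

  SameGraph-trans : ∀ {vs es ws fs us gs} →
                    SameGraph vs es ws fs → SameGraph ws fs us gs → SameGraph vs es us gs
  SameGraph-trans p q = record
    { vertices = trans P.vertices Q.vertices
    ; edges    = E.↭-trans P.edges Q.edges
    ; zeta     = ≡.trans P.zeta Q.zeta }
    where
    module P = SameGraph p
    module Q = SameGraph q

  rearrange : ∀ {vs ws es fs} → vs ↭ ws → es ~ fs → SameGraph vs es ws fs
  rearrange vs↭ws es~fs = record
    { vertices = ↭.++⁺ vs↭ws (interiors-~ es~fs)
    ; edges    = edges-~ es~fs
    ; zeta     = Z-resp _≟_ vs↭ws es~fs }

  smooth-same : ∀ {v vs s xs ys t es} → s ≢ v → t ≢ v → deg es v ≡ 0 →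
                WellFormed (v ∷ vs) ((s , xs , v) ∷ (v , ys , t) ∷ es) →
                SameGraph (v ∷ vs) ((s , xs , v) ∷ (v , ys , t) ∷ es)
                          vs ((s , xs ++ v ∷ ys , t) ∷ es)
  smooth-same {v} {vs} {s} {xs} {ys} {t} {es} s≢v t≢v deg≡0 wf = record
    { vertices = begin
        v ∷ vs ++ (xs ++ ys ++ I)   ↭⟨ ↭.shift v vs (xs ++ ys ++ I) ⟨
        vs ++ v ∷ (xs ++ ys ++ I)   ↭⟨ ↭.++⁺ˡ vs (↭.shift v xs (ys ++ I)) ⟨
        vs ++ (xs ++ v ∷ (ys ++ I)) ≡⟨ cong (vs ++_) (List.++-assoc xs (v ∷ ys) I) ⟨
        vs ++ ((xs ++ v ∷ ys) ++ I) ∎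
    ; edges    = E.↭-reflexive (≡.trans (sym (List.++-assoc (path s xs v) (path v ys t) _))
                   (cong (_++ concatMap edgesOf es) (sym (path-++ s xs v ys t))))
    ; zeta     = Z-smooth _≟_ {xs = xs} {ys = ys} s≢v t≢v
                   (Unique-head (WellFormed.unique wf)) (deg≡0⇒avoids es deg≡0) }
    where
    open PermutationReasoning
    I : List V
    I = concatMap interior es

  NormalForm : List V → List (Arc V) → Set
  NormalForm vs es = ∃ λ ws → ∃ λ fs → Normal ws fs × SameGraph vs es ws fs

  prepend : ∀ {vs es ws fs} → SameGraph vs es ws fs → NormalForm ws fs → NormalForm vs es
  prepend p (us , gs , n , q) = us , gs , n , SameGraph-trans p q

  by-rearranging : ∀ {vs es ws fs} → vs ↭ ws → es ~ fs → Normal ws fs → NormalForm vs es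
  by-rearranging vs↭ws es~fs n = _ , _ , n , rearrange vs↭ws es~fs

  figureEight-sort : ∀ v xs ys → NormalForm (v ∷ []) ((v , xs , v) ∷ (v , ys , v) ∷ [])
  figureEight-sort v xs ys with ℕ.≤-total (length xs) (length ys)
  ... | inj₁ x≤y = by-rearranging refl ~refl (figureEight v xs ys x≤y)
  ... | inj₂ y≤x = by-rearranging refl ~swap (figureEight v ys xs y≤x)

  dumbbell-sort : ∀ {v w} → v ≢ w → ∀ xs ys zs →
                  NormalForm (v ∷ w ∷ []) ((v , xs , v) ∷ (w , ys , w) ∷ (v , zs , w) ∷ [])
  dumbbell-sort {v} {w} v≢w xs ys zs with ℕ.≤-total (length xs) (length ys)
  ... | inj₁ x≤y = by-rearranging refl ~refl (dumbbell v w xs ys zs v≢w x≤y)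
  -- Exchanging the loops exchanges the two vertices, so the link has to be turned around as well.
  ... | inj₂ y≤x = by-rearranging (swap v w refl) (~trans ~swap (~cons (~cons ~flip)))
                     (dumbbell w v ys xs (reverse zs) (v≢w ∘ sym) y≤x)

  theta-sort : ∀ {v w} → v ≢ w → ∀ xs ys zs →
               NormalForm (v ∷ w ∷ []) ((v , xs , w) ∷ (v , ys , w) ∷ (v , zs , w) ∷ [])
  theta-sort {v} {w} v≢w xs ys zs
    with ℕ.≤-total (length xs) (length ys) | ℕ.≤-total (length ys) (length zs)
       | ℕ.≤-total (length xs) (length zs)
  ... | inj₁ x≤y | inj₁ y≤z | _ = by-rearranging refl ~refl (theta v w xs ys zs v≢w x≤y y≤z)
  ... | inj₁ x≤y | inj₂ z≤y | inj₁ x≤z =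
    by-rearranging refl (~cons ~swap) (theta v w xs zs ys v≢w x≤z z≤y)
  ... | inj₁ x≤y | inj₂ z≤y | inj₂ z≤x =
    by-rearranging refl (~trans (~cons ~swap) ~swap) (theta v w zs xs ys v≢w z≤x x≤y)
  ... | inj₂ y≤x | inj₁ y≤z | inj₁ x≤z =
    by-rearranging refl ~swap (theta v w ys xs zs v≢w y≤x x≤z)
  ... | inj₂ y≤x | inj₁ y≤z | inj₂ z≤x =
    by-rearranging refl (~trans ~swap (~cons ~swap)) (theta v w ys zs xs v≢w y≤z z≤x)
  ... | inj₂ y≤x | inj₂ z≤y | _ =
    by-rearranging refl (~trans (~cons ~swap) (~trans ~swap (~cons ~swap)))
      (theta v w zs ys xs v≢w z≤y y≤x)

  data Kind : Set where
    loop₁ loop₂ link : Kind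

  ends₁ ends₂ : Kind → ℕ
  ends₁ loop₁ = 2
  ends₁ loop₂ = 0
  ends₁ link  = 1
  ends₂ loop₁ = 0
  ends₂ loop₂ = 2
  ends₂ link  = 1

  module TwoVertices {v w : V} (v≢w : v ≢ w) where

    arc : Kind → List V → Arc V
    arc loop₁ xs = v , xs , v
    arc loop₂ xs = w , xs , w
    arc link  xs = v , xs , w

    orient : ∀ {s t} xs → s ∈ v ∷ w ∷ [] → t ∈ v ∷ w ∷ [] →
             ∃ λ k → ∃ λ ys → ∀ {es} → (s , xs , t) ∷ es ~ arc k ys ∷ es
    orient xs (here ≡.refl)         (here ≡.refl)         = loop₁ , xs , ~refl
    orient xs (here ≡.refl)         (there (here ≡.refl)) = link , xs , ~refl
    orient xs (there (here ≡.refl)) (here ≡.refl)         = link , reverse xs , ~flip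
    orient xs (there (here ≡.refl)) (there (here ≡.refl)) = loop₂ , xs , ~refl

    incidence₁ : ∀ k xs → incidence v (arc k xs) ≡ ends₁ k
    incidence₁ loop₁ xs rewrite [≐]-refl v = ≡.refl
    incidence₁ loop₂ xs rewrite [≐]-≢ (v≢w ∘ sym) = ≡.refl
    incidence₁ link  xs rewrite [≐]-refl v | [≐]-≢ (v≢w ∘ sym) = ≡.refl

    incidence₂ : ∀ k xs → incidence w (arc k xs) ≡ ends₂ k
    incidence₂ loop₁ xs rewrite [≐]-≢ v≢w = ≡.refl
    incidence₂ loop₂ xs rewrite [≐]-refl w = ≡.refl
    incidence₂ link  xs rewrite [≐]-refl w | [≐]-≢ v≢w = ≡.refl

    -- Of the 27 ways to place three arcs on two vertices, degree at least 3 at both leaves the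
    -- theta graph and six orders of the dumbbell. The degree conditions are Boolean computations,
    -- so an absurd pattern refutes each of the other twenty.
    resolve : ∀ k l m xs ys zs →
              T (3 ≤ᵇ ends₁ k ℕ.+ (ends₁ l ℕ.+ (ends₁ m ℕ.+ 0))) →
              T (3 ≤ᵇ ends₂ k ℕ.+ (ends₂ l ℕ.+ (ends₂ m ℕ.+ 0))) →
              NormalForm (v ∷ w ∷ []) (arc k xs ∷ arc l ys ∷ arc m zs ∷ [])
    resolve link  link  link  xs ys zs _ _ = theta-sort v≢w xs ys zs
    resolve loop₁ loop₂ link  xs ys zs _ _ = dumbbell-sort v≢w xs ys zs
    resolve loop₂ loop₁ link  xs ys zs _ _ =
      prepend (rearrange refl ~swap) (dumbbell-sort v≢w ys xs zs)
    resolve loop₁ link  loop₂ xs ys zs _ _ =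
      prepend (rearrange refl (~cons ~swap)) (dumbbell-sort v≢w xs zs ys)
    resolve loop₂ link  loop₁ xs ys zs _ _ =
      prepend (rearrange refl (~trans (~cons ~swap) ~swap)) (dumbbell-sort v≢w zs xs ys)
    resolve link  loop₁ loop₂ xs ys zs _ _ =
      prepend (rearrange refl (~trans ~swap (~cons ~swap))) (dumbbell-sort v≢w ys zs xs)
    resolve link  loop₂ loop₁ xs ys zs _ _ =
      prepend (rearrange refl (~trans ~swap (~trans (~cons ~swap) ~swap))) (dumbbell-sort v≢w zs ys xs)
    resolve loop₁ loop₁ loop₁ xs ys zs _ ()
    resolve loop₁ loop₁ loop₂ xs ys zs _ ()
    resolve loop₁ loop₁ link  xs ys zs _ ()
    resolve loop₁ loop₂ loop₁ xs ys zs _ ()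
    resolve loop₁ loop₂ loop₂ xs ys zs () _
    resolve loop₁ link  loop₁ xs ys zs _ ()
    resolve loop₁ link  link  xs ys zs _ ()
    resolve loop₂ loop₁ loop₁ xs ys zs _ ()
    resolve loop₂ loop₁ loop₂ xs ys zs () _
    resolve loop₂ loop₂ loop₁ xs ys zs () _
    resolve loop₂ loop₂ loop₂ xs ys zs () _
    resolve loop₂ loop₂ link  xs ys zs () _
    resolve loop₂ link  loop₂ xs ys zs () _
    resolve loop₂ link  link  xs ys zs () _
    resolve link  loop₁ loop₁ xs ys zs _ ()
    resolve link  loop₁ link  xs ys zs _ ()
    resolve link  loop₂ loop₂ xs ys zs () _
    resolve link  loop₂ link  xs ys zs () _
    resolve link  link  loop₁ xs ys zs _ ()
    resolve link  link  loop₂ xs ys zs () _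

  -- The chain 3|V| ≤ Σ deg ≤ 2|E| = 2|V| + 2 allows at most two vertices. Without vertices the one
  -- arc would have no ends, and on a single vertex both arcs are loops.
  terminal : ∀ {vs es} → WellFormed vs es → (∀ {v} → v ∈ vs → 3 ≤ deg es v) → NormalForm vs es
  terminal {vs} {es} wf ≥3 = go vs es inside count unique ≥3
      (ℕ.≤-trans (total-deg-lower es vs ≥3) (handshake es unique))
    where
    open WellFormed wf
    go : ∀ vs es → All (λ (s , _ , t) → s ∈ vs × t ∈ vs) es → length es ≡ suc (length vs) →
         Unique vs → (∀ {v} → v ∈ vs → 3 ≤ deg es v) →
         length vs ℕ.* 3 ≤ length es ℕ.* 2 → NormalForm vs es
    go [] (_ ∷ []) ((() , _) ∷ _) _ _ _ _
    go (v ∷ []) ((_ , xs , _) ∷ (_ , ys , _) ∷ [])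
       ((here ≡.refl , here ≡.refl) ∷ (here ≡.refl , here ≡.refl) ∷ []) _ _ _ _ = figureEight-sort v xs ys
    go (v ∷ w ∷ []) ((_ , xs , _) ∷ (_ , ys , _) ∷ (_ , zs , _) ∷ [])
       ((s₁ , t₁) ∷ (s₂ , t₂) ∷ (s₃ , t₃) ∷ []) _ ((v≢w ∷ []) ∷ _) ≥3 _
      with k , xs′ , to₁ ← TwoVertices.orient v≢w xs s₁ t₁
         | l , ys′ , to₂ ← TwoVertices.orient v≢w ys s₂ t₂
         | m , zs′ , to₃ ← TwoVertices.orient v≢w zs s₃ t₃
      = prepend (rearrange refl oriented) (resolve k l m xs′ ys′ zs′
          (ℕ.≤⇒≤ᵇ (subst (3 ≤_) deg-v (≥3 (here ≡.refl))))
          (ℕ.≤⇒≤ᵇ (subst (3 ≤_) deg-w (≥3 (there (here ≡.refl))))))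
      where
      open TwoVertices v≢w
      oriented = ~trans to₁ (~trans (~cons to₂) (~cons (~cons to₃)))
      deg-v = ≡.trans (deg-~ oriented v) (cong₂ ℕ._+_ (incidence₁ k xs′)
        (cong₂ ℕ._+_ (incidence₁ l ys′) (cong (ℕ._+ 0) (incidence₁ m zs′))))
      deg-w = ≡.trans (deg-~ oriented w) (cong₂ ℕ._+_ (incidence₂ k xs′)
        (cong₂ ℕ._+_ (incidence₂ l ys′) (cong (ℕ._+ 0) (incidence₂ m zs′))))
    go (u ∷ v ∷ w ∷ vs) es _ count _ _ bound = contradiction bound (ℕ.<⇒≱ (begin-strict
      length es ℕ.* 2                ≡⟨ cong (ℕ._* 2) count ⟩
      8 ℕ.+ length vs ℕ.* 2          <⟨ ℕ.n<1+n _ ⟩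
      9 ℕ.+ length vs ℕ.* 2          ≤⟨ ℕ.+-monoʳ-≤ 9 (ℕ.*-monoʳ-≤ (length vs) (s≤s (s≤s z≤n))) ⟩
      9 ℕ.+ length vs ℕ.* 3          ∎))
      where open ℕ.≤-Reasoning

  -- A vertex of degree 2 either carries one loop, which `no-isolated-loop` excludes, or meets two
  -- arcs, which smoothing joins. Each round deletes a vertex, and `n` makes this decrease
  -- structural.
  normalise : ∀ n {vs es} → length vs ≡ n → WellFormed vs es → NormalForm vs es
  normalise n {vs} {es} len wf with any? (λ v → deg es v ℕ.≟ 2) vs
  ... | no ¬any = terminal wf λ v∈ →
    ℕ.≤∧≢⇒< (WellFormed.deg≥2 wf v∈) (λ eq → ¬any (lose v∈ (sym eq)))
  ... | yes any with v , v∈ , deg≡2 ← find any with as , bs , ≡.refl ← ∈-∃++ v∈ = remove n len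
    where
    us : List V
    us = as ++ bs
    vs↭ : as ++ v ∷ bs ↭ v ∷ us
    vs↭ = ↭.shift v as bs

    remove : ∀ n → length (as ++ v ∷ bs) ≡ n → NormalForm (as ++ v ∷ bs) es
    remove zero    len with () ← ≡.trans (sym (↭.↭-length vs↭)) len
    remove (suc n) len
      with xs , s , fs , es~ ← pull es (λ eq → contradiction (≡.trans (sym deg≡2) eq) (λ ()))
      with s ≟ v
    ... | yes ≡.refl = ⊥-elim (no-isolated-loop (WellFormed-resp vs↭ es~ wf) fs≡0)
      where
      fs≡0 : deg fs v ≡ 0
      fs≡0 = ℕ.+-cancelˡ-≡ 2 _ _ (≡.trans
        (sym (cong (λ i → i ℕ.+ i ℕ.+ deg fs v) ([≐]-refl v)))
        (≡.trans (sym (deg-~ es~ v)) deg≡2))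
    ... | no s≢v = continue (pull fs (λ eq → contradiction (≡.trans (sym fs≡1) eq) (λ ())))
      where
      fs≡1 : deg fs v ≡ 1
      fs≡1 = ℕ.+-cancelˡ-≡ 1 _ _ (≡.trans
        (sym (cong₂ (λ i j → i ℕ.+ j ℕ.+ deg fs v) ([≐]-refl v) ([≐]-≢ s≢v)))
        (≡.trans (sym (deg-~ es~ v)) deg≡2))

      continue : (∃ λ ys → ∃ λ t → ∃ λ gs → fs ~ (v , ys , t) ∷ gs) → NormalForm (as ++ v ∷ bs) es
      continue (ys , t , gs , fs~) = prepend (rearrange vs↭ es~′)
        (prepend (smooth-same s≢v t≢v gs≡0 wf′)
          (normalise n (ℕ.suc-injective (≡.trans (sym (↭.↭-length vs↭)) len))
            (smooth s≢v t≢v gs≡0 wf′)))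
        where
        es~′ : es ~ (s , reverse xs , v) ∷ (v , ys , t) ∷ gs
        es~′ = ~trans es~ (~trans ~flip (~cons fs~))
        wf′ : WellFormed (v ∷ us) ((s , reverse xs , v) ∷ (v , ys , t) ∷ gs)
        wf′ = WellFormed-resp vs↭ es~′ wf
        total : 1 ℕ.+ [ t ≐ v ] ℕ.+ deg gs v ≡ 1
        total = ≡.trans (sym (cong (λ i → i ℕ.+ [ t ≐ v ] ℕ.+ deg gs v) ([≐]-refl v)))
          (≡.trans (sym (deg-~ fs~ v)) fs≡1)
        t≢v : t ≢ v
        t≢v ≡.refl with () ← ≡.trans (sym (cong (λ i → 1 ℕ.+ i ℕ.+ deg gs v) ([≐]-refl v))) total
        gs≡0 : deg gs v ≡ 0
        gs≡0 = ℕ.m+n≡0⇒n≡0 [ t ≐ v ] (ℕ.suc-injective total)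

-- Recovering the lengths from the value at 10

module Decimal where
  open import Data.Integer.Base using (_+_; _*_; _-_; -_; _^_)
  open import Data.Integer.Divisibility.Signed using (_∣_; _∣?_)
  open +-*-Solver using (solve; _:=_; _:+_; _:*_; :-_; _:-_; con)

  10ℤ 2ℤ 4ℤ : ℤ
  10ℤ = ℤ.+ 10
  2ℤ  = ℤ.+ 2
  4ℤ  = ℤ.+ 4

  -- At the uses `c` is a literal, so the implicit argument is settled by computation and only the
  -- quotient `k` has to be exhibited.
  10∤ : ∀ c {_ : False (10ℤ ∣? c)} {m} k → m ≡ c + 10ℤ * k → ¬ (10ℤ ∣ m)
  10∤ c {nondiv} k ≡.refl 10∣m =
    toWitnessFalse nondiv (Divisibility.∣m+n∣n⇒∣m 10∣m (Divisibility.∣m⇒∣m*n k Divisibility.∣-refl))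

  cancel-10^ : ∀ i {m n} → 10ℤ ^ i * m ≡ 10ℤ ^ i * n → m ≡ n
  cancel-10^ zero    eq = ≡.trans (sym (ℤ.*-identityˡ _)) (≡.trans eq (ℤ.*-identityˡ _))
  cancel-10^ (suc i) eq = cancel-10^ i (ℤ.*-cancelˡ-≡ 10ℤ _ _
    (≡.trans (sym (ℤ.*-assoc 10ℤ (10ℤ ^ i) _)) (≡.trans eq (ℤ.*-assoc 10ℤ (10ℤ ^ i) _))))

  -- After the common powers are cancelled, a ten left over on one side would divide the cofactor on
  -- the other. The argument holds for a composite base as well.
  valuation : ∀ i j {m n} → ¬ (10ℤ ∣ m) → ¬ (10ℤ ∣ n) → 10ℤ ^ i * m ≡ 10ℤ ^ j * n → i ≡ j
  valuation zero    zero    _    _    _  = ≡.refl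
  valuation zero    (suc j) 10∤m _    eq = contradiction
    (Divisibility.divides (10ℤ ^ j * _) (≡.trans (sym (ℤ.*-identityˡ _)) (≡.trans eq
      (solve 2 (λ a b → con 10ℤ :* a :* b := a :* b :* con 10ℤ) ≡.refl (10ℤ ^ j) _)))) 10∤m
  valuation (suc i) zero    _    10∤n eq = contradiction
    (Divisibility.divides (10ℤ ^ i * _) (≡.trans (sym (ℤ.*-identityˡ _)) (≡.trans (sym eq)
      (solve 2 (λ a b → con 10ℤ :* a :* b := a :* b :* con 10ℤ) ≡.refl (10ℤ ^ i) _)))) 10∤n
  valuation (suc i) (suc j) 10∤m 10∤n eq = cong suc (valuation i j 10∤m 10∤n
    (ℤ.*-cancelˡ-≡ 10ℤ _ _
      (≡.trans (sym (ℤ.*-assoc 10ℤ (10ℤ ^ i) _)) (≡.trans eq (ℤ.*-assoc 10ℤ (10ℤ ^ j) _)))))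

  dumbbellℤ thetaℤ : (x y z : ℤ) → ℤ
  dumbbellℤ x y z = (1ℤ - x) * (1ℤ - y) * ((1ℤ - x) * (1ℤ - y) - 4ℤ * (x * y * (z * z)))
  thetaℤ x y z =
    (1ℤ - x * y - x * z - y * z) * (1ℤ - x * y - x * z - y * z) - 4ℤ * (x * y * z * (x * y * z))

  -- The three smallest exponents of 1 − P, read off one after the other as 10-adic
  -- valuations: P = (1 − x)² − 2y(1 − x) + y² − r with x = 10^p, y = 10^(p+d) and
  -- r = 10^(p+d+e) m, where p = p′ + 1 and m ≡ c mod 10.
  record Expansion (P : ℤ) (p′ d e : ℕ) (c k : ℤ) : Set where
    x : ℤ
    x = 10ℤ ^ suc p′
    D : ℤ
    D = 10ℤ ^ d
    E : ℤ
    E = 10ℤ ^ e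
    m : ℤ
    m = c + 10ℤ * k
    field
      c-cases  : c ≡ 2ℤ ⊎ (c ≡ - 2ℤ × e ≢ 0)
      expanded : P ≡ (1ℤ - x) * (1ℤ - x) - 2ℤ * (x * D) * (1ℤ - x) + x * D * (x * D) - x * D * E * m

    x′ m₁ m₂ : ℤ
    x′ = 10ℤ ^ p′
    m₁ = 2ℤ - x + 2ℤ * D * (1ℤ - x) - x * D * D + D * E * m
    m₂ = 2ℤ * (1ℤ - x) - x * D + E * m

    first : 1ℤ - P ≡ x * m₁
    first = ≡.trans (cong (λ z → 1ℤ - z) expanded)
      (solve 4 (λ x D E m →
        con 1ℤ :- ((con 1ℤ :- x) :* (con 1ℤ :- x) :- con 2ℤ :* (x :* D) :* (con 1ℤ :- x)
          :+ x :* D :* (x :* D) :- x :* D :* E :* m)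
        := x :* (con 2ℤ :- x :+ con 2ℤ :* D :* (con 1ℤ :- x) :- x :* D :* D :+ D :* E :* m))
        ≡.refl x D E m)

    second : (1ℤ - x) * (1ℤ - x) - P ≡ x * (10ℤ ^ d * m₂)
    second = ≡.trans (cong (λ z → (1ℤ - x) * (1ℤ - x) - z) expanded)
      (solve 4 (λ x D E m →
        (con 1ℤ :- x) :* (con 1ℤ :- x) :- ((con 1ℤ :- x) :* (con 1ℤ :- x)
          :- con 2ℤ :* (x :* D) :* (con 1ℤ :- x) :+ x :* D :* (x :* D) :- x :* D :* E :* m)
        := x :* (D :* (con 2ℤ :* (con 1ℤ :- x) :- x :* D :+ E :* m))) ≡.refl x D E m)

    third : m₂ - 2ℤ * (1ℤ - x) + x * D ≡ 10ℤ ^ e * m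
    third = solve 4 (λ x D E m →
      con 2ℤ :* (con 1ℤ :- x) :- x :* D :+ E :* m :- con 2ℤ :* (con 1ℤ :- x) :+ x :* D := E :* m)
      ≡.refl x D E m

    10∤m : ¬ (10ℤ ∣ m)
    10∤m with c-cases
    ... | inj₁ ≡.refl       = 10∤ 2ℤ k ≡.refl
    ... | inj₂ (≡.refl , _) = 10∤ (- 2ℤ) k ≡.refl

    -- Modulo ten `m₁` is twice the number of terms among 2x, 2y and r that share the smallest
    -- exponent: 6, 4 or 2. A coefficient -2 in r could cancel one of the others, but then e ≢ 0
    -- keeps r behind y.
    10∤m₁ : ¬ (10ℤ ∣ m₁)
    10∤m₁ = nondivisible d e c-cases
      where
      nondivisible : ∀ d e → c ≡ 2ℤ ⊎ (c ≡ - 2ℤ × e ≢ 0) →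
        ¬ (10ℤ ∣ 2ℤ - x + 2ℤ * 10ℤ ^ d * (1ℤ - x) - x * 10ℤ ^ d * 10ℤ ^ d + 10ℤ ^ d * 10ℤ ^ e * m)
      nondivisible zero zero (inj₁ ≡.refl) = 10∤ (ℤ.+ 6) (k - 4ℤ * x′)
        (solve 2 (λ x′ k → let x = con 10ℤ :* x′ ; m = con 2ℤ :+ con 10ℤ :* k in
          con 2ℤ :- x :+ con 2ℤ :* con 1ℤ :* (con 1ℤ :- x) :- x :* con 1ℤ :* con 1ℤ
            :+ con 1ℤ :* con 1ℤ :* m
          := con (ℤ.+ 6) :+ con 10ℤ :* (k :- con 4ℤ :* x′)) ≡.refl x′ k)
      nondivisible zero zero (inj₂ (_ , e≢0)) = contradiction ≡.refl e≢0
      nondivisible zero (suc e) _ = 10∤ 4ℤ (10ℤ ^ e * m - 4ℤ * x′)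
        (solve 3 (λ x′ E m → let x = con 10ℤ :* x′ in
          con 2ℤ :- x :+ con 2ℤ :* con 1ℤ :* (con 1ℤ :- x) :- x :* con 1ℤ :* con 1ℤ
            :+ con 1ℤ :* (con 10ℤ :* E) :* m
          := con 4ℤ :+ con 10ℤ :* (E :* m :- con 4ℤ :* x′)) ≡.refl x′ (10ℤ ^ e) m)
      nondivisible (suc d) e _ = 10∤ 2ℤ
        (2ℤ * 10ℤ ^ d * (1ℤ - x) - x′ - x * 10ℤ ^ d * 10ℤ ^ suc d + 10ℤ ^ d * 10ℤ ^ e * m)
        (solve 4 (λ x′ D E m → let x = con 10ℤ :* x′ ; D′ = con 10ℤ :* D in
          con 2ℤ :- x :+ con 2ℤ :* D′ :* (con 1ℤ :- x) :- x :* D′ :* D′ :+ D′ :* E :* m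
          := con 2ℤ :+ con 10ℤ :* (con 2ℤ :* D :* (con 1ℤ :- x) :- x′ :- x :* D :* D′ :+ D :* E :* m))
          ≡.refl x′ (10ℤ ^ d) (10ℤ ^ e) m)

    10∤m₂ : ¬ (10ℤ ∣ m₂)
    10∤m₂ = nondivisible e c-cases
      where
      nondivisible : ∀ e → c ≡ 2ℤ ⊎ (c ≡ - 2ℤ × e ≢ 0) →
                     ¬ (10ℤ ∣ 2ℤ * (1ℤ - x) - x * D + 10ℤ ^ e * m)
      nondivisible zero (inj₁ ≡.refl) = 10∤ 4ℤ (k - 2ℤ * x′ - x′ * D)
        (solve 3 (λ x′ D k → let x = con 10ℤ :* x′ in
          con 2ℤ :* (con 1ℤ :- x) :- x :* D :+ con 1ℤ :* (con 2ℤ :+ con 10ℤ :* k)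
          := con 4ℤ :+ con 10ℤ :* (k :- con 2ℤ :* x′ :- x′ :* D)) ≡.refl x′ D k)
      nondivisible zero (inj₂ (_ , e≢0)) = contradiction ≡.refl e≢0
      nondivisible (suc e) _ = 10∤ 2ℤ (10ℤ ^ e * m - 2ℤ * x′ - x′ * D)
        (solve 4 (λ x′ D E m → let x = con 10ℤ :* x′ in
          con 2ℤ :* (con 1ℤ :- x) :- x :* D :+ con 10ℤ :* E :* m
          := con 2ℤ :+ con 10ℤ :* (E :* m :- con 2ℤ :* x′ :- x′ :* D)) ≡.refl
          x′ D (10ℤ ^ e) m)

  Expansion-unique : ∀ {P p d e c k p̂ d̂ ê ĉ k̂} → Expansion P p d e c k → Expansion P p̂ d̂ ê ĉ k̂ →
                     p ≡ p̂ × d ≡ d̂ × e ≡ ê × c + 10ℤ * k ≡ ĉ + 10ℤ * k̂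
  Expansion-unique {P} {p} {d} {e} {c} {k} {p̂} {d̂} {ê} {ĉ} {k̂} exp exp′ =
    ℕ.suc-injective p≡ , d≡ , e≡ , m≡
    where
    module X = Expansion exp
    module Y = Expansion exp′
    open ≡-Reasoning
    p≡ : suc p ≡ suc p̂
    p≡ = valuation (suc p) (suc p̂) X.10∤m₁ Y.10∤m₁ (≡.trans (sym X.first) Y.first)

    seconds : 10ℤ ^ d * X.m₂ ≡ 10ℤ ^ d̂ * Y.m₂
    seconds = cancel-10^ (suc p) (begin
      X.x * (10ℤ ^ d * X.m₂)        ≡⟨ X.second ⟨
      (1ℤ - X.x) * (1ℤ - X.x) - P   ≡⟨ cong (λ p → (1ℤ - 10ℤ ^ p) * (1ℤ - 10ℤ ^ p) - P) p≡ ⟩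
      (1ℤ - Y.x) * (1ℤ - Y.x) - P   ≡⟨ Y.second ⟩
      Y.x * (10ℤ ^ d̂ * Y.m₂)        ≡⟨ cong (λ p → 10ℤ ^ p * (10ℤ ^ d̂ * Y.m₂)) p≡ ⟨
      X.x * (10ℤ ^ d̂ * Y.m₂)        ∎)

    d≡ : d ≡ d̂
    d≡ = valuation d d̂ X.10∤m₂ Y.10∤m₂ seconds

    m₂≡ : X.m₂ ≡ Y.m₂
    m₂≡ = cancel-10^ d (≡.trans seconds (cong (λ d → 10ℤ ^ d * Y.m₂) (sym d≡)))

    thirds : 10ℤ ^ e * X.m ≡ 10ℤ ^ ê * Y.m
    thirds = begin
      10ℤ ^ e * X.m                         ≡⟨ X.third ⟨
      X.m₂ - 2ℤ * (1ℤ - X.x) + X.x * X.D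
        ≡⟨ cong₂ (λ p d → X.m₂ - 2ℤ * (1ℤ - 10ℤ ^ p) + 10ℤ ^ p * 10ℤ ^ d) p≡ d≡ ⟩
      X.m₂ - 2ℤ * (1ℤ - Y.x) + Y.x * Y.D    ≡⟨ cong (λ z → z - 2ℤ * (1ℤ - Y.x) + Y.x * Y.D) m₂≡ ⟩
      Y.m₂ - 2ℤ * (1ℤ - Y.x) + Y.x * Y.D    ≡⟨ Y.third ⟩
      10ℤ ^ ê * Y.m                         ∎

    e≡ : e ≡ ê
    e≡ = valuation e ê X.10∤m Y.10∤m thirds

    m≡ : X.m ≡ Y.m
    m≡ = cancel-10^ e (≡.trans thirds (cong (λ e → 10ℤ ^ e * Y.m) (sym e≡)))

  +-cancelˡ : LeftCancellative _≡_ _+_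
  +-cancelˡ = GroupProperties.∙-cancelˡ (AbelianGroup.group ℤ.+-0-abelianGroup)

  -- The weight of a path with k interior vertices.
  w : ℕ → ℤ
  w k = 10ℤ ^ suc k

  10^-+ : ∀ i j → 10ℤ ^ (i ℕ.+ j) ≡ 10ℤ ^ i * 10ℤ ^ j
  10^-+ = ℤ.^-distribˡ-+-* 10ℤ

  -- For path weights A, B = A·I and C = A·I·J the cycle weights in increasing order are AB, AC =
  -- AB·J and BC = AC·I, which puts `j` before `i`. The exponent of AB is (a + 1) + (a + i + 1), and
  -- its predecessor is the first index. Every nonconstant term of the last cofactor contains AB,
  -- hence a factor ten; the witness is their sum divided by ten.
  theta-expansion : ∀ a i j →
    ∃ (Expansion (thetaℤ (w a) (w (a ℕ.+ i)) (w (a ℕ.+ i ℕ.+ j))) (a ℕ.+ suc (a ℕ.+ i)) j i 2ℤ)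
  theta-expansion a i j =
    - (2ℤ * x′) - 2ℤ * x′ * J - x′ * I * J + 4ℤ * x′ * (10ℤ * x′) * J , record
    { c-cases = inj₁ ≡.refl
    ; expanded = begin
        thetaℤ A (w (a ℕ.+ i)) (w (a ℕ.+ i ℕ.+ j))
          ≡⟨ cong₂ (thetaℤ A) b≡ (≡.trans (10^-+ (suc (a ℕ.+ i)) j) (cong (_* J) b≡)) ⟩
        thetaℤ A (A * I) (A * I * J)
          ≡⟨ solve 3 (λ A I J → let B = A :* I ; C = A :* I :* J ; S = con 1ℤ :- A :* B :- A :* C :- B :* C
                                    x = A :* B in
               S :* S :- con 4ℤ :* (A :* B :* C :* (A :* B :* C))
               := (con 1ℤ :- x) :* (con 1ℤ :- x) :- con 2ℤ :* (x :* J) :* (con 1ℤ :- x)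
                  :+ x :* J :* (x :* J) :- x :* J :* I :*
                  (con 2ℤ :- con 2ℤ :* x :- con 2ℤ :* x :* J :- x :* I :* J :+ con 4ℤ :* x :* x :* J))
               ≡.refl A I J ⟩
        expression (A * (A * I))
          ≡⟨ cong expression (≡.trans (10^-+ (suc a) (suc (a ℕ.+ i))) (cong (A *_) b≡)) ⟨
        expression (10ℤ * x′)
          ≡⟨ cong (λ m → (1ℤ - 10ℤ * x′) * (1ℤ - 10ℤ * x′) - 2ℤ * (10ℤ * x′ * J) * (1ℤ - 10ℤ * x′)
                            + 10ℤ * x′ * J * (10ℤ * x′ * J) - 10ℤ * x′ * J * I * m)
               (solve 3 (λ x′ I J → let x = con 10ℤ :* x′ in
                 con 2ℤ :- con 2ℤ :* x :- con 2ℤ :* x :* J :- x :* I :* J :+ con 4ℤ :* x :* x :* J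
                 := con 2ℤ :+ con 10ℤ :* (:- (con 2ℤ :* x′) :- con 2ℤ :* x′ :* J :- x′ :* I :* J
                                            :+ con 4ℤ :* x′ :* x :* J)) ≡.refl x′ I J) ⟩
        _ ∎ }
    where
    open ≡-Reasoning
    p′ : ℕ
    p′ = a ℕ.+ suc (a ℕ.+ i)
    A I J x′ : ℤ
    A = w a
    I = 10ℤ ^ i
    J = 10ℤ ^ j
    x′ = 10ℤ ^ p′
    b≡ : w (a ℕ.+ i) ≡ A * I
    b≡ = 10^-+ (suc a) i
    expression : ℤ → ℤ
    expression x = (1ℤ - x) * (1ℤ - x) - 2ℤ * (x * J) * (1ℤ - x) + x * J * (x * J)
                     - x * J * I * (2ℤ - 2ℤ * x - 2ℤ * x * J - x * I * J + 4ℤ * x * x * J)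

  -- The remainder r is xy times this, since (1 - x)(1 - y) differs from 1 - x - y by xy; hence `e`
  -- is the exponent a + 1 of x. For weights x and y divisible by ten the residue is -2 + 4z², that
  -- is 2 for z = 1 and -2 when z is the weight of a link.
  dumbbell-tail : (x y z : ℤ) → ℤ
  dumbbell-tail x y z = - (2ℤ * (1ℤ - x)) + y * (2ℤ - x) + z * z * (4ℤ * (1ℤ - x) * (1ℤ - y))

  dumbbell-expanded : ∀ a i z → dumbbellℤ (w a) (w (a ℕ.+ i)) z ≡
    (1ℤ - w a) * (1ℤ - w a) - 2ℤ * (w a * 10ℤ ^ i) * (1ℤ - w a) + w a * 10ℤ ^ i * (w a * 10ℤ ^ i)
      - w a * 10ℤ ^ i * w a * dumbbell-tail (w a) (w a * 10ℤ ^ i) z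
  dumbbell-expanded a i z = ≡.trans (cong (λ b → dumbbellℤ (w a) b z) (10^-+ (suc a) i))
    (solve 3 (λ x I z → let y = x :* I in
      (con 1ℤ :- x) :* (con 1ℤ :- y) :* ((con 1ℤ :- x) :* (con 1ℤ :- y)
        :- con 4ℤ :* (x :* y :* (z :* z)))
      := (con 1ℤ :- x) :* (con 1ℤ :- x) :- con 2ℤ :* y :* (con 1ℤ :- x) :+ y :* y
         :- x :* I :* x :* (:- (con 2ℤ :* (con 1ℤ :- x)) :+ y :* (con 2ℤ :- x)
             :+ z :* z :* (con 4ℤ :* (con 1ℤ :- x) :* (con 1ℤ :- y))))
      ≡.refl (w a) (10ℤ ^ i) z)

  dumbbell-expansion : ∀ a i z c k → c ≡ 2ℤ ⊎ c ≡ - 2ℤ →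
    dumbbell-tail (w a) (w a * 10ℤ ^ i) z ≡ c + 10ℤ * k →
    Expansion (dumbbellℤ (w a) (w (a ℕ.+ i)) z) a i (suc a) c k
  dumbbell-expansion a i z c k c≡ tail≡ = record
    { c-cases  = Sum.map₂ (λ eq → eq , λ ()) c≡
    ; expanded = ≡.trans (dumbbell-expanded a i z)
        (cong (λ m → (1ℤ - w a) * (1ℤ - w a) - 2ℤ * (w a * 10ℤ ^ i) * (1ℤ - w a)
                       + w a * 10ℤ ^ i * (w a * 10ℤ ^ i) - w a * 10ℤ ^ i * w a * m) tail≡) }

  figureEight-residue : ∀ a i → ∃ λ k → dumbbell-tail (w a) (w a * 10ℤ ^ i) 1ℤ ≡ 2ℤ + 10ℤ * k
  figureEight-residue a i = - (2ℤ * A) - 2ℤ * A * I + ℤ.+ 3 * A * (10ℤ * A) * I ,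
    solve 2 (λ A I → let x = con 10ℤ :* A ; y = x :* I in
      :- (con 2ℤ :* (con 1ℤ :- x)) :+ y :* (con 2ℤ :- x)
        :+ con 1ℤ :* con 1ℤ :* (con 4ℤ :* (con 1ℤ :- x) :* (con 1ℤ :- y))
      := con 2ℤ :+ con 10ℤ :* (:- (con 2ℤ :* A) :- con 2ℤ :* A :* I
                                 :+ con (ℤ.+ 3) :* A :* x :* I)) ≡.refl A I
    where
    A I : ℤ
    A = 10ℤ ^ a
    I = 10ℤ ^ i

  dumbbell-residue : ∀ a i l → ∃ λ k → dumbbell-tail (w a) (w a * 10ℤ ^ i) (w l) ≡ - 2ℤ + 10ℤ * k
  dumbbell-residue a i l =
    2ℤ * A + A * I * (2ℤ - 10ℤ * A) + 10ℤ * L * L * (4ℤ * (1ℤ - 10ℤ * A) * (1ℤ - 10ℤ * A * I)) ,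
    solve 3 (λ A I L → let x = con 10ℤ :* A ; y = x :* I ; z = con 10ℤ :* L in
      :- (con 2ℤ :* (con 1ℤ :- x)) :+ y :* (con 2ℤ :- x)
        :+ z :* z :* (con 4ℤ :* (con 1ℤ :- x) :* (con 1ℤ :- y))
      := con (- 2ℤ) :+ con 10ℤ :* (con 2ℤ :* A :+ A :* I :* (con 2ℤ :- x)
           :+ con 10ℤ :* L :* L :* (con 4ℤ :* (con 1ℤ :- x) :* (con 1ℤ :- y)))) ≡.refl A I L
    where
    A I L : ℤ
    A = 10ℤ ^ a
    I = 10ℤ ^ i
    L = 10ℤ ^ l

  residues-differ : ∀ k l → 2ℤ + 10ℤ * k ≢ - 2ℤ + 10ℤ * l
  residues-differ k l eq = 10∤ 4ℤ (k - l)
    (≡.trans (sym (ℤ.i≡j⇒i-j≡0 {2ℤ + 10ℤ * k} {(- 2ℤ) + 10ℤ * l} eq))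
      (solve 2 (λ k l → con 2ℤ :+ con 10ℤ :* k :- (con (- 2ℤ) :+ con 10ℤ :* l)
                          := con 4ℤ :+ con 10ℤ :* (k :- l)) ≡.refl k l))
    (Divisibility.divides 0ℤ ≡.refl)

  figureEight-expansion : ∀ a i → ∃ (Expansion (dumbbellℤ (w a) (w (a ℕ.+ i)) 1ℤ) a i (suc a) 2ℤ)
  figureEight-expansion a i = proj₁ residue ,
    dumbbell-expansion a i 1ℤ 2ℤ (proj₁ residue) (inj₁ ≡.refl) (proj₂ residue)
    where residue = figureEight-residue a i

  -- The loops give a and i; then l is read off the term 4 · 10^(2(l+1)) (1 − x)(1 − y) of the tail.
  tail-injective : ∀ {a i a′ i′} l l′ → a ≡ a′ → i ≡ i′ →
    dumbbell-tail (w a) (w a * 10ℤ ^ i) (w l) ≡ dumbbell-tail (w a′) (w a′ * 10ℤ ^ i′) (w l′) → l ≡ l′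
  tail-injective {a} {i} l l′ ≡.refl ≡.refl eq = ℕ.suc-injective (double-injective
    (valuation (suc l ℕ.+ suc l) (suc l′ ℕ.+ suc l′) 10∤n 10∤n squares))
    where
    open ≡-Reasoning
    x y n : ℤ
    x = w a
    y = w a * 10ℤ ^ i
    n = 4ℤ * (1ℤ - x) * (1ℤ - y)
    10∤n : ¬ (10ℤ ∣ n)
    10∤n = 10∤ 4ℤ (4ℤ * (10ℤ ^ a * x * 10ℤ ^ i - 10ℤ ^ a - 10ℤ ^ a * 10ℤ ^ i))
      (solve 2 (λ A I → let x = con 10ℤ :* A in
        con 4ℤ :* (con 1ℤ :- x) :* (con 1ℤ :- x :* I)
        := con 4ℤ :+ con 10ℤ :* (con 4ℤ :* (A :* x :* I :- A :- A :* I))) ≡.refl (10ℤ ^ a) (10ℤ ^ i))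
    squares : 10ℤ ^ (suc l ℕ.+ suc l) * n ≡ 10ℤ ^ (suc l′ ℕ.+ suc l′) * n
    squares = begin
      10ℤ ^ (suc l ℕ.+ suc l) * n   ≡⟨ cong (_* n) (10^-+ (suc l) (suc l)) ⟩
      w l * w l * n
        ≡⟨ +-cancelˡ (- (2ℤ * (1ℤ - x)) + y * (2ℤ - x)) (w l * w l * n) (w l′ * w l′ * n) eq ⟩
      w l′ * w l′ * n               ≡⟨ cong (_* n) (10^-+ (suc l′) (suc l′)) ⟨
      10ℤ ^ (suc l′ ℕ.+ suc l′) * n ∎
    double-injective : ∀ {m n} → m ℕ.+ m ≡ n ℕ.+ n → m ≡ n
    double-injective {m} {n} eq = ℕ.*-cancelˡ-≡ m n 2
      (≡.trans (cong (m ℕ.+_) (ℕ.+-identityʳ m)) (≡.trans eq (sym (cong (n ℕ.+_) (ℕ.+-identityʳ n)))))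

  unique-at : ∀ {P Q p d e c k p̂ d̂ ê ĉ k̂} → P ≡ Q → Expansion P p d e c k → Expansion Q p̂ d̂ ê ĉ k̂ →
              p ≡ p̂ × d ≡ d̂ × e ≡ ê × c + 10ℤ * k ≡ ĉ + 10ℤ * k̂
  unique-at ≡.refl = Expansion-unique

  figureEight-injective : ∀ a i a′ i′ →
    dumbbellℤ (w a) (w (a ℕ.+ i)) 1ℤ ≡ dumbbellℤ (w a′) (w (a′ ℕ.+ i′)) 1ℤ → a ≡ a′ × i ≡ i′
  figureEight-injective a i a′ i′ eq = proj₁ same , proj₁ (proj₂ same)
    where same = unique-at eq (proj₂ (figureEight-expansion a i)) (proj₂ (figureEight-expansion a′ i′))

  dumbbell-injective : ∀ a i l a′ i′ l′ →
    dumbbellℤ (w a) (w (a ℕ.+ i)) (w l) ≡ dumbbellℤ (w a′) (w (a′ ℕ.+ i′)) (w l′) →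
    a ≡ a′ × i ≡ i′ × l ≡ l′
  dumbbell-injective a i l a′ i′ l′ eq = proj₁ same , proj₁ (proj₂ same) ,
    tail-injective l l′ (proj₁ same) (proj₁ (proj₂ same))
      (≡.trans (proj₂ r) (≡.trans (proj₂ (proj₂ (proj₂ same))) (sym (proj₂ r′))))
    where
    r  = dumbbell-residue a i l
    r′ = dumbbell-residue a′ i′ l′
    same = unique-at eq
      (dumbbell-expansion a i (w l) (- 2ℤ) (proj₁ r) (inj₂ ≡.refl) (proj₂ r))
      (dumbbell-expansion a′ i′ (w l′) (- 2ℤ) (proj₁ r′) (inj₂ ≡.refl) (proj₂ r′))

  -- The exponent of the smallest cycle yields only 2a + i. The number `i` is the third exponent,
  -- the excess of BC over AC, and `a` then follows by halving.
  theta-injective : ∀ a i j a′ i′ j′ →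
    thetaℤ (w a) (w (a ℕ.+ i)) (w (a ℕ.+ i ℕ.+ j)) ≡
    thetaℤ (w a′) (w (a′ ℕ.+ i′)) (w (a′ ℕ.+ i′ ℕ.+ j′)) → a ≡ a′ × i ≡ i′ × j ≡ j′
  theta-injective a i j a′ i′ j′ eq = base (proj₁ same) i≡ , i≡ , proj₁ (proj₂ same)
    where
    same = unique-at eq (proj₂ (theta-expansion a i j)) (proj₂ (theta-expansion a′ i′ j′))
    i≡ : i ≡ i′
    i≡ = proj₁ (proj₂ (proj₂ same))
    shape : ∀ a i → a ℕ.+ suc (a ℕ.+ i) ≡ 2 ℕ.* a ℕ.+ suc i
    shape = solve-∀
    base : ∀ {i i′} → a ℕ.+ suc (a ℕ.+ i) ≡ a′ ℕ.+ suc (a′ ℕ.+ i′) → i ≡ i′ → a ≡ a′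
    base {i} p≡ ≡.refl = ℕ.*-cancelˡ-≡ a a′ 2 (ℕ.+-cancelʳ-≡ (suc i) _ _
      (≡.trans (sym (shape a i)) (≡.trans p≡ (shape a′ i))))

  figureEight≢dumbbell : ∀ a i a′ i′ l′ →
    dumbbellℤ (w a) (w (a ℕ.+ i)) 1ℤ ≢ dumbbellℤ (w a′) (w (a′ ℕ.+ i′)) (w l′)
  figureEight≢dumbbell a i a′ i′ l′ eq =
    residues-differ (proj₁ X) (proj₁ r′) (proj₂ (proj₂ (proj₂ same)))
    where
    X  = figureEight-expansion a i
    r′ = dumbbell-residue a′ i′ l′
    same = unique-at eq (proj₂ X)
      (dumbbell-expansion a′ i′ (w l′) (- 2ℤ) (proj₁ r′) (inj₂ ≡.refl) (proj₂ r′))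

  dumbbell≢theta : ∀ a i l a′ i′ j′ →
    dumbbellℤ (w a) (w (a ℕ.+ i)) (w l) ≢ thetaℤ (w a′) (w (a′ ℕ.+ i′)) (w (a′ ℕ.+ i′ ℕ.+ j′))
  dumbbell≢theta a i l a′ i′ j′ eq =
    residues-differ (proj₁ Y) (proj₁ r) (sym (proj₂ (proj₂ (proj₂ same))))
    where
    r = dumbbell-residue a i l
    Y = theta-expansion a′ i′ j′
    same = unique-at eq
      (dumbbell-expansion a i (w l) (- 2ℤ) (proj₁ r) (inj₂ ≡.refl) (proj₂ r)) (proj₂ Y)

  -- A figure eight looks like a theta graph with a path of length 0, which w excludes.
  figureEight≢theta : ∀ a i a′ i′ j′ →
    dumbbellℤ (w a) (w (a ℕ.+ i)) 1ℤ ≢ thetaℤ (w a′) (w (a′ ℕ.+ i′)) (w (a′ ℕ.+ i′ ℕ.+ j′))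
  figureEight≢theta a i a′ i′ j′ eq = ℕ.m+1+n≢n (suc a′ ℕ.+ a′)
    (≡.trans (sym (shape a′ i′)) (≡.trans (cong suc (sym (proj₁ same))) (proj₁ (proj₂ (proj₂ same)))))
    where
    same = unique-at eq (proj₂ (figureEight-expansion a i)) (proj₂ (theta-expansion a′ i′ j′))
    shape : ∀ a i → suc (a ℕ.+ suc (a ℕ.+ i)) ≡ suc a ℕ.+ a ℕ.+ suc i
    shape = solve-∀

-- Evaluation of integer polynomials

-- The denominator 1 is put in directly, without normalisation, so that `numerator` gives the
-- integer back by computation.
ℤ→ℚ : ℤ → ℚ
ℤ→ℚ i = mkℚ i 0 (Coprimality.sym (Coprimality.1-coprimeTo ℤ.∣ i ∣))

ℤ→ℚ-injective : ∀ {i j} → ℤ→ℚ i ≡ ℤ→ℚ j → i ≡ j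
ℤ→ℚ-injective = cong ℚ.numerator

ℚ-algebra : ℤ-Algebra
ℚ-algebra = record
  { Carrier = ℚ ; _+_ = ℚ._+_ ; _*_ = ℚ._*_ ; -_ = ℚ.-_ ; ι = ℤ→ℚ
  ; isCommutativeRing = ℚ.+-*-isCommutativeRing
  ; ι-+ = λ i j → ℚ.toℚᵘ-injective (ℚᵘ.≃-trans
      (*≡* (cong (ℤ._* 1ℤ) (sym (cong₂ ℤ._+_ (ℤ.*-identityʳ i) (ℤ.*-identityʳ j)))))
      (ℚᵘ.≃-sym (ℚ.toℚᵘ-homo-+ (ℤ→ℚ i) (ℤ→ℚ j))))
  ; ι-* = λ i j → ℚ.toℚᵘ-injective (ℚᵘ.≃-sym (ℚ.toℚᵘ-homo-* (ℤ→ℚ i) (ℤ→ℚ j)))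
  ; ι-neg = λ i → ℚ.toℚᵘ-injective (ℚᵘ.≃-sym (ℚ.toℚᵘ-homo‿- (ℤ→ℚ i))) }

module _ (R : ℤ-Algebra) where
  open ℤ-Algebra R

  ι-^ : ∀ i n → ι (i ℤ.^ n) ≡ ι i ^ n
  ι-^ i zero    = ≡.refl
  ι-^ i (suc n) = ≡.trans (ι-* i (i ℤ.^ n)) (cong (ι i *_) (ι-^ i n))

  ι-- : ∀ i j → ι (i ℤ.- j) ≡ ι i - ι j
  ι-- i j = ≡.trans (ι-+ i (ℤ.- j)) (cong (ι i +_) (ι-neg j))

  ι-1-^² : ∀ i n → ι (1ℤ ℤ.- i ℤ.^ n ℤ.* i ℤ.^ n) ≡ 1# - ι i ^ n * ι i ^ n
  ι-1-^² i n = ≡.trans (ι-- 1ℤ (i ℤ.^ n ℤ.* i ℤ.^ n))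
    (cong (λ x → 1# - x) (≡.trans (ι-* (i ℤ.^ n) (i ℤ.^ n)) (cong₂ _*_ (ι-^ i n) (ι-^ i n))))

-- Otherwise, taking absolute values, 2 + N would divide 1.
1-N²≢0 : ∀ N k → 1ℤ ℤ.- (ℤ.+ (2 ℕ.+ N)) ℤ.^ suc k ℤ.* (ℤ.+ (2 ℕ.+ N)) ℤ.^ suc k ≢ 0ℤ
1-N²≢0 N k eq = contradiction
  (ℕ.m*n≡1⇒m≡1 (2 ℕ.+ N) ℤ.∣ M ∣ (ℕ.m*n≡1⇒m≡1 ((2 ℕ.+ N) ℕ.* ℤ.∣ M ∣) _ square)) λ ()
  where
  open ≡-Reasoning
  M : ℤ
  M = (ℤ.+ (2 ℕ.+ N)) ℤ.^ k
  square : (2 ℕ.+ N) ℕ.* ℤ.∣ M ∣ ℕ.* ((2 ℕ.+ N) ℕ.* ℤ.∣ M ∣) ≡ 1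
  square = begin
    (2 ℕ.+ N) ℕ.* ℤ.∣ M ∣ ℕ.* ((2 ℕ.+ N) ℕ.* ℤ.∣ M ∣)
      ≡⟨ cong₂ ℕ._*_ (ℤ.abs-* (ℤ.+ (2 ℕ.+ N)) M) (ℤ.abs-* (ℤ.+ (2 ℕ.+ N)) M) ⟨
    ℤ.∣ ℤ.+ (2 ℕ.+ N) ℤ.* M ∣ ℕ.* ℤ.∣ ℤ.+ (2 ℕ.+ N) ℤ.* M ∣
      ≡⟨ ℤ.abs-* (ℤ.+ (2 ℕ.+ N) ℤ.* M) (ℤ.+ (2 ℕ.+ N) ℤ.* M) ⟨
    ℤ.∣ ℤ.+ (2 ℕ.+ N) ℤ.* M ℤ.* (ℤ.+ (2 ℕ.+ N) ℤ.* M) ∣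
      ≡⟨ cong ℤ.∣_∣ (ℤ.i-j≡0⇒i≡j 1ℤ (ℤ.+ (2 ℕ.+ N) ℤ.* M ℤ.* (ℤ.+ (2 ℕ.+ N) ℤ.* M)) eq) ⟨
    1 ∎

-- The index `N` stands for the point 2 + N, so that 1 and -1, where 1 - u^(2k) vanishes, are left
-- out by construction.
record IntegerPoint (N : ℕ) : Set₁ where
  field point : Point
  open Point point public
  field
    u≡ι         : u ≡ ι (ℤ.+ (2 ℕ.+ N))
    ι-injective : ∀ {i j} → ι i ≡ ι j → i ≡ j

abstract
  -- Opaque, so that type checking does not unfold the arithmetic of ℚ and later arguments go
  -- through the fields.
  integerPoint : ∀ N → IntegerPoint N
  integerPoint N = record
    { point = record
      { algebra   = ℚ-algebra
      ; u         = ℤ→ℚ n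
      ; g         = λ k → ℚ.1/_ (ℤ→ℚ (z k)) {{nonZero k}}
      ; g-inverse = λ k → ≡.trans
          (cong (ℚ._* (ℚ.1/_ (ℤ→ℚ (z k)) {{nonZero k}})) (sym (ι-1-^² ℚ-algebra n (suc k))))
          (ℚ.*-inverseʳ (ℤ→ℚ (z k)) {{nonZero k}}) }
    ; u≡ι = ≡.refl
    ; ι-injective = ℤ→ℚ-injective }
    where
    n : ℤ
    n = ℤ.+ (2 ℕ.+ N)
    z : ℕ → ℤ
    z k = 1ℤ ℤ.- n ℤ.^ suc k ℤ.* n ℤ.^ suc k
    nonZero : ∀ k → ℚ.NonZero (ℤ→ℚ (z k))
    nonZero k = ℚ.≢-nonZero (λ eq → 1-N²≢0 N k (ℤ→ℚ-injective eq))

module Evaluation (R : ℤ-Algebra) (u : ℤ-Algebra.Carrier R) where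
  open ℤ-Algebra R
  open Solver using (solve; _:=_; _:+_; _:*_; :-_; _:-_; con)

  ⟦_⟧ : Poly → Carrier
  ⟦ []    ⟧ = 0#
  ⟦ a ∷ p ⟧ = ι a + u * ⟦ p ⟧

  ⟦⟧-+ : ∀ p q → ⟦ p +ₚ q ⟧ ≡ ⟦ p ⟧ + ⟦ q ⟧
  ⟦⟧-+ []      q       = sym (+-identityˡ _)
  ⟦⟧-+ (a ∷ p) []      = sym (+-identityʳ _)
  ⟦⟧-+ (a ∷ p) (b ∷ q) = ≡.trans (cong₂ (λ x y → x + u * y) (ι-+ a b) (⟦⟧-+ p q))
    (solve 5 (λ a b u p q → a :+ b :+ u :* (p :+ q) := a :+ u :* p :+ (b :+ u :* q)) ≡.refl
      (ι a) (ι b) u ⟦ p ⟧ ⟦ q ⟧)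

  ⟦⟧-scale : ∀ a q → ⟦ map (a ℤ.*_) q ⟧ ≡ ι a * ⟦ q ⟧
  ⟦⟧-scale a []      = sym (zeroʳ _)
  ⟦⟧-scale a (b ∷ q) = ≡.trans (cong₂ (λ x y → x + u * y) (ι-* a b) (⟦⟧-scale a q))
    (solve 4 (λ a b u q → a :* b :+ u :* (a :* q) := a :* (b :+ u :* q)) ≡.refl (ι a) (ι b) u ⟦ q ⟧)

  ⟦⟧-* : ∀ p q → ⟦ p *ₚ q ⟧ ≡ ⟦ p ⟧ * ⟦ q ⟧
  ⟦⟧-* []      q = sym (zeroˡ _)
  ⟦⟧-* (a ∷ p) q = ≡.trans (⟦⟧-+ (map (a ℤ.*_) q) (0ℤ ∷ (p *ₚ q)))
    (≡.trans (cong₂ (λ x y → x + (0# + u * y)) (⟦⟧-scale a q) (⟦⟧-* p q))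
      (solve 4 (λ a u p q → a :* q :+ (con 0ℤ :+ u :* (p :* q)) := (a :+ u :* p) :* q) ≡.refl
        (ι a) u ⟦ p ⟧ ⟦ q ⟧))

  ⟦⟧-1 : ⟦ 1ₚ ⟧ ≡ 1#
  ⟦⟧-1 = solve 1 (λ u → con 1ℤ :+ u :* con 0ℤ := con 1ℤ) ≡.refl u

  ⟦⟧-neg1 : ⟦ map (ℤ.-_) 1ₚ ⟧ ≡ - 1#
  ⟦⟧-neg1 = ≡.trans (cong (_+ u * 0#) (ι-neg 1ℤ))
    (solve 1 (λ u → :- con 1ℤ :+ u :* con 0ℤ := :- con 1ℤ) ≡.refl u)

  ⟦⟧-^ : ∀ p n → ⟦ p ^ₚ n ⟧ ≡ ⟦ p ⟧ ^ n
  ⟦⟧-^ p zero    = ⟦⟧-1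
  ⟦⟧-^ p (suc n) = ≡.trans (⟦⟧-* p (p ^ₚ n)) (cong (⟦ p ⟧ *_) (⟦⟧-^ p n))

  ⟦⟧-sum : ∀ {n} (f : Fin n → Poly) {h : Fin n → Carrier} → (∀ j → ⟦ f j ⟧ ≡ h j) →
           ⟦ sumₚ f ⟧ ≡ sum h
  ⟦⟧-sum {zero}  f eq = ≡.refl
  ⟦⟧-sum {suc n} f eq = ≡.trans (⟦⟧-+ (f zero) _) (cong₂ _+_ (eq zero) (⟦⟧-sum (f ∘ suc) (eq ∘ suc)))

  ⟦⟧-det : ∀ {n} (A : Matrix Poly n) → ⟦ det ℤ[u] A ⟧ ≡ det rawRing (λ i j → ⟦ A i j ⟧)
  ⟦⟧-det {zero}  A = ⟦⟧-1
  ⟦⟧-det {suc n} A = ⟦⟧-sum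
    (λ j → (map (ℤ.-_) 1ₚ ^ₚ toℕ j) *ₚ A zero j *ₚ det ℤ[u] (λ i k → A (suc i) (punchIn j k)))
    λ j → ≡.trans (⟦⟧-* ((map (ℤ.-_) 1ₚ ^ₚ toℕ j) *ₚ A zero j) (det ℤ[u] (λ i k → A (suc i) (punchIn j k))))
      (cong₂ _*_
        (≡.trans (⟦⟧-* (map (ℤ.-_) 1ₚ ^ₚ toℕ j) (A zero j)) (cong (_* ⟦ A zero j ⟧)
          (≡.trans (⟦⟧-^ (map (ℤ.-_) 1ₚ) (toℕ j)) (cong (_^ toℕ j) ⟦⟧-neg1))))
        (⟦⟧-det (λ i k → A (suc i) (punchIn j k))))

  ⟦⟧-zero : ∀ p → p ≈ₚ [] → ⟦ p ⟧ ≡ 0#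
  ⟦⟧-zero []      _   = ≡.refl
  ⟦⟧-zero (a ∷ p) p≈0 = ≡.trans
    (cong₂ (λ x y → ι x + u * y) (p≈0 0) (⟦⟧-zero p (p≈0 ∘ suc)))
    (solve 1 (λ u → con 0ℤ :+ u :* con 0ℤ := con 0ℤ) ≡.refl u)

  ⟦⟧-cong : ∀ p q → p ≈ₚ q → ⟦ p ⟧ ≡ ⟦ q ⟧
  ⟦⟧-cong []      q       p≈q = sym (⟦⟧-zero q (sym ∘ p≈q))
  ⟦⟧-cong (a ∷ p) []      p≈q = ⟦⟧-zero (a ∷ p) p≈q
  ⟦⟧-cong (a ∷ p) (b ∷ q) p≈q =
    cong₂ (λ x y → ι x + u * y) (p≈q 0) (⟦⟧-cong p q (p≈q ∘ suc))

eval : ℤ → Poly → ℤ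
eval n []      = 0ℤ
eval n (a ∷ p) = a ℤ.+ n ℤ.* eval n p

tail : Poly → Poly
tail []      = []
tail (_ ∷ p) = p

coeff-tail : ∀ p k → coeff p (suc k) ≡ coeff (tail p) k
coeff-tail []      k = ≡.refl
coeff-tail (_ ∷ p) k = ≡.refl

eval-tail : ∀ n p → eval n p ≡ coeff p 0 ℤ.+ n ℤ.* eval n (tail p)
eval-tail n []      = sym (≡.trans (ℤ.+-identityˡ _) (ℤ.*-zeroʳ n))
eval-tail n (a ∷ p) = ≡.refl

-- The difference of the constant terms is divisible by integers larger than itself.
constant-terms : ∀ a b (x y : ℕ → ℤ) →
  (∀ N → a ℤ.+ ℤ.+ (2 ℕ.+ N) ℤ.* x N ≡ b ℤ.+ ℤ.+ (2 ℕ.+ N) ℤ.* y N) → a ≡ b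
constant-terms a b x y eq = ℤ.i-j≡0⇒i≡j a b (ℤ.∣i∣≡0⇒i≡0 (small ℤ.∣ y N ℤ.- x N ∣ multiple))
  where
  open ≡-Reasoning
  N : ℕ
  N = ℤ.∣ a ℤ.- b ∣
  difference : ∀ n x y → a ℤ.+ n ℤ.* x ≡ b ℤ.+ n ℤ.* y → a ℤ.- b ≡ n ℤ.* (y ℤ.- x)
  difference n x y eq = begin
    a ℤ.- b
      ≡⟨ solve 3 (λ a b z → a :- b := a :+ z :- b :- z) ≡.refl a b (n ℤ.* x) ⟩
    a ℤ.+ n ℤ.* x ℤ.- b ℤ.- n ℤ.* x
      ≡⟨ cong (λ z → z ℤ.- b ℤ.- n ℤ.* x) eq ⟩
    b ℤ.+ n ℤ.* y ℤ.- b ℤ.- n ℤ.* x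
      ≡⟨ solve 4 (λ b n x y → b :+ n :* y :- b :- n :* x := n :* (y :- x)) ≡.refl b n x y ⟩
    n ℤ.* (y ℤ.- x) ∎
    where open +-*-Solver using (solve; _:=_; _:+_; _:*_; _:-_)
  multiple : N ≡ (2 ℕ.+ N) ℕ.* ℤ.∣ y N ℤ.- x N ∣
  multiple = ≡.trans (cong ℤ.∣_∣ (difference (ℤ.+ (2 ℕ.+ N)) (x N) (y N) (eq N)))
                     (ℤ.abs-* (ℤ.+ (2 ℕ.+ N)) (y N ℤ.- x N))
  small : ∀ m → N ≡ (2 ℕ.+ N) ℕ.* m → N ≡ 0
  small zero    N≡ = ≡.trans N≡ (ℕ.*-zeroʳ (2 ℕ.+ N))
  small (suc m) N≡ = contradiction (ℕ.≤-reflexive (sym N≡)) (ℕ.<⇒≱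
    (ℕ.≤-trans (ℕ.n≤1+n (suc N)) (ℕ.m≤m*n (2 ℕ.+ N) (suc m))))

-- The recursion descends in the index of the coefficient, because trailing zeros allow `p` and `q`
-- to have different lengths. Once the constant terms agree they cancel, and so does the factor 2 +
-- N in front of the tails.
eval-injective : ∀ p q → (∀ N → eval (ℤ.+ (2 ℕ.+ N)) p ≡ eval (ℤ.+ (2 ℕ.+ N)) q) → p ≈ₚ q
eval-injective p q eq = go
  where
  split : ∀ N → coeff p 0 ℤ.+ ℤ.+ (2 ℕ.+ N) ℤ.* eval (ℤ.+ (2 ℕ.+ N)) (tail p) ≡
                coeff q 0 ℤ.+ ℤ.+ (2 ℕ.+ N) ℤ.* eval (ℤ.+ (2 ℕ.+ N)) (tail q)
  split N = ≡.trans (sym (eval-tail (ℤ.+ (2 ℕ.+ N)) p)) (≡.trans (eq N) (eval-tail (ℤ.+ (2 ℕ.+ N)) q))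
  head≡ : coeff p 0 ≡ coeff q 0
  head≡ = constant-terms _ _ (λ N → eval (ℤ.+ (2 ℕ.+ N)) (tail p)) (λ N → eval (ℤ.+ (2 ℕ.+ N)) (tail q)) split
  tail≡ : ∀ N → eval (ℤ.+ (2 ℕ.+ N)) (tail p) ≡ eval (ℤ.+ (2 ℕ.+ N)) (tail q)
  tail≡ N = ℤ.*-cancelˡ-≡ (ℤ.+ (2 ℕ.+ N)) _ _ (Decimal.+-cancelˡ (coeff p 0) _ _
    (≡.trans (split N) (cong (λ a → a ℤ.+ ℤ.+ (2 ℕ.+ N) ℤ.* eval (ℤ.+ (2 ℕ.+ N)) (tail q)) (sym head≡))))
  go : p ≈ₚ q
  go zero    = head≡
  go (suc k) = ≡.trans (coeff-tail p k)
    (≡.trans (eval-injective (tail p) (tail q) tail≡ k) (sym (coeff-tail q k)))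

-- Adjacency matrices as sums over edges

module _ {A : Set} where

  total : (A → ℕ) → List A → ℕ
  total f xs = foldr (λ x z → f x ℕ.+ z) 0 xs

  total-cong : ∀ {f h : A → ℕ} → (∀ x → f x ≡ h x) → ∀ xs → total f xs ≡ total h xs
  total-cong f≗h []       = ≡.refl
  total-cong f≗h (x ∷ xs) = cong₂ ℕ._+_ (f≗h x) (total-cong f≗h xs)

  total-+ : ∀ (f h : A → ℕ) xs → total (λ x → f x ℕ.+ h x) xs ≡ total f xs ℕ.+ total h xs
  total-+ f h []       = ≡.refl
  total-+ f h (x ∷ xs) rewrite total-+ f h xs = shape (f x) (h x) (total f xs) (total h xs)
    where
    shape : ∀ a b c d → a ℕ.+ b ℕ.+ (c ℕ.+ d) ≡ a ℕ.+ c ℕ.+ (b ℕ.+ d)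
    shape = solve-∀

  length-filter : ∀ {P : A → Set} (P? : ∀ x → Dec (P x)) xs →
                  length (filter P? xs) ≡ total (λ x → if does (P? x) then 1 else 0) xs
  length-filter P? []       = ≡.refl
  length-filter P? (x ∷ xs) with does (P? x)
  ... | true  = cong suc (length-filter P? xs)
  ... | false = length-filter P? xs

module GraphArcs (G : Graph) where
  open import Data.Fin.Properties using (_≟_)
  open ArcGraph {Fin (#V G)} _≟_ using ([_≐_]; [≐]-refl; [≐]-≢; deg; WellFormed; deg≡0⇒avoids)

  V : Set
  V = Fin (#V G)

  edges : List (Fin (#E G))
  edges = allFin (#E G)

  src tgt : Fin (#E G) → V
  src e = proj₁ (ends G e)
  tgt e = proj₂ (ends G e)

  arcOf : Fin (#E G) → Arc V
  arcOf e = src e , [] , tgt e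

  arcs : List (Arc V)
  arcs = map arcOf edges

  interiors-arcs : ∀ es → concatMap interior (map arcOf es) ≡ []
  interiors-arcs []       = ≡.refl
  interiors-arcs (_ ∷ es) = interiors-arcs es

  edges-arcs : ∀ es → concatMap edgesOf (map arcOf es) ≡ map (ends G) es
  edges-arcs []       = ≡.refl
  edges-arcs (e ∷ es) = cong (ends G e ∷_) (edges-arcs es)

  degree≡ : ∀ v → degree G v ≡ total (λ e → [ src e ≐ v ] ℕ.+ [ tgt e ≐ v ]) edges
  degree≡ v = ≡.trans (cong₂ ℕ._+_ (length-filter (λ e → src e ≟ v) edges)
                                    (length-filter (λ e → tgt e ≟ v) edges))
                      (sym (total-+ (λ e → [ src e ≐ v ]) (λ e → [ tgt e ≐ v ]) edges))

  deg≡degree : ∀ v → deg arcs v ≡ degree G v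
  deg≡degree v = ≡.trans (List.foldr-map _ arcOf 0 edges) (sym (degree≡ v))

  -- These are the coefficients of α and β in `entry`, as natural numbers. Summed over all edges
  -- they give 𝒟 and 𝒜; a loop at i adds 2 to `crossing i i`, in agreement with the doubled diagonal
  -- of 𝒜.
  diagonal crossing : V → V → Fin (#E G) → ℕ
  diagonal i j e = [ src e ≐ i ] ℕ.* [ src e ≐ j ] ℕ.+ [ tgt e ≐ i ] ℕ.* [ tgt e ≐ j ]
  crossing i j e = [ src e ≐ i ] ℕ.* [ tgt e ≐ j ] ℕ.+ [ tgt e ≐ i ] ℕ.* [ src e ≐ j ]

  indicator² : ∀ s i → [ s ≐ i ] ≡ [ s ≐ i ] ℕ.* [ s ≐ i ]
  indicator² s i with does (s ≟ i)
  ... | true  = ≡.refl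
  ... | false = ≡.refl

  indicators-disjoint : ∀ {i j : V} → i ≢ j → ∀ s → [ s ≐ i ] ℕ.* [ s ≐ j ] ≡ 0
  indicators-disjoint {i} {j} i≢j s with s ≟ i
  ... | no _       = ≡.refl
  ... | yes ≡.refl = ≡.trans (ℕ.*-identityˡ _) ([≐]-≢ i≢j)

  indicators-absent : ∀ {s t i j : V} → (s , t) ≢ (i , j) → [ s ≐ i ] ℕ.* [ t ≐ j ] ≡ 0
  indicators-absent {s} {t} {i} {j} ≢ij with s ≟ i | t ≟ j
  ... | no _       | _          = ≡.refl
  ... | yes _      | no _       = ≡.refl
  ... | yes ≡.refl | yes ≡.refl = contradiction ≡.refl ≢ij

  indicators-present : ∀ {s t i j : V} → (s , t) ≡ (i , j) → [ s ≐ i ] ℕ.* [ t ≐ j ] ≡ 1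
  indicators-present {s} {t} ≡.refl = cong₂ ℕ._*_ ([≐]-refl s) ([≐]-refl t)

  𝒟≡ : ∀ i j → 𝒟 G i j ≡ ℤ.+ total (diagonal i j) edges
  𝒟≡ i j with i ≟ j
  ... | yes ≡.refl = cong ℤ.+_ (≡.trans (degree≡ i) (total-cong
    (λ e → cong₂ ℕ._+_ (indicator² (src e) i) (indicator² (tgt e) i)) edges))
  ... | no i≢j = cong ℤ.+_ (sym (≡.trans (total-cong
    (λ e → cong₂ ℕ._+_ (indicators-disjoint i≢j (src e)) (indicators-disjoint i≢j (tgt e))) edges)
    (zeros edges)))
    where
    zeros : ∀ es → total {Fin (#E G)} (λ _ → 0) es ≡ 0
    zeros []       = ≡.refl
    zeros (_ ∷ es) = zeros es

  𝒜≡ : ∀ i j → 𝒜 G i j ≡ ℤ.+ total (crossing i j) edges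
  𝒜≡ i j with i ≟ j
  ... | yes ≡.refl = cong ℤ.+_ (begin
    2 ℕ.* edgesBetween G i i
      ≡⟨ cong (2 ℕ.*_) (length-filter (joins? G i i) edges) ⟩
    total joined edges ℕ.+ (total joined edges ℕ.+ 0)
      ≡⟨ cong (total joined edges ℕ.+_) (ℕ.+-identityʳ _) ⟩
    total joined edges ℕ.+ total joined edges
      ≡⟨ total-+ joined joined edges ⟨
    total (λ e → joined e ℕ.+ joined e) edges
      ≡⟨ total-cong loop edges ⟩
    total (crossing i i) edges ∎)
    where
    open ≡-Reasoning
    joined : Fin (#E G) → ℕ
    joined e = if does (joins? G i i e) then 1 else 0
    loop : ∀ e → joined e ℕ.+ joined e ≡ crossing i i e
    loop e = twice (joins? G i i e)
      where
      twice : (d : Dec (Joins G i i e)) →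
              (if does d then 1 else 0) ℕ.+ (if does d then 1 else 0) ≡ crossing i i e
      twice (yes (inj₁ eq)) = sym (cong₂ ℕ._+_ (indicators-present eq)
                                (indicators-present (cong Product.swap eq)))
      twice (yes (inj₂ eq)) = sym (cong₂ ℕ._+_ (indicators-present eq)
                                (indicators-present (cong Product.swap eq)))
      twice (no ¬joins)     = sym (cong₂ ℕ._+_ (indicators-absent (¬joins ∘ inj₁))
                                (indicators-absent (¬joins ∘ inj₁ ∘ cong Product.swap)))
  ... | no i≢j = cong ℤ.+_ (≡.trans (length-filter (joins? G i j) edges) (total-cong link edges))
    where
    link : ∀ e → (if does (joins? G i j e) then 1 else 0) ≡ crossing i j e
    link e = once (joins? G i j e)
      where
      once : (d : Dec (Joins G i j e)) → (if does d then 1 else 0) ≡ crossing i j e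
      once (yes (inj₁ eq)) = sym (cong₂ ℕ._+_ (indicators-present eq)
        (indicators-absent (λ eq′ → i≢j (sym (cong proj₁ (≡.trans (sym (cong Product.swap eq)) eq′))))))
      once (yes (inj₂ eq)) = sym (cong₂ ℕ._+_
        (indicators-absent (λ eq′ → i≢j (sym (cong proj₁ (≡.trans (sym eq) eq′)))))
        (indicators-present (cong Product.swap eq)))
      once (no ¬joins)     = sym (cong₂ ℕ._+_ (indicators-absent (¬joins ∘ inj₁))
        (indicators-absent (¬joins ∘ inj₂ ∘ cong Product.swap)))

  module _ (G-connected : Connected G) (no-leaf : NoDegreeOne G) (rank≡2 : rank G ≡ ℤ.+ 2) where

    edge-count : #E G ≡ suc (#V G)
    edge-count = ℤ.+-injective (begin
      ℤ.+ #E G                     ≡⟨ solve 2 (λ e v → e := (e :- v) :+ con 1ℤ :+ (v :- con 1ℤ)) ≡.refl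
                                       (ℤ.+ #E G) (ℤ.+ #V G) ⟩
      rank G ℤ.+ (ℤ.+ #V G ℤ.- 1ℤ)  ≡⟨ cong (ℤ._+ (ℤ.+ #V G ℤ.- 1ℤ)) rank≡2 ⟩
      ℤ.+ 2 ℤ.+ (ℤ.+ #V G ℤ.- 1ℤ)   ≡⟨ solve 1 (λ v → con (ℤ.+ 2) :+ (v :- con 1ℤ) := con 1ℤ :+ v) ≡.refl
                                       (ℤ.+ #V G) ⟩
      ℤ.+ suc (#V G)               ∎)
      where
      open ≡-Reasoning
      open +-*-Solver using (solve; _:=_; _:+_; _:-_; con)

    constant : ∀ (f : V → Bool) → All (λ (s , _ , t) → f s ≡ f t) arcs → ∀ x y → f x ≡ f y
    constant f const x y = walk (proj₂ G-connected x y)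
      where
      on-edge : ∀ e → f (src e) ≡ f (tgt e)
      on-edge e = All.lookup (All.map⁻ const) (∈-allFin e)
      step : ∀ {x y} → Adjacent G x y → f x ≡ f y
      step (e , inj₁ eq) = ≡.trans (cong (f ∘ proj₁) (sym eq)) (≡.trans (on-edge e) (cong (f ∘ proj₂) eq))
      step (e , inj₂ eq) = ≡.trans (cong (f ∘ proj₂) (sym eq)) (≡.trans (sym (on-edge e)) (cong (f ∘ proj₁) eq))
      walk : ∀ {x y} → Star (Adjacent G) x y → f x ≡ f y
      walk Star.ε         = ≡.refl
      walk (adj ◅ adjs) = ≡.trans (step adj) (walk adjs)

    -- Rank two provides an edge. If no arc met `v`, the colouring that singles out `v` would be
    -- constant on arcs, hence on all vertices, and the source of that edge would be `v`.
    no-isolated-vertex : ∀ v → deg arcs v ≢ 0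
    no-isolated-vertex v deg≡0 = proj₁ (All.lookup (All.map⁻ avoids) (∈-allFin some-edge))
      (in-class (src some-edge) (≡.trans (constant (λ x → does (x ≟ v)) const (src some-edge) v)
                                         (dec-true (v ≟ v) ≡.refl)))
      where
      some-edge : Fin (#E G)
      some-edge = subst Fin (sym edge-count) zero
      avoids : All (λ (s , _ , t) → s ≢ v × t ≢ v) arcs
      avoids = deg≡0⇒avoids arcs deg≡0
      const : All (λ (s , _ , t) → does (s ≟ v) ≡ does (t ≟ v)) arcs
      const = All.map (λ {(s , _ , t)} (s≢v , t≢v) →
        ≡.trans (dec-false (s ≟ v) s≢v) (sym (dec-false (t ≟ v) t≢v))) avoids
      in-class : ∀ x → does (x ≟ v) ≡ true → x ≡ v
      in-class x eq with x ≟ v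
      ... | yes x≡v = x≡v

    arcs-wellFormed : WellFormed (allFin (#V G)) arcs
    arcs-wellFormed = record
      { unique    = allFin⁺ (#V G)
      ; inside    = All.universal (λ (s , _ , t) → ∈-allFin s , ∈-allFin t) arcs
      ; connected = λ f const {x} {y} _ _ → constant f const x y
      ; deg≥2     = λ {v} _ → ≥2 (deg arcs v) (no-isolated-vertex v)
                      (λ deg≡1 → no-leaf v (≡.trans (sym (deg≡degree v)) deg≡1))
      ; count     = ≡.trans (List.length-map arcOf edges) (≡.trans (List.length-tabulate id)
                      (≡.trans edge-count (cong suc (sym (List.length-tabulate id))))) }
      where
      ≥2 : ∀ n → n ≢ 0 → n ≢ 1 → 2 ≤ n
      ≥2 zero          n≢0 _   = contradiction ≡.refl n≢0
      ≥2 (suc zero)    _   n≢1 = contradiction ≡.refl n≢1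
      ≥2 (suc (suc n)) _   _   = s≤s (s≤s z≤n)

    module _ (𝒫 : Point) where
      open Point 𝒫
      open Determinant algebra
      open WeightedZeta 𝒫
      open Evaluation algebra u
      open Solver using (solve; _:=_; _:+_; _:*_; :-_; _:-_; con)

      ι[_] : ℕ → Carrier
      ι[ n ] = ι (ℤ.+ n)

      δ≡ι : ∀ (v w : V) → δ _≟_ v w ≡ ι[ [ v ≐ w ] ]
      δ≡ι v w with does (v ≟ w)
      ... | true  = ≡.refl
      ... | false = ≡.refl

      α β : Carrier
      α = weight 0 * weight 0 * g 0
      β = weight 0 * g 0

      pair≡ι : ∀ a b c d → ι[ a ] * ι[ c ] + ι[ b ] * ι[ d ] ≡ ι[ a ℕ.* c ℕ.+ b ℕ.* d ]
      pair≡ι a b c d = sym (≡.trans (ι-+ (ℤ.+ (a ℕ.* c)) (ℤ.+ (b ℕ.* d)))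
        (cong₂ _+_ (≡.trans (cong ι (ℤ.pos-* a c)) (ι-* (ℤ.+ a) (ℤ.+ c)))
                   (≡.trans (cong ι (ℤ.pos-* b d)) (ι-* (ℤ.+ b) (ℤ.+ d)))))

      contribution≡ : ∀ i j e → contribution _≟_ i j (arcOf e) ≡
                      ι[ diagonal i j e ] * α - ι[ crossing i j e ] * β
      contribution≡ i j e
        rewrite δ≡ι (src e) i | δ≡ι (tgt e) i | δ≡ι (src e) j | δ≡ι (tgt e) j =
        cong₂ (λ x y → x * α - y * β)
          (pair≡ι [ src e ≐ i ] [ tgt e ≐ i ] [ src e ≐ j ] [ tgt e ≐ j ])
          (pair≡ι [ src e ≐ i ] [ tgt e ≐ i ] [ tgt e ≐ j ] [ src e ≐ j ])

      contributions≡ : ∀ i j es → contributions _≟_ (map arcOf es) i j ≡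
                       ι[ total (diagonal i j) es ] * α - ι[ total (crossing i j) es ] * β
      contributions≡ i j []       = solve 2 (λ α β → con 0ℤ := con 0ℤ :* α :- con 0ℤ :* β) ≡.refl α β
      contributions≡ i j (e ∷ es) = begin
        contribution _≟_ i j (arcOf e) + contributions _≟_ (map arcOf es) i j
          ≡⟨ cong₂ _+_ (contribution≡ i j e) (contributions≡ i j es) ⟩
        ι[ d ] * α - ι[ c ] * β + (ι[ ds ] * α - ι[ cs ] * β)
          ≡⟨ solve 6 (λ d c D C α β → d :* α :- c :* β :+ (D :* α :- C :* β)
                        := (d :+ D) :* α :- (c :+ C) :* β) ≡.refl ι[ d ] ι[ c ] ι[ ds ] ι[ cs ] α β ⟩
        (ι[ d ] + ι[ ds ]) * α - (ι[ c ] + ι[ cs ]) * β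
          ≡⟨ cong₂ (λ x y → x * α - y * β) (ι-+ (ℤ.+ d) (ℤ.+ ds)) (ι-+ (ℤ.+ c) (ℤ.+ cs)) ⟨
        ι[ d ℕ.+ ds ] * α - ι[ c ℕ.+ cs ] * β ∎
        where
        open ≡-Reasoning
        d c ds cs : ℕ
        d  = diagonal i j e
        c  = crossing i j e
        ds = total (diagonal i j) es
        cs = total (crossing i j) es

      δ≡𝕀 : ∀ (i j : V) → δ _≟_ i j ≡ ι (𝕀 i j)
      δ≡𝕀 i j with does (i ≟ j)
      ... | true  = ≡.refl
      ... | false = ≡.refl

      M≡ : ∀ i j → M _≟_ arcs i j ≡ g 0 * ⟦ I-𝒜u+𝒬u² G i j ⟧
      M≡ i j = begin
        δ _≟_ i j + contributions _≟_ arcs i j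
          ≡⟨ cong₂ _+_ (δ≡𝕀 i j) (contributions≡ i j edges) ⟩
        I + (ι[ total (diagonal i j) edges ] * α - ι[ total (crossing i j) edges ] * β)
          ≡⟨ cong₂ (λ x y → I + (ι x * α - ι y * β)) (𝒟≡ i j) (𝒜≡ i j) ⟨
        I + (D * α - A * β)
          ≡⟨ cong (_+ (D * α - A * β)) (*-identityʳ I) ⟨
        I * 1# + (D * α - A * β)
          -- Replacing 1 by (1 - u²) · g 0 puts the identity matrix over the denominator of α and β;
          -- its part -u² is what turns 𝒟 into 𝒬.
          ≡⟨ cong (λ x → I * x + (D * α - A * β)) (g-inverse 0) ⟨
        I * ((1# - weight 0 * weight 0) * g 0) + (D * α - A * β)
          ≡⟨ solve 5 (λ I D A u g → let x = u :* con 1ℤ in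
               I :* ((con 1ℤ :- x :* x) :* g) :+ (D :* (x :* x :* g) :- A :* (x :* g))
               := g :* (I :+ u :* (:- A :+ u :* (D :- I :+ u :* con 0ℤ)))) ≡.refl I D A u (g 0) ⟩
        g 0 * (I + u * (- A + u * (D - I + u * 0#)))
          ≡⟨ cong₂ (λ x y → g 0 * (I + u * (x + u * (y + u * 0#)))) (ι-neg (𝒜 G i j))
               (ι-- algebra (𝒟 G i j) (𝕀 i j)) ⟨
        g 0 * ⟦ I-𝒜u+𝒬u² G i j ⟧ ∎
        where
        open ≡-Reasoning
        I D A : Carrier
        I = ι (𝕀 i j)
        D = ι (𝒟 G i j)
        A = ι (𝒜 G i j)

      f : Carrier
      f = 1# - weight 0 * weight 0

      factors≡ : ∀ es → factors _≟_ (map arcOf es) ≡ f ^ length es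
      factors≡ []       = ≡.refl
      factors≡ (e ∷ es) = cong (f *_) (factors≡ es)

      -- Each edge brings a factor `f` and each vertex a factor `g 0`. As |E| = |V| + 1, one `f`
      -- survives, and it is the power (1 - u²)^(r - 1) of the definition.
      cancel-powers : ∀ n → f ^ suc n * g 0 ^ n ≡ f
      cancel-powers zero    = solve 1 (λ f → f :* con 1ℤ :* con 1ℤ := f) ≡.refl f
      cancel-powers (suc n) = begin
        f * (f ^ suc n) * (g 0 * g 0 ^ n)
          ≡⟨ solve 4 (λ f F g h → f :* F :* (g :* h) := (f :* g) :* (F :* h)) ≡.refl f (f ^ suc n) (g 0) (g 0 ^ n) ⟩
        f * g 0 * (f ^ suc n * g 0 ^ n) ≡⟨ cong₂ _*_ (g-inverse 0) (cancel-powers n) ⟩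
        1# * f                          ≡⟨ *-identityˡ f ⟩
        f                               ∎
        where open ≡-Reasoning

      Z-arcs : Z _≟_ (allFin (#V G)) arcs ≡ f * ⟦ det ℤ[u] (I-𝒜u+𝒬u² G) ⟧
      Z-arcs = begin
        factors _≟_ arcs * detOn (M _≟_ arcs) vs
          ≡⟨ cong₂ _*_ (≡.trans (factors≡ edges) (cong (f ^_) (≡.trans (List.length-tabulate id) edge-count)))
               (≡.trans (detOn-cong vs (λ {i} {j} _ _ → M≡ i j)) (minor-* (g 0) B vs vs)) ⟩
        f ^ suc (#V G) * (g 0 ^ length vs * detOn B vs)
          ≡⟨ cong (λ n → f ^ suc (#V G) * (g 0 ^ n * detOn B vs)) (List.length-tabulate {n = #V G} id) ⟩
        f ^ suc (#V G) * (g 0 ^ #V G * detOn B vs)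
          ≡⟨ *-assoc _ _ _ ⟨
        f ^ suc (#V G) * g 0 ^ #V G * detOn B vs
          ≡⟨ cong₂ _*_ (cancel-powers (#V G)) (cong (λ rs → minor rs vs) (List.map-tabulate id B)) ⟩
        f * minor (tabulate B) (tabulate id)
          ≡⟨ cong (f *_) (det≡minor B id) ⟨
        f * det rawRing B
          ≡⟨ cong (f *_) (⟦⟧-det (I-𝒜u+𝒬u² G)) ⟨
        f * ⟦ det ℤ[u] (I-𝒜u+𝒬u² G) ⟧ ∎
        where
        open ≡-Reasoning
        vs : List V
        vs = allFin (#V G)
        B : V → V → Carrier
        B i j = ⟦ I-𝒜u+𝒬u² G i j ⟧

ζ-exponent : ∀ {G} → rank G ≡ ℤ.+ 2 → rank G ℤ.- 1ℤ ≡ 1ℤ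
ζ-exponent eq = cong (ℤ._- 1ℤ) eq

-- The definition of `[1-u²]^_·_` matches on its exponent, which is stuck for a variable graph; with
-- a variable `k` in its place the equation can be matched.
den≡ : ∀ {k} → k ≡ 1ℤ → ∀ p → den ([1-u²]^ k · p) ≡ 1ₚ
den≡ ≡.refl p = ≡.refl

num≡ : ∀ {k} → k ≡ 1ℤ → ∀ p → num ([1-u²]^ k · p) ≡ (1-u² ^ₚ 1) *ₚ p
num≡ ≡.refl p = ≡.refl

module GraphZeta (G : Graph) (connected : Connected G) (no-leaf : NoDegreeOne G)
                 (rank≡2 : rank G ≡ ℤ.+ 2) where
  open GraphArcs G public using (arcs)

  Z-graph : (𝒫 : Point) → Point.Carrier 𝒫
  Z-graph 𝒫 = WeightedZeta.Z 𝒫 Fin._≟_ (allFin (#V G)) arcs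

  module _ (𝒫 : Point) where
    open Point 𝒫
    open Evaluation algebra u
    open Solver using (solve; _:=_; _:+_; _:*_; :-_; _:-_; con)
    open ≡-Reasoning

    ⟦num⟧ : ⟦ num (ζ⁻¹ G) ⟧ ≡ Z-graph 𝒫
    ⟦num⟧ = begin
      ⟦ num (ζ⁻¹ G) ⟧
        ≡⟨ cong ⟦_⟧ (num≡ (ζ-exponent {G} rank≡2) determinant) ⟩
      ⟦ (1-u² ^ₚ 1) *ₚ determinant ⟧
        ≡⟨ ⟦⟧-* (1-u² ^ₚ 1) determinant ⟩
      ⟦ 1-u² ^ₚ 1 ⟧ * ⟦ determinant ⟧
        ≡⟨ cong (_* ⟦ determinant ⟧) (≡.trans (⟦⟧-^ 1-u² 1) quadratic) ⟩
      (1# - u ^ 1 * u ^ 1) * ⟦ determinant ⟧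
        ≡⟨ GraphArcs.Z-arcs G connected no-leaf rank≡2 𝒫 ⟨
      Z-graph 𝒫 ∎
      where
      determinant : Poly
      determinant = det ℤ[u] (I-𝒜u+𝒬u² G)
      quadratic : ⟦ 1-u² ⟧ * 1# ≡ 1# - u ^ 1 * u ^ 1
      quadratic = solve 1 (λ u →
        (con 1ℤ :+ u :* (con 0ℤ :+ u :* (con (ℤ.- 1ℤ) :+ u :* con 0ℤ))) :* con 1ℤ
        := con 1ℤ :- u :* con 1ℤ :* (u :* con 1ℤ)) ≡.refl u

    ⟦den⟧ : ⟦ den (ζ⁻¹ G) ⟧ ≡ 1#
    ⟦den⟧ = ≡.trans (cong ⟦_⟧ (den≡ (ζ-exponent {G} rank≡2) (det ℤ[u] (I-𝒜u+𝒬u² G)))) ⟦⟧-1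

-- Invariance of the zeta function under isomorphism

mapArc : ∀ {V W : Set} → (V → W) → Arc V → Arc W
mapArc σ (s , xs , t) = σ s , map σ xs , σ t

module _ (𝒫 : Point) {V W : Set} (_≟_ : DecidableEquality V) (_≟′_ : DecidableEquality W)
         (σ : V → W) (σ-injective : ∀ {v w} → σ v ≡ σ w → v ≡ w) where
  open Point 𝒫
  open Determinant algebra
  open WeightedZeta 𝒫

  δ-map : ∀ v w → δ _≟′_ (σ v) (σ w) ≡ δ _≟_ v w
  δ-map v w with v ≟ w
  ... | yes ≡.refl = δ-refl _≟′_ (σ v)
  ... | no v≢w     = δ-≢ _≟′_ (v≢w ∘ σ-injective)

  contributions-map : ∀ es i j → contributions _≟′_ (map (mapArc σ) es) (σ i) (σ j) ≡
                                 contributions _≟_ es i j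
  contributions-map []                   i j = ≡.refl
  contributions-map ((s , xs , t) ∷ es) i j
    rewrite δ-map s i | δ-map t i | δ-map s j | δ-map t j | List.length-map σ xs
          | contributions-map es i j = ≡.refl

  factors-map : ∀ es → factors _≟′_ (map (mapArc σ) es) ≡ factors _≟_ es
  factors-map []                  = ≡.refl
  factors-map ((s , xs , t) ∷ es) rewrite List.length-map σ xs | factors-map es = ≡.refl

  Z-map : ∀ vs es → Z _≟′_ (map σ vs) (map (mapArc σ) es) ≡ Z _≟_ vs es
  Z-map vs es = cong₂ _*_ (factors-map es) (≡.trans (minor-map σ (M _≟′_ (map (mapArc σ) es)) vs vs)
    (detOn-cong vs λ {i} {j} _ _ → cong₂ _+_ (δ-map i j) (contributions-map es i j)))

module _ {V : Set} {A : Set} where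

  map-~ : ∀ (f : A → Arc V) {xs ys : List A} → xs ↭ ys → map f xs ~ map f ys
  map-~ f refl          = ~refl
  map-~ f (prep x p)    = ~cons (map-~ f p)
  map-~ f (swap x y p)  = ~trans ~swap (~cons (~cons (map-~ f p)))
  map-~ f (trans p q)   = ~trans (map-~ f p) (map-~ f q)

  flips-~ : ∀ {f h : A → Arc V} → (∀ x → h x ≡ f x ⊎ h x ≡ flip (f x)) → ∀ xs → map f xs ~ map h xs
  flips-~ eq []       = ~refl
  flips-~ {f} {h} eq (x ∷ xs) with h x | eq x
  ... | _ | inj₁ ≡.refl = ~cons (flips-~ eq xs)
  ... | _ | inj₂ ≡.refl = ~trans ~flip (~cons (flips-~ eq xs))

-- Both lists are free of repetitions and contain all of `Fin n`, so they agree as bags.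
allFin-↭ : ∀ {m n} (π : Permutation m n) → allFin n ↭ map (π ⟨$⟩ʳ_) (allFin m)
allFin-↭ {m} {n} π = ∼bag⇒↭ (unique∧set⇒bag (allFin⁺ n) (map⁺ injective (allFin⁺ m))
  (λ {x} → mk⇔ (λ _ → subst (_∈ map (π ⟨$⟩ʳ_) (allFin m)) (Perm.inverseʳ π)
                        (∈-map⁺ (π ⟨$⟩ʳ_) (∈-allFin (π ⟨$⟩ˡ x))))
               (λ _ → ∈-allFin x)))
  where
  injective : ∀ {i j} → π ⟨$⟩ʳ i ≡ π ⟨$⟩ʳ j → i ≡ j
  injective eq = ≡.trans (sym (Perm.inverseˡ π)) (≡.trans (cong (π ⟨$⟩ˡ_) eq) (Perm.inverseˡ π))

module _ {G H : Graph} (G≅H : G ≅ H) where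
  open _≅_ G≅H renaming (vertices to σ; edges to π)
  private
    module G = GraphArcs G
    module H = GraphArcs H

  ≅⇒Z≡ : (𝒫 : Point) → WeightedZeta.Z 𝒫 Fin._≟_ (allFin (#V G)) G.arcs ≡
                       WeightedZeta.Z 𝒫 Fin._≟_ (allFin (#V H)) H.arcs
  ≅⇒Z≡ 𝒫 = sym (≡.trans (WeightedZeta.Z-resp 𝒫 Fin._≟_ (allFin-↭ σ) arcs~)
    (Z-map 𝒫 Fin._≟_ Fin._≟_ (σ ⟨$⟩ʳ_) injective (allFin (#V G)) G.arcs))
    where
    injective : ∀ {i j} → σ ⟨$⟩ʳ i ≡ σ ⟨$⟩ʳ j → i ≡ j
    injective eq = ≡.trans (sym (Perm.inverseˡ σ)) (≡.trans (cong (σ ⟨$⟩ˡ_) eq) (Perm.inverseˡ σ))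

    same-arc : ∀ e → mapArc (σ ⟨$⟩ʳ_) (G.arcOf e) ≡ H.arcOf (π ⟨$⟩ʳ e) ⊎
                     mapArc (σ ⟨$⟩ʳ_) (G.arcOf e) ≡ flip (H.arcOf (π ⟨$⟩ʳ e))
    same-arc e with incidence e
    ... | inj₁ eq = inj₁ (cong (λ (s , t) → s , [] , t) (sym eq))
    ... | inj₂ eq = inj₂ (cong (λ (s , t) → t , [] , s) (sym eq))

    arcs~ : H.arcs ~ map (mapArc (σ ⟨$⟩ʳ_)) G.arcs
    arcs~ = ~trans (map-~ H.arcOf (allFin-↭ π))
      (subst (_~ map (mapArc (σ ⟨$⟩ʳ_)) G.arcs) (List.map-∘ (allFin (#E G)))
        (subst (map (H.arcOf ∘ (π ⟨$⟩ʳ_)) (allFin (#E G)) ~_) (List.map-∘ (allFin (#E G)))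
          (flips-~ same-arc (allFin (#E G)))))

module _ {N : ℕ} (P : IntegerPoint N) where
  open IntegerPoint P
  open Evaluation algebra u

  ⟦⟧-eval : ∀ p → ⟦ p ⟧ ≡ ι (eval (ℤ.+ (2 ℕ.+ N)) p)
  ⟦⟧-eval []      = ≡.refl
  ⟦⟧-eval (a ∷ p) = begin
    ι a + u * ⟦ p ⟧                 ≡⟨ cong₂ (λ x y → ι a + x * y) u≡ι (⟦⟧-eval p) ⟩
    ι a + ι n * ι (eval n p)        ≡⟨ cong (ι a +_) (ι-* n (eval n p)) ⟨
    ι a + ι (n ℤ.* eval n p)        ≡⟨ ι-+ a (n ℤ.* eval n p) ⟨
    ι (a ℤ.+ n ℤ.* eval n p)        ∎
    where
    open ≡-Reasoning
    n : ℤ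
    n = ℤ.+ (2 ℕ.+ N)

-- Isomorphisms from matching presentations

module _ {c ℓ} (S : Setoid c ℓ) where
  open Setoid S using (Carrier; _≈_; reflexive)
  private
    module S  = PermS S
    module SP = PermSP S

  lookup-tabulate′ : ∀ {n} (f : Fin n → Carrier) k →
                     lookup (tabulate f) k ≡ f (cast (List.length-tabulate f) k)
  lookup-tabulate′ {suc n} f zero    = ≡.refl
  lookup-tabulate′ {suc n} f (suc k) = lookup-tabulate′ (f ∘ suc) k

  -- This turns an equality of multisets of edges into a bijection of edge indices. Stated over a
  -- setoid, it also applies to edges that agree only up to orientation.
  tabulate-↭ : ∀ {m n} (f : Fin m → Carrier) (h : Fin n → Carrier) → tabulate f S.↭ tabulate h →
               ∃ λ (π : Permutation m n) → ∀ i → f i ≈ h (π ⟨$⟩ʳ i)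
  tabulate-↭ f h p =
    Perm.cast-id (sym (List.length-tabulate f)) ∘ₚ S.onIndices p ∘ₚ Perm.cast-id (List.length-tabulate h) ,
    λ i → Setoid.trans S (reflexive (sym (List.lookup-tabulate f i)))
      (Setoid.trans S (SP.onIndices-lookup p (cast (sym (List.length-tabulate f)) i))
             (reflexive (lookup-tabulate′ h _)))

map-by-index : ∀ {A B : Set} (σ : A → B) xs ys (len : length xs ≡ length ys) →
               (∀ k → σ (lookup xs k) ≡ lookup ys (cast len k)) → map σ xs ≡ ys
map-by-index σ []       []       len eq = ≡.refl
map-by-index σ (x ∷ xs) (y ∷ ys) len eq =
  cong₂ _∷_ (eq zero) (map-by-index σ xs ys (ℕ.suc-injective len) (eq ∘ suc))

enumeration : ∀ {n} (W : List (Fin n)) → W ↭ allFin n →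
              ∃ λ (φ : Permutation (length W) n) → ∀ k → lookup W k ≡ φ ⟨$⟩ʳ k
enumeration W p = tabulate-↭ (≡.setoid _) (lookup W) id
  (↭⇒↭ₛ (subst (_↭ allFin _) (sym (List.tabulate-lookup W)) p))

-- Both lists name every vertex exactly once. So a vertex has a position in `W`, and the bijection
-- sends it to whatever stands there in `W′`.
relabelling : ∀ {m n} (W : List (Fin m)) (W′ : List (Fin n)) → W ↭ allFin m → W′ ↭ allFin n →
              length W ≡ length W′ → ∃ λ (σ : Permutation m n) → map (σ ⟨$⟩ʳ_) W ≡ W′
relabelling W W′ p p′ len = σ , map-by-index (σ ⟨$⟩ʳ_) W W′ len λ k → begin
  φ′ ⟨$⟩ʳ cast len (φ ⟨$⟩ˡ lookup W k)    ≡⟨ cong (λ i → φ′ ⟨$⟩ʳ cast len (φ ⟨$⟩ˡ i)) (φ≡ k) ⟩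
  φ′ ⟨$⟩ʳ cast len (φ ⟨$⟩ˡ (φ ⟨$⟩ʳ k))   ≡⟨ cong (λ i → φ′ ⟨$⟩ʳ cast len i) (Perm.inverseˡ φ) ⟩
  φ′ ⟨$⟩ʳ cast len k                     ≡⟨ φ′≡ (cast len k) ⟨
  lookup W′ (cast len k)                ∎
  where
  open ≡-Reasoning
  φ   = proj₁ (enumeration W p)
  φ≡  = proj₂ (enumeration W p)
  φ′  = proj₁ (enumeration W′ p′)
  φ′≡ = proj₂ (enumeration W′ p′)
  σ   = Perm.flip φ ∘ₚ Perm.cast-id len ∘ₚ φ′

support : ∀ {V : Set} → List V → List (Arc V) → List V
support vs es = vs ++ concatMap interior es

module _ {V W : Set} where

  path-map : ∀ (σ : V → W) s xs t → map (Product.map σ σ) (path s xs t) ≡ path (σ s) (map σ xs) (σ t)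
  path-map σ s []       t = ≡.refl
  path-map σ s (x ∷ xs) t = cong ((σ s , σ x) ∷_) (path-map σ x xs t)

  edges-map : ∀ (σ : V → W) es → map (Product.map σ σ) (concatMap edgesOf es) ≡
                                 concatMap edgesOf (map (mapArc σ) es)
  edges-map σ []                  = ≡.refl
  edges-map σ ((s , xs , t) ∷ es) = ≡.trans (List.map-++ (Product.map σ σ) (path s xs t) _)
    (cong₂ _++_ (path-map σ s xs t) (edges-map σ es))

  -- A vertex map is prescribed position by position on the supports, and it is required to carry
  -- arcs to arcs. The equality of lengths is a separate component because `relabelling` needs it to
  -- produce such a map.
  Matching : List V → List (Arc V) → List W → List (Arc W) → Set
  Matching vs es ws fs = length (support vs es) ≡ length (support ws fs) ×
    (∀ (σ : V → W) → map σ (support vs es) ≡ support ws fs → map (mapArc σ) es ≡ fs)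

  SameLength : Arc V → Arc W → Set
  SameLength (_ , xs , _) (_ , ys , _) = length xs ≡ length ys

  Corresponding : (V → W) → Arc V → Arc W → Set
  Corresponding σ (s , xs , t) (s′ , ys , t′) = σ s ≡ s′ × length xs ≡ length ys × σ t ≡ t′

  split-map : ∀ (σ : V → W) xs ys {zs ws} → length xs ≡ length ys →
              map σ (xs ++ zs) ≡ ys ++ ws → map σ xs ≡ ys × map σ zs ≡ ws
  split-map σ []       []       len eq = ≡.refl , eq
  split-map σ (x ∷ xs) (y ∷ ys) len eq =
    Product.map₁ (cong₂ _∷_ (List.∷-injectiveˡ eq))
      (split-map σ xs ys (ℕ.suc-injective len) (List.∷-injectiveʳ eq))

  interiors-length : ∀ {es fs} → Pointwise SameLength es fs →
                     length (concatMap interior es) ≡ length (concatMap interior fs)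
  interiors-length [] = ≡.refl
  interiors-length {(_ , xs , _) ∷ _} {(_ , ys , _) ∷ _} (len ∷ lens) =
    ≡.trans (List.length-++ xs) (≡.trans (cong₂ ℕ._+_ len (interiors-length lens)) (sym (List.length-++ ys)))

  arcs-correspond : ∀ (σ : V → W) {es fs} → Pointwise (Corresponding σ) es fs →
                    map σ (concatMap interior es) ≡ concatMap interior fs → map (mapArc σ) es ≡ fs
  arcs-correspond σ [] eq = ≡.refl
  arcs-correspond σ {(s , xs , t) ∷ _} {(_ , ys , _) ∷ _} ((≡.refl , len , ≡.refl) ∷ cs) eq =
    cong₂ _∷_ (cong (λ zs → σ s , zs , σ t) (proj₁ split)) (arcs-correspond σ cs (proj₂ split))
    where split = split-map σ xs ys len eq

  match₁ : ∀ {v v′ es fs} → Pointwise SameLength es fs →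
           (∀ σ → σ v ≡ v′ → Pointwise (Corresponding σ) es fs) →
           Matching (v ∷ []) es (v′ ∷ []) fs
  match₁ lens corr = cong suc (interiors-length lens) ,
    λ σ eq → arcs-correspond σ (corr σ (List.∷-injectiveˡ eq)) (List.∷-injectiveʳ eq)

  match₂ : ∀ {v w v′ w′ es fs} → Pointwise SameLength es fs →
           (∀ σ → σ v ≡ v′ → σ w ≡ w′ → Pointwise (Corresponding σ) es fs) →
           Matching (v ∷ w ∷ []) es (v′ ∷ w′ ∷ []) fs
  match₂ lens corr = cong (2 ℕ.+_) (interiors-length lens) ,
    λ σ eq → arcs-correspond σ
      (corr σ (List.∷-injectiveˡ eq) (List.∷-injectiveˡ (List.∷-injectiveʳ eq)))
      (List.∷-injectiveʳ (List.∷-injectiveʳ eq))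

-- Separation of the normal forms by their values at 10

module Separation where
  open Decimal

  private
    Gap : ℕ → ℕ → Set
    Gap a b = ∃ λ i → a ℕ.+ i ≡ b

  gap : ∀ {a b} → a ≤ b → Gap a b
  gap a≤b = ℕ.m≤n⇒∃[o]m+o≡n a≤b

  figureEight-lengths : ∀ {a b a′ b′} → Gap a b → Gap a′ b′ →
    dumbbellℤ (w a) (w b) 1ℤ ≡ dumbbellℤ (w a′) (w b′) 1ℤ → a ≡ a′ × b ≡ b′
  figureEight-lengths {a} {_} {a′} (i , ≡.refl) (i′ , ≡.refl) eq =
    proj₁ same , cong₂ ℕ._+_ (proj₁ same) (proj₂ same)
    where same = figureEight-injective a i a′ i′ eq

  dumbbell-lengths : ∀ {a b l a′ b′ l′} → Gap a b → Gap a′ b′ →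
    dumbbellℤ (w a) (w b) (w l) ≡ dumbbellℤ (w a′) (w b′) (w l′) → a ≡ a′ × b ≡ b′ × l ≡ l′
  dumbbell-lengths {a} {_} {l} {a′} {_} {l′} (i , ≡.refl) (i′ , ≡.refl) eq =
    proj₁ same , cong₂ ℕ._+_ (proj₁ same) (proj₁ (proj₂ same)) , proj₂ (proj₂ same)
    where same = dumbbell-injective a i l a′ i′ l′ eq

  theta-lengths : ∀ {a b c a′ b′ c′} → Gap a b → Gap b c → Gap a′ b′ → Gap b′ c′ →
    thetaℤ (w a) (w b) (w c) ≡ thetaℤ (w a′) (w b′) (w c′) → a ≡ a′ × b ≡ b′ × c ≡ c′
  theta-lengths {a} {_} {_} {a′} (i , ≡.refl) (j , ≡.refl) (i′ , ≡.refl) (j′ , ≡.refl) eq =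
    proj₁ same , b≡ , cong₂ ℕ._+_ b≡ (proj₂ (proj₂ same))
    where
    same = theta-injective a i j a′ i′ j′ eq
    b≡   = cong₂ ℕ._+_ (proj₁ same) (proj₁ (proj₂ same))

  figureEight-not-dumbbell : ∀ {a b a′ b′ l′} → Gap a b → Gap a′ b′ →
    dumbbellℤ (w a) (w b) 1ℤ ≢ dumbbellℤ (w a′) (w b′) (w l′)
  figureEight-not-dumbbell {a} {_} {a′} {_} {l′} (i , ≡.refl) (i′ , ≡.refl) = figureEight≢dumbbell a i a′ i′ l′

  figureEight-not-theta : ∀ {a b a′ b′ c′} → Gap a b → Gap a′ b′ → Gap b′ c′ →
    dumbbellℤ (w a) (w b) 1ℤ ≢ thetaℤ (w a′) (w b′) (w c′)
  figureEight-not-theta {a} {_} {a′} (i , ≡.refl) (i′ , ≡.refl) (j′ , ≡.refl) = figureEight≢theta a i a′ i′ j′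

  dumbbell-not-theta : ∀ {a b l a′ b′ c′} → Gap a b → Gap a′ b′ → Gap b′ c′ →
    dumbbellℤ (w a) (w b) (w l) ≢ thetaℤ (w a′) (w b′) (w c′)
  dumbbell-not-theta {a} {_} {l} {a′} (i , ≡.refl) (i′ , ≡.refl) (j′ , ≡.refl) = dumbbell≢theta a i l a′ i′ j′

  value : ∀ {V : Set} {vs : List V} {es} → Normal vs es → ℤ
  value (figureEight v xs ys _)        = dumbbellℤ (w (length xs)) (w (length ys)) 1ℤ
  value (dumbbell v _ xs ys zs _ _)    = dumbbellℤ (w (length xs)) (w (length ys)) (w (length zs))
  value (theta v _ xs ys zs _ _ _)     = thetaℤ (w (length xs)) (w (length ys)) (w (length zs))

  value-matching : ∀ {V W : Set} {vs : List V} {es} {ws : List W} {fs}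
                   (n : Normal vs es) (n′ : Normal ws fs) → value n ≡ value n′ → Matching vs es ws fs
  value-matching (figureEight _ xs ys x≤y) (figureEight _ xs′ ys′ x≤y′) eq =
    match₁ (x≡ ∷ y≡ ∷ []) (λ σ v → (v , x≡ , v) ∷ (v , y≡ , v) ∷ [])
    where
    lengths = figureEight-lengths (gap x≤y) (gap x≤y′) eq
    x≡ = proj₁ lengths
    y≡ = proj₂ lengths
  value-matching (dumbbell _ _ xs ys zs _ x≤y) (dumbbell _ _ xs′ ys′ zs′ _ x≤y′) eq =
    match₂ (x≡ ∷ y≡ ∷ z≡ ∷ []) (λ σ v w → (v , x≡ , v) ∷ (w , y≡ , w) ∷ (v , z≡ , w) ∷ [])
    where
    lengths = dumbbell-lengths {l = length zs} {l′ = length zs′} (gap x≤y) (gap x≤y′) eq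
    x≡ = proj₁ lengths
    y≡ = proj₁ (proj₂ lengths)
    z≡ = proj₂ (proj₂ lengths)
  value-matching (theta _ _ xs ys zs _ x≤y y≤z) (theta _ _ xs′ ys′ zs′ _ x≤y′ y≤z′) eq =
    match₂ (x≡ ∷ y≡ ∷ z≡ ∷ []) (λ σ v w → (v , x≡ , w) ∷ (v , y≡ , w) ∷ (v , z≡ , w) ∷ [])
    where
    lengths = theta-lengths (gap x≤y) (gap y≤z) (gap x≤y′) (gap y≤z′) eq
    x≡ = proj₁ lengths
    y≡ = proj₁ (proj₂ lengths)
    z≡ = proj₂ (proj₂ lengths)
  value-matching (figureEight _ xs ys x≤y) (dumbbell _ _ xs′ ys′ zs′ _ x≤y′) eq =
    contradiction eq (figureEight-not-dumbbell {l′ = length zs′} (gap x≤y) (gap x≤y′))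
  value-matching (figureEight _ xs ys x≤y) (theta _ _ xs′ ys′ zs′ _ x≤y′ y≤z′) eq =
    contradiction eq (figureEight-not-theta (gap x≤y) (gap x≤y′) (gap y≤z′))
  value-matching (dumbbell _ _ xs ys zs _ x≤y) (figureEight _ xs′ ys′ x≤y′) eq =
    contradiction (sym eq) (figureEight-not-dumbbell {l′ = length zs} (gap x≤y′) (gap x≤y))
  value-matching (dumbbell _ _ xs ys zs _ x≤y) (theta _ _ xs′ ys′ zs′ _ x≤y′ y≤z′) eq =
    contradiction eq (dumbbell-not-theta {l = length zs} (gap x≤y) (gap x≤y′) (gap y≤z′))
  value-matching (theta _ _ xs ys zs _ x≤y y≤z) (figureEight _ xs′ ys′ x≤y′) eq =
    contradiction (sym eq) (figureEight-not-theta (gap x≤y′) (gap x≤y) (gap y≤z))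
  value-matching (theta _ _ xs ys zs _ x≤y y≤z) (dumbbell _ _ xs′ ys′ zs′ _ x≤y′) eq =
    contradiction (sym eq) (dumbbell-not-theta {l = length zs′} (gap x≤y′) (gap x≤y) (gap y≤z))

module AtTen (P : IntegerPoint 8) where
  open IntegerPoint P
  open WeightedZeta point
  open Decimal using (10ℤ; 4ℤ; w; dumbbellℤ; thetaℤ)
  open Separation using (value)

  weight≡ι : ∀ k → weight k ≡ ι (w k)
  weight≡ι k = ≡.trans (cong (_^ suc k) u≡ι) (sym (ι-^ algebra 10ℤ (suc k)))

  ι-dumbbell : ∀ x y z → ι (dumbbellℤ x y z) ≡ WeightedZeta.dumbbell point (ι x) (ι y) (ι z)
  ι-dumbbell x y z = ≡.trans (ι-* ((1ℤ ℤ.- x) ℤ.* (1ℤ ℤ.- y)) _) (cong₂ _*_ linear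
    (≡.trans (ι-- algebra ((1ℤ ℤ.- x) ℤ.* (1ℤ ℤ.- y)) (4ℤ ℤ.* (x ℤ.* y ℤ.* (z ℤ.* z))))
      (cong₂ _-_ linear (≡.trans (ι-* 4ℤ (x ℤ.* y ℤ.* (z ℤ.* z))) (cong (ι 4ℤ *_)
        (≡.trans (ι-* (x ℤ.* y) (z ℤ.* z)) (cong₂ _*_ (ι-* x y) (ι-* z z))))))))
    where
    linear : ι ((1ℤ ℤ.- x) ℤ.* (1ℤ ℤ.- y)) ≡ (1# - ι x) * (1# - ι y)
    linear = ≡.trans (ι-* (1ℤ ℤ.- x) (1ℤ ℤ.- y)) (cong₂ _*_ (ι-- algebra 1ℤ x) (ι-- algebra 1ℤ y))

  ι-theta : ∀ x y z → ι (thetaℤ x y z) ≡ WeightedZeta.theta point (ι x) (ι y) (ι z)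
  ι-theta x y z = ≡.trans (ι-- algebra (S ℤ.* S) (4ℤ ℤ.* (xyz ℤ.* xyz))) (cong₂ _-_
    (≡.trans (ι-* S S) (cong₂ _*_ S≡ S≡))
    (≡.trans (ι-* 4ℤ (xyz ℤ.* xyz)) (cong (ι 4ℤ *_) (≡.trans (ι-* xyz xyz) (cong₂ _*_ xyz≡ xyz≡)))))
    where
    S xyz : ℤ
    S   = 1ℤ ℤ.- x ℤ.* y ℤ.- x ℤ.* z ℤ.- y ℤ.* z
    xyz = x ℤ.* y ℤ.* z
    xyz≡ : ι xyz ≡ ι x * ι y * ι z
    xyz≡ = ≡.trans (ι-* (x ℤ.* y) z) (cong (_* ι z) (ι-* x y))
    S≡ : ι S ≡ 1# - ι x * ι y - ι x * ι z - ι y * ι z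
    S≡ = ≡.trans (ι-- algebra (1ℤ ℤ.- x ℤ.* y ℤ.- x ℤ.* z) (y ℤ.* z)) (cong₂ _-_
      (≡.trans (ι-- algebra (1ℤ ℤ.- x ℤ.* y) (x ℤ.* z)) (cong₂ _-_
        (≡.trans (ι-- algebra 1ℤ (x ℤ.* y)) (cong (λ t → 1# - t) (ι-* x y))) (ι-* x z))) (ι-* y z))

  Z-normal : ∀ {V : Set} (_≟_ : DecidableEquality V) {vs es} (n : Normal vs es) →
             Z _≟_ vs es ≡ ι (value n)
  Z-normal _≟_ (figureEight v xs ys _) = ≡.trans (Z-figureEight _≟_ v xs ys)
    (≡.trans (cong₂ (λ x y → WeightedZeta.dumbbell point x y 1#) (weight≡ι (length xs)) (weight≡ι (length ys)))
             (sym (ι-dumbbell (w (length xs)) (w (length ys)) 1ℤ)))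
  Z-normal _≟_ (dumbbell v v′ xs ys zs v≢v′ _) = ≡.trans (Z-dumbbell _≟_ v≢v′ xs ys zs)
    (≡.trans (cong₂ (λ x y → WeightedZeta.dumbbell point x y (weight (length zs)))
                (weight≡ι (length xs)) (weight≡ι (length ys)))
      (≡.trans (cong (WeightedZeta.dumbbell point (ι (w (length xs))) (ι (w (length ys)))) (weight≡ι (length zs)))
               (sym (ι-dumbbell (w (length xs)) (w (length ys)) (w (length zs))))))
  Z-normal _≟_ (theta v v′ xs ys zs v≢v′ _ _) = ≡.trans (Z-theta _≟_ v≢v′ xs ys zs)
    (≡.trans (cong₂ (λ x y → WeightedZeta.theta point x y (weight (length zs)))
                (weight≡ι (length xs)) (weight≡ι (length ys)))
      (≡.trans (cong (WeightedZeta.theta point (ι (w (length xs))) (ι (w (length ys)))) (weight≡ι (length zs)))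
               (sym (ι-theta (w (length xs)) (w (length ys)) (w (length zs))))))

-- Presentations of graphs and the two implications

record Presentation (G : Graph) (vs : List (Fin (#V G))) (es : List (Arc (Fin (#V G)))) : Set where
  field
    vertices : support vs es ↭ allFin (#V G)
    edges    : tabulate (ends G) ↭ᴱ concatMap edgesOf es

-- The relabelling of the supports is the vertex bijection. It carries the multiset of edges of `G`
-- to that of `H` up to orientation, and the edge bijection is extracted from this permutation,
-- parallel edges included.
matching⇒≅ : ∀ {G H vs es ws fs} → Presentation G vs es → Presentation H ws fs →
             Matching vs es ws fs → G ≅ H
matching⇒≅ {G} {H} {vs} {es} {ws} {fs} P Q (len , match) = record
  { vertices  = σ
  ; edges     = proj₁ π
  ; incidence = λ e → joins (proj₂ π e) }
  where
  module P = Presentation P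
  module Q = Presentation Q
  module E = PermS (edgeSetoid (Fin (#V H)))
  relabel = relabelling (support vs es) (support ws fs) P.vertices Q.vertices len
  σ = proj₁ relabel
  σ² : Fin (#V G) × Fin (#V G) → Fin (#V H) × Fin (#V H)
  σ² = Product.map (σ ⟨$⟩ʳ_) (σ ⟨$⟩ʳ_)

  same-edges : tabulate (σ² ∘ ends G) ↭ᴱ tabulate (ends H)
  same-edges = begin
    tabulate (σ² ∘ ends G)                         ≡⟨ List.map-tabulate (ends G) σ² ⟨
    map σ² (tabulate (ends G))
      ↭⟨ PermSP.map⁺ (edgeSetoid (Fin (#V G))) (edgeSetoid (Fin (#V H))) σ²-cong P.edges ⟩
    map σ² (concatMap edgesOf es)                  ≡⟨ edges-map (σ ⟨$⟩ʳ_) es ⟩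
    concatMap edgesOf (map (mapArc (σ ⟨$⟩ʳ_)) es)
      ≡⟨ cong (concatMap edgesOf) (match (σ ⟨$⟩ʳ_) (proj₂ relabel)) ⟩
    concatMap edgesOf fs                           ↭⟨ Q.edges ⟨
    tabulate (ends H)                              ∎
    where
    open E.PermutationReasoning
    σ²-cong : ∀ {e f} → SameEdge e f → SameEdge (σ² e) (σ² f)
    σ²-cong (inj₁ ≡.refl) = inj₁ ≡.refl
    σ²-cong (inj₂ ≡.refl) = inj₂ ≡.refl

  π : ∃ λ (π : Permutation (#E G) (#E H)) → ∀ e → SameEdge (σ² (ends G e)) (ends H (π ⟨$⟩ʳ e))
  π = tabulate-↭ (edgeSetoid (Fin (#V H))) (σ² ∘ ends G) (ends H) same-edges

  joins : ∀ {i j e} → SameEdge (i , j) (ends H e) → Joins H i j e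
  joins (inj₁ eq) = inj₁ (sym eq)
  joins (inj₂ eq) = inj₂ (cong Product.swap (sym eq))

module _ (G : Graph) (connected : Connected G) (no-leaf : NoDegreeOne G) (rank≡2 : rank G ≡ ℤ.+ 2) where
  open GraphArcs G using (arcs; arcs-wellFormed; interiors-arcs; edges-arcs)

  present : (𝒫 : Point) → ∃ λ vs → ∃ λ es → Normal vs es × Presentation G vs es ×
            GraphZeta.Z-graph G connected no-leaf rank≡2 𝒫 ≡ WeightedZeta.Z 𝒫 Fin._≟_ vs es
  present 𝒫 = vs , es , proj₁ (proj₂ (proj₂ form)) , record
    { vertices = subst (support vs es ↭_)
        (≡.trans (cong (allFin (#V G) ++_) (interiors-arcs (allFin (#E G)))) (List.++-identityʳ _))
        (↭-sym same.vertices)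
    ; edges    = subst (_↭ᴱ concatMap edgesOf es)
        (≡.trans (edges-arcs (allFin (#E G))) (List.map-tabulate id (ends G))) same.edges
    } , same.zeta
    where
    open Classification 𝒫 {Fin (#V G)} Fin._≟_
    form = normalise (#V G) (List.length-tabulate id) (arcs-wellFormed connected no-leaf rank≡2)
    vs = proj₁ form
    es = proj₁ (proj₂ form)
    module same = SameGraph (proj₂ (proj₂ (proj₂ form)))

open import Data.Integer.Base using (+_)

theorem3 : (G₁ G₂ : Graph) →
    Connected G₁ → NoDegreeOne G₁ → rank G₁ ≡ + 2 →
    Connected G₂ → NoDegreeOne G₂ → rank G₂ ≡ + 2 →
    (G₁ ≅ G₂) ⇔ (ζ G₁ ≃ ζ G₂)
theorem3 G₁ G₂ c₁ l₁ r₁ c₂ l₂ r₂ = mk⇔ forward backward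
  where
  module ζ₁ = GraphZeta G₁ c₁ l₁ r₁
  module ζ₂ = GraphZeta G₂ c₂ l₂ r₂

  -- The numerator of ζ is the denominator of ζ⁻¹, which is 1 in rank two. Each cross product thus
  -- evaluates to the weighted zeta value of the other graph, and the indices trade places.
  crossed₁ crossed₂ : Poly
  crossed₁ = num (ζ G₁) *ₚ den (ζ G₂)
  crossed₂ = num (ζ G₂) *ₚ den (ζ G₁)

  module _ (𝒫 : Point) where
    open Point 𝒫
    open Evaluation algebra u

    ⟦crossed₁⟧ : ⟦ crossed₁ ⟧ ≡ ζ₂.Z-graph 𝒫
    ⟦crossed₁⟧ = ≡.trans (⟦⟧-* (num (ζ G₁)) (den (ζ G₂)))
      (≡.trans (cong₂ _*_ (ζ₁.⟦den⟧ 𝒫) (ζ₂.⟦num⟧ 𝒫)) (*-identityˡ _))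

    ⟦crossed₂⟧ : ⟦ crossed₂ ⟧ ≡ ζ₁.Z-graph 𝒫
    ⟦crossed₂⟧ = ≡.trans (⟦⟧-* (num (ζ G₂)) (den (ζ G₁)))
      (≡.trans (cong₂ _*_ (ζ₂.⟦den⟧ 𝒫) (ζ₁.⟦num⟧ 𝒫)) (*-identityˡ _))

  forward : G₁ ≅ G₂ → ζ G₁ ≃ ζ G₂
  forward G₁≅G₂ = eval-injective crossed₁ crossed₂ λ N →
    let open IntegerPoint (integerPoint N) in
    ι-injective (≡.trans (sym (⟦⟧-eval (integerPoint N) crossed₁))
      (≡.trans (⟦crossed₁⟧ point) (≡.trans (sym (≅⇒Z≡ G₁≅G₂ point))
        (≡.trans (sym (⟦crossed₂⟧ point)) (⟦⟧-eval (integerPoint N) crossed₂)))))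

  backward : ζ G₁ ≃ ζ G₂ → G₁ ≅ G₂
  backward ζ≃ = matching⇒≅ p₁ p₂ (Separation.value-matching n₁ n₂ (ι-injective
    (≡.trans (sym (AtTen.Z-normal ten Fin._≟_ n₁)) (≡.trans (sym z₁) (≡.trans (sym (⟦crossed₂⟧ point))
      (≡.trans (Evaluation.⟦⟧-cong algebra u crossed₂ crossed₁ (sym ∘ ζ≃))
        (≡.trans (⟦crossed₁⟧ point) (≡.trans z₂ (AtTen.Z-normal ten Fin._≟_ n₂)))))))))
    where
    -- The point is 2 + 8 = 10.
    ten = integerPoint 8
    open IntegerPoint ten
    present₁ = present G₁ c₁ l₁ r₁ point
    present₂ = present G₂ c₂ l₂ r₂ point
    n₁ = proj₁ (proj₂ (proj₂ present₁))
    n₂ = proj₁ (proj₂ (proj₂ present₂))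
    p₁ = proj₁ (proj₂ (proj₂ (proj₂ present₁)))
    p₂ = proj₁ (proj₂ (proj₂ (proj₂ present₂)))
    z₁ = proj₂ (proj₂ (proj₂ (proj₂ present₁)))
    z₂ = proj₂ (proj₂ (proj₂ (proj₂ present₂)))
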